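{- For all positive integers $m$ and $k$, the alternating multiple zeta values $$\zeta\left(\bar1,\{1\}_{m-1},\bar1\right)\quad\text{and}\quad\zeta\left(\bar1,\{1\}_{m-1},2,\{1\}_{k-1}\right)$$ are expressible in terms of zeta values, polylogarithms (at $\tfrac12$) and $\ln2$; that is, each of them is a rational linear combination of products of numbers from the set $\{\ln2\}\cup\{\zeta(n):n\ge2\}\cup\{\mathrm{Li}_n(\tfrac12):n\ge1\}$.
   Context: Notation. $\{1\}_r$ denotes the string of $r$ entries equal to $1$ (empty if $r=0$). For positive integers $s_1,\dots,s_r$, $\zeta(s_1,\dots,s_r):=\lim_{n\to\infty}\sum_{n\ge k_1>\cdots>k_r\ge1}\frac{1}{k_1^{s_1}\cdots k_r^{s_r}}$, and a bar over an entry $s_j$ means that the factor $(-1)^{k_j}$ is inserted in the summand; e.g. $\zeta(\bar1,\{1\}_{m-1},\bar1)=\lim_{n\to\infty}\sum_{n\ge k_1>\cdots>k_{m+1}\ge1}\frac{(-1)^{k_1+k_{m+1}}}{k_1\cdots k_{m+1}}$. $\zeta(n)$ is the Riemann zeta value and $\mathrm{Li}_p(x):=\sum_{n\ge1}x^n/n^p$. -}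

module Defs where

open import Data.Integer.Base using (+_)
open import Data.List.Base using (List; []; _∷_; foldr)
open import Data.List.NonEmpty.Base using (List⁺; foldr₁)
import Data.List.NonEmpty.Base as List⁺
open import Data.Nat.Base as ℕ using (ℕ; zero; suc)
import Data.Nat.Properties as ℕ
open import Data.Product.Base using (Σ; ∃; _×_; _,_; proj₁)
open import Data.Rational.Base
open import Data.Rational.Properties
open import Data.Rational.Solver using (module +-*-Solver)
open import Relation.Binary.PropositionalEquality

open import Algebra.Definitions.RawSemiring +-*-rawSemiring using (_^_)

-- Real numbers: Cauchy sequences of rationals, considered up to _≃ᴿ_.

Cauchy : (ℕ → ℚ) → Set
Cauchy u = ∀ ε → 0ℚ < ε →
  ∃ λ N → ∀ m n → N ℕ.≤ m → N ℕ.≤ n → ∣ u m - u n ∣ < ε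

record ℝ : Set where
  constructor mkℝ
  field
    seq    : ℕ → ℚ
    cauchy : Cauchy seq

open ℝ public

-- For Cauchy v, the real number represented by v is the limit of u
-- exactly when u n - v n → 0; so this serves both for equality of reals and
-- for convergence of a rational sequence to a real.
Asymptotic : (ℕ → ℚ) → (ℕ → ℚ) → Set
Asymptotic u v = ∀ ε → 0ℚ < ε →
  ∃ λ N → ∀ n → N ℕ.≤ n → ∣ u n - v n ∣ < ε

infix 4 _≃ᴿ_ _⟶_

_≃ᴿ_ : ℝ → ℝ → Set
x ≃ᴿ y = Asymptotic (seq x) (seq y)

_⟶_ : (ℕ → ℚ) → ℝ → Set
u ⟶ x = Asymptotic u (seq x)

fromℚ : ℚ → ℝ
fromℚ q = mkℝ (λ _ → q) λ ε 0<ε →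
  0 , λ _ _ _ _ → subst (_< ε) (sym (cong ∣_∣ (+-inverseʳ q))) 0<ε

private
  half>0 : ∀ ε → 0ℚ < ε → 0ℚ < ½ * ε
  half>0 ε 0<ε = subst (_< ½ * ε) (*-zeroʳ ½) (*-monoʳ-<-pos ½ {0ℚ} {ε} 0<ε)

  halves : ∀ ε → ½ * ε + ½ * ε ≡ ε
  halves ε = trans (sym (*-distribʳ-+ ε ½ ½)) (*-identityˡ ε)

  +-diff : ∀ a b c d → (a + b) - (c + d) ≡ (a - c) + (b - d)
  +-diff = solve 4 (λ a b c d →
    (a :+ b) :- (c :+ d) := (a :- c) :+ (b :- d)) refl
    where open +-*-Solver

  *-diff : ∀ a b c d → a * b - c * d ≡ a * (b - d) + d * (a - c)
  *-diff = solve 4 (λ a b c d →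
    a :* b :- c :* d := a :* (b :- d) :+ d :* (a :- c)) refl
    where open +-*-Solver

  split : ∀ a b → a ≡ b + (a - b)
  split = solve 2 (λ a b → a := b :+ (a :- b)) refl
    where open +-*-Solver

  +-cauchy : ∀ u v → Cauchy u → Cauchy v → Cauchy (λ n → u n + v n)
  +-cauchy u v cu cv ε 0<ε
    with M , hM ← cu (½ * ε) (half>0 ε 0<ε)
    with N , hN ← cv (½ * ε) (half>0 ε 0<ε) = M ℕ.⊔ N , λ m n p q → begin-strict
      ∣ (u m + v m) - (u n + v n) ∣    ≡⟨ cong ∣_∣ (+-diff (u m) (v m) (u n) (v n)) ⟩
      ∣ (u m - u n) + (v m - v n) ∣    ≤⟨ ∣p+q∣≤∣p∣+∣q∣ (u m - u n) (v m - v n) ⟩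
      ∣ u m - u n ∣ + ∣ v m - v n ∣
        <⟨ +-mono-< {∣ u m - u n ∣} {½ * ε} {∣ v m - v n ∣} {½ * ε}
                    (hM m n (ℕ.m⊔n≤o⇒m≤o M N p) (ℕ.m⊔n≤o⇒m≤o M N q))
                    (hN m n (ℕ.m⊔n≤o⇒n≤o M N p) (ℕ.m⊔n≤o⇒n≤o M N q)) ⟩
      ½ * ε + ½ * ε                    ≡⟨ halves ε ⟩
      ε                                ∎
    where open ≤-Reasoning

  bounded : ∀ u → Cauchy u →
    ∃ λ B → 0ℚ < B × ∃ λ N → ∀ n → N ℕ.≤ n → ∣ u n ∣ ≤ B
  bounded u cu with N , h ← cu 1ℚ (positive⁻¹ 1ℚ) =
    ∣ u N ∣ + 1ℚ ,
    +-mono-≤-< {0ℚ} {∣ u N ∣} {0ℚ} {1ℚ} (0≤∣p∣ (u N)) (positive⁻¹ 1ℚ) ,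
    N , λ n p → begin
      ∣ u n ∣                  ≡⟨ cong ∣_∣ (split (u n) (u N)) ⟩
      ∣ u N + (u n - u N) ∣    ≤⟨ ∣p+q∣≤∣p∣+∣q∣ (u N) (u n - u N) ⟩
      ∣ u N ∣ + ∣ u n - u N ∣  ≤⟨ +-monoʳ-≤ ∣ u N ∣ {∣ u n - u N ∣} {1ℚ} (<⇒≤ (h n N p ℕ.≤-refl)) ⟩
      ∣ u N ∣ + 1ℚ             ∎
    where open ≤-Reasoning

  scale : ∀ B ε → 0ℚ < B → 0ℚ < ε → ∃ λ δ → 0ℚ < δ × B * δ ≡ ε
  scale B ε 0<B 0<ε = 1/B * ε
    , subst (_< 1/B * ε) (*-zeroʳ 1/B) (*-monoʳ-<-pos 1/B {{1/pos⇒pos B}} {0ℚ} {ε} 0<ε)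
    , trans (sym (*-assoc B 1/B ε))
        (trans (cong (_* ε) (*-inverseʳ B)) (*-identityˡ ε))
    where
    instance
      posB : Positive B
      posB = positive 0<B
      nonZeroB : NonZero B
      nonZeroB = pos⇒nonZero B
    1/B = 1/ B

  ∣a*d∣< : ∀ B δ a d → 0ℚ < B → ∣ a ∣ ≤ B → ∣ d ∣ < δ → ∣ a * d ∣ < B * δ
  ∣a*d∣< B δ a d 0<B a≤B d<δ = begin-strict
    ∣ a * d ∣      ≡⟨ ∣p*q∣≡∣p∣*∣q∣ a d ⟩
    ∣ a ∣ * ∣ d ∣  ≤⟨ *-monoʳ-≤-nonNeg ∣ d ∣ {{∣-∣-nonNeg d}} {∣ a ∣} {B} a≤B ⟩
    B * ∣ d ∣      <⟨ *-monoʳ-<-pos B {{positive 0<B}} {∣ d ∣} {δ} d<δ ⟩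
    B * δ          ∎
    where open ≤-Reasoning

  *-close : ∀ a b c d B C δ η → 0ℚ < B → 0ℚ < C → ∣ a ∣ ≤ B → ∣ d ∣ ≤ C →
    ∣ b - d ∣ < δ → ∣ a - c ∣ < η → ∣ a * b - c * d ∣ < B * δ + C * η
  *-close a b c d B C δ η 0<B 0<C a≤B d≤C b-d a-c = begin-strict
    ∣ a * b - c * d ∣                      ≡⟨ cong ∣_∣ (*-diff a b c d) ⟩
    ∣ a * (b - d) + d * (a - c) ∣          ≤⟨ ∣p+q∣≤∣p∣+∣q∣ (a * (b - d)) (d * (a - c)) ⟩
    ∣ a * (b - d) ∣ + ∣ d * (a - c) ∣
      <⟨ +-mono-< {∣ a * (b - d) ∣} {B * δ} {∣ d * (a - c) ∣} {C * η}
                  (∣a*d∣< B δ a (b - d) 0<B a≤B b-d)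
                  (∣a*d∣< C η d (a - c) 0<C d≤C a-c) ⟩
    B * δ + C * η                          ∎
    where open ≤-Reasoning

  *-cauchy : ∀ u v → Cauchy u → Cauchy v → Cauchy (λ n → u n * v n)
  *-cauchy u v cu cv ε 0<ε =
    let B , 0<B , K , hB = bounded u cu
        C , 0<C , L , hC = bounded v cv
        δ , 0<δ , Bδ = scale B (½ * ε) 0<B (half>0 ε 0<ε)
        η , 0<η , Cη = scale C (½ * ε) 0<C (half>0 ε 0<ε)
        M , hM = cv δ 0<δ
        N , hN = cu η 0<η
    in (K ℕ.⊔ L) ℕ.⊔ (M ℕ.⊔ N) , λ m n p q →
      let pKL = ℕ.m⊔n≤o⇒m≤o (K ℕ.⊔ L) (M ℕ.⊔ N) p
          qKL = ℕ.m⊔n≤o⇒m≤o (K ℕ.⊔ L) (M ℕ.⊔ N) q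
          pMN = ℕ.m⊔n≤o⇒n≤o (K ℕ.⊔ L) (M ℕ.⊔ N) p
          qMN = ℕ.m⊔n≤o⇒n≤o (K ℕ.⊔ L) (M ℕ.⊔ N) q
      in subst (∣ u m * v m - u n * v n ∣ <_)
           (trans (cong₂ _+_ Bδ Cη) (halves ε))
           (*-close (u m) (v m) (u n) (v n) B C δ η 0<B 0<C
             (hB m (ℕ.m⊔n≤o⇒m≤o K L pKL)) (hC n (ℕ.m⊔n≤o⇒n≤o K L qKL))
             (hM m n (ℕ.m⊔n≤o⇒m≤o M N pMN) (ℕ.m⊔n≤o⇒m≤o M N qMN))
             (hN m n (ℕ.m⊔n≤o⇒n≤o M N pMN) (ℕ.m⊔n≤o⇒n≤o M N qMN)))

infixl 6 _+ᴿ_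
infixl 7 _*ᴿ_

_+ᴿ_ : ℝ → ℝ → ℝ
x +ᴿ y = mkℝ (λ n → seq x n + seq y n) (+-cauchy (seq x) (seq y) (cauchy x) (cauchy y))

_*ᴿ_ : ℝ → ℝ → ℝ
x *ᴿ y = mkℝ (λ n → seq x n * seq y n) (*-cauchy (seq x) (seq y) (cauchy x) (cauchy y))

∑ : ℕ → ((k : ℕ) → .{{ℕ.NonZero k}} → ℚ) → ℚ
∑ zero    f = 0ℚ
∑ (suc n) f = ∑ n f + f (suc n)

1/_^ᴺ_ : (k s : ℕ) → .{{ℕ.NonZero k}} → ℚ
1/ k ^ᴺ s = _/_ (+ 1) (k ℕ.^ s) {{ℕ.m^n≢0 k s}}

-- An argument of a multiple zeta value; bar s is s with a bar over it.
data Entry : Set where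
  plain bar : (s : ℕ) → .{{ℕ.NonZero s}} → Entry

factor : Entry → (k : ℕ) → .{{ℕ.NonZero k}} → ℚ
factor (plain s) k = 1/ k ^ᴺ s
factor (bar s)   k = (- 1ℚ) ^ k * 1/ k ^ᴺ s

-- The sum over n ≥ k₁ > ⋯ > kᵣ ≥ 1: once k₁ = k is chosen, the remaining
-- indices range over k - 1 ≥ k₂ > ⋯ > kᵣ ≥ 1.
mzvPartial : List Entry → ℕ → ℚ
mzvPartial []       n = 1ℚ
mzvPartial (s ∷ ss) n = ∑ n λ k → factor s k * mzvPartial ss (ℕ.pred k)

zetaPartial : ℕ → ℕ → ℚ
zetaPartial s n = ∑ n λ k → 1/ k ^ᴺ s

liPartial : ℕ → ℚ → ℕ → ℚ
liPartial p x n = ∑ n λ k → x ^ k * 1/ k ^ᴺ p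

-- ln 2 is the integral of 1/t over [1, 2]. Its right Riemann sum on n equal
-- subintervals is ∑ (1/n) · 1/(1 + k/n) = ∑ 1/(n + k), over 1 ≤ k ≤ n.
ln2Riemann : ℕ → ℚ
ln2Riemann n = ∑ n λ k → _/_ (+ 1) (k ℕ.+ n) {{k+n≢0 k}}
  where
  k+n≢0 : ∀ k → .{{ℕ.NonZero k}} → ℕ.NonZero (k ℕ.+ n)
  k+n≢0 (suc _) = _

-- The set {ln 2} ∪ {ζ(n) : n ≥ 2} ∪ {Liₙ(1/2) : n ≥ 1}, as a predicate
-- on reals.
data Generator (x : ℝ) : Set where
  isLn2  : ln2Riemann ⟶ x → Generator x
  isZeta : ∀ n → 2 ℕ.≤ n → zetaPartial n ⟶ x → Generator x
  isLi   : ∀ n → 1 ℕ.≤ n → liPartial n ½ ⟶ x → Generator x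

-- Products have at least one factor, so a rational constant is not
-- automatically such a combination.
product : List⁺ (Σ ℝ Generator) → ℝ
product gs = foldr₁ _*ᴿ_ (List⁺.map proj₁ gs)

linearCombination : List (ℚ × List⁺ (Σ ℝ Generator)) → ℝ
linearCombination = foldr (λ (q , gs) x → fromℚ q *ᴿ product gs +ᴿ x) (fromℚ 0ℚ)

Expressible : ℝ → Set
Expressible x = ∃ λ ts → x ≃ᴿ linearCombination ts

-- The value ζ(ss), defined as a limit, exists and is expressible.
ExpressibleMZV : List Entry → Set
ExpressibleMZV ss = ∃ λ x → mzvPartial ss ⟶ x × Expressible x

{-# OPTIONS --safe #-}

-- Both values are iterated integrals over [0, 1] of the forms dt / (1 + t),
-- dt / (1 - t) and dt / t. The substitutions s = t / (1 + t), respectively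
-- s = (1 - t) / 2, turn them into polynomials in ln 2 and the integrals
-- Zₚ = ∫ (- ln (1 - s))ᵖ / p! · ds / s over [0, ½]. Splitting the corresponding
-- integral for ζ(p + 1) at s = ½ expresses Zₚ by ζ(p + 1), powers of ln 2 and
-- the values Liⱼ(½).
--
-- All this is carried out on finite sums, in the manner of Maesaka, Seki and
-- Watanabe: on a grid the iterated integrals become multiple sums, and the
-- expansions in powers of t satisfy exact recursions as soon as tᵏ is replaced
-- by a quotient of a falling and a rising factorial. At t = 1 this quotient is
-- C(2n, n + k) / C(2n, n), and inserting it as a weight into a convergent series
-- does not change the limit. Only products of logarithms and the form
-- dt / (1 - t) contribute errors, which tend to 0.

module Submission where

open import Defs
open import Data.Empty using (⊥-elim)
import Data.Integer.Base as ℤ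
import Data.Integer.Properties as ℤ
open import Data.List.Base using (List; []; _∷_; _++_; replicate; map; length)
open import Data.List.NonEmpty.Base as List⁺ using (List⁺; _⁺++⁺_)
open import Data.Nat.Base as ℕ using (ℕ; zero; suc; z≤n; s≤s; NonZero; pred)
import Data.Nat.Properties as ℕ
open import Data.Product.Base using (Σ; ∃; _×_; _,_; proj₁; proj₂)
open import Data.Rational.Base as ℚ
  using (ℚ; mkℚ; 0ℚ; 1ℚ; ½; _/_; _+_; _*_; _-_; -_; ∣_∣; _≤_; _<_; *≤*; *<*; Positive; positive; nonNegative; toℚᵘ)
open import Data.Rational.Properties
open import Data.Rational.Solver using (module +-*-Solver)
open import Data.Rational.Unnormalised.Base as ℚᵘ using (mkℚᵘ)
import Data.Rational.Unnormalised.Properties as ℚᵘ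
open import Data.Sum.Base using (inj₁; inj₂)
open import Relation.Binary.Definitions using (tri<; tri≈; tri>)
open import Relation.Binary.PropositionalEquality hiding (J)
open +-*-Solver using (solve; con; _:+_; _:*_; _:-_; :-_; _:=_)
open import Algebra.Definitions.RawSemiring +-*-rawSemiring using (_^_)

-- A real number is given here by a rational sequence, so identities between integrals must become
-- identities between finite sums at the same n. One grid serves both substitutions: [0, 1] is cut
-- into 2n cells in s, an even number, so that s = ½ is always a grid point, and cell i carries the
-- weight 1 / (2n - i) of ds / (1 - s). Under s = t / (1 + t) the form dt / (1 + t) receives
-- literally this weight; under s = (1 - t) / 2 it receives the same weight with the cells of [0, ½]
-- reversed. The obstacle is t = 1. The alternating series converge only conditionally there, so the
-- weights cannot be inserted termwise; they decrease in k, and this makes summation by parts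
-- possible. The form dt / (1 - t) is even singular there. Its error is the sum of all weights
-- divided by n, and that sum is at most of order √n. The logarithms introduced by repeated
-- integration against ds / (1 - s) are removed by multiplying with ln 2 and solving the resulting
-- product relation, which raises the index p of Zₚ.

0≤1 : 0ℚ ≤ 1ℚ
0≤1 = nonNegative⁻¹ 1ℚ

0≤½ : 0ℚ ≤ ½
0≤½ = nonNegative⁻¹ ½

0≤-+ : ∀ {p q} → 0ℚ ≤ p → 0ℚ ≤ q → 0ℚ ≤ p + q
0≤-+ {p} {q} 0≤p 0≤q = nonNegative⁻¹ (p + q)
  {{nonNeg+nonNeg⇒nonNeg p {{nonNegative 0≤p}} q {{nonNegative 0≤q}}}}

0≤-* : ∀ {p q} → 0ℚ ≤ p → 0ℚ ≤ q → 0ℚ ≤ p * q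
0≤-* {p} {q} 0≤p 0≤q = nonNegative⁻¹ (p * q)
  {{nonNeg*nonNeg⇒nonNeg p {{nonNegative 0≤p}} q {{nonNegative 0≤q}}}}

0<-* : ∀ {p q} → 0ℚ < p → 0ℚ < q → 0ℚ < p * q
0<-* {p} {q} 0<p 0<q = positive⁻¹ (p * q)
  {{pos*pos⇒pos p {{positive 0<p}} q {{positive 0<q}}}}

≤⇒0≤- : ∀ {p q} → p ≤ q → 0ℚ ≤ q - p
≤⇒0≤- {p} {q} p≤q = subst (_≤ q - p) (+-inverseʳ p) (+-monoˡ-≤ (- p) p≤q)

≤-from-difference : ∀ {p q} r → 0ℚ ≤ r → q ≡ p + r → p ≤ q
≤-from-difference {p} r 0≤r refl =
  subst (_≤ p + r) (+-identityʳ p) (+-monoʳ-≤ p 0≤r)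

0≤-⇒≤ : ∀ {p q} → 0ℚ ≤ q - p → p ≤ q
0≤-⇒≤ {p} {q} 0≤q-p = ≤-from-difference (q - p) 0≤q-p
  (solve 2 (λ p q → q := p :+ (q :- p)) refl p q)

*-mono-≤ : ∀ {p q r s} → 0ℚ ≤ p → 0ℚ ≤ r → p ≤ q → r ≤ s → p * r ≤ q * s
*-mono-≤ {p} {q} {r} {s} 0≤p 0≤r p≤q r≤s = ≤-trans
  (*-monoʳ-≤-nonNeg r {{nonNegative 0≤r}} p≤q)
  (*-monoˡ-≤-nonNeg q {{nonNegative (≤-trans 0≤p p≤q)}} r≤s)

*-monoʳ-≤ : ∀ {r p q} → 0ℚ ≤ r → p ≤ q → r * p ≤ r * q
*-monoʳ-≤ {r} 0≤r = *-monoˡ-≤-nonNeg r {{nonNegative 0≤r}}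

*-monoˡ-≤ : ∀ {r p q} → 0ℚ ≤ r → p ≤ q → p * r ≤ q * r
*-monoˡ-≤ {r} 0≤r = *-monoʳ-≤-nonNeg r {{nonNegative 0≤r}}

*-≤1 : ∀ {p q} → 0ℚ ≤ p → 0ℚ ≤ q → p ≤ 1ℚ → q ≤ 1ℚ → p * q ≤ 1ℚ
*-≤1 0≤p 0≤q = *-mono-≤ 0≤p 0≤q

p≤∣p∣ : ∀ p → p ≤ ∣ p ∣
p≤∣p∣ p with ≤-total 0ℚ p
... | inj₁ 0≤p = ≤-reflexive (sym (0≤p⇒∣p∣≡p 0≤p))
... | inj₂ p≤0 = ≤-trans p≤0 (0≤∣p∣ p)

∣p+q∣≤ : ∀ {p q r s} → ∣ p ∣ ≤ r → ∣ q ∣ ≤ s → ∣ p + q ∣ ≤ r + s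
∣p+q∣≤ {p} {q} hp hq = ≤-trans (∣p+q∣≤∣p∣+∣q∣ p q) (+-mono-≤ hp hq)

∣p-q∣≤ : ∀ {p q r s} → ∣ p ∣ ≤ r → ∣ q ∣ ≤ s → ∣ p - q ∣ ≤ r + s
∣p-q∣≤ {p} {q} hp hq = ≤-trans (∣p-q∣≤∣p∣+∣q∣ p q) (+-mono-≤ hp hq)

∣p*q∣≤ : ∀ {p q r s} → ∣ p ∣ ≤ r → ∣ q ∣ ≤ s → ∣ p * q ∣ ≤ r * s
∣p*q∣≤ {p} {q} {r} {s} hp hq = subst (_≤ r * s) (sym (∣p*q∣≡∣p∣*∣q∣ p q))
  (*-mono-≤ (0≤∣p∣ p) (0≤∣p∣ q) hp hq)

-- Lets the ring solver work modulo a relation, typically ι (suc k) * inv (suc k) ≡ 1ℚ, with cofactor c.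
modulo : ∀ {p q e e′} c → e ≡ e′ → p ≡ q + c * (e - e′) → p ≡ q
modulo {q = q} {e} c refl p≡ = trans p≡
  (solve 3 (λ q c e → q :+ c :* (e :- e) := q) refl q c e)

-- Natural numbers as rationals, and their reciprocals

ι : ℕ → ℚ
ι zero    = 0ℚ
ι (suc n) = 1ℚ + ι n

ι-+ : ∀ m n → ι (m ℕ.+ n) ≡ ι m + ι n
ι-+ zero    n = sym (+-identityˡ (ι n))
ι-+ (suc m) n = trans (cong (λ t → 1ℚ + t) (ι-+ m n)) (sym (+-assoc 1ℚ (ι m) (ι n)))

ι-* : ∀ m n → ι (m ℕ.* n) ≡ ι m * ι n
ι-* zero    n = sym (*-zeroˡ (ι n))
ι-* (suc m) n = trans (ι-+ n (m ℕ.* n)) (trans (cong (λ t → ι n + t) (ι-* m n))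
  (solve 2 (λ m n → n :+ m :* n := (con 1ℚ :+ m) :* n) refl (ι m) (ι n)))

ι-∸ : ∀ {m n} → n ℕ.≤ m → ι (m ℕ.∸ n) ≡ ι m - ι n
ι-∸ {m} {n} n≤m = trans
  (solve 2 (λ x y → x := (x :+ y) :- y) refl (ι (m ℕ.∸ n)) (ι n))
  (cong (λ t → t - ι n) (trans (sym (ι-+ (m ℕ.∸ n) n)) (cong ι (ℕ.m∸n+n≡m n≤m))))

0≤ι : ∀ n → 0ℚ ≤ ι n
0≤ι zero    = ≤-refl
0≤ι (suc n) = 0≤-+ 0≤1 (0≤ι n)

ι-mono : ∀ {m n} → m ℕ.≤ n → ι m ≤ ι n
ι-mono {n = n} z≤n = 0≤ι n
ι-mono (s≤s m≤n)   = +-monoʳ-≤ 1ℚ (ι-mono m≤n)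

private
  /-suc : ∀ m k → ℤ.+ 1 / suc k + ℤ.+ m / suc k ≡ ℤ.+ suc m / suc k
  /-suc m k = toℚᵘ-injective (begin
    toℚᵘ (ℤ.+ 1 / suc k + ℤ.+ m / suc k)             ≈⟨ toℚᵘ-homo-+ (ℤ.+ 1 / suc k) (ℤ.+ m / suc k) ⟩
    toℚᵘ (ℤ.+ 1 / suc k) ℚᵘ.+ toℚᵘ (ℤ.+ m / suc k)   ≈⟨ ℚᵘ.+-cong (toℚᵘ-fromℚᵘ (mkℚᵘ (ℤ.+ 1) k)) (toℚᵘ-fromℚᵘ (mkℚᵘ (ℤ.+ m) k)) ⟩
    mkℚᵘ (ℤ.+ 1) k ℚᵘ.+ mkℚᵘ (ℤ.+ m) k               ≈⟨ ℚᵘ.*≡* numerators ⟩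
    mkℚᵘ (ℤ.+ suc m) k                             ≈⟨ ℚᵘ.≃-sym (toℚᵘ-fromℚᵘ (mkℚᵘ (ℤ.+ suc m) k)) ⟩
    toℚᵘ (ℤ.+ suc m / suc k)                       ∎)
    where
    open ℚᵘ.≃-Reasoning
    s = ℤ.+ suc k
    numerators : (ℤ.+ 1 ℤ.* s ℤ.+ ℤ.+ m ℤ.* s) ℤ.* s ≡ ℤ.+ suc m ℤ.* (s ℤ.* s)
    numerators = trans (cong (ℤ._* s) (sym (ℤ.*-distribʳ-+ s (ℤ.+ 1) (ℤ.+ m)))) (ℤ.*-assoc (ℤ.+ suc m) s s)

  ι*1/ : ∀ m k → ι m * (ℤ.+ 1 / suc k) ≡ ℤ.+ m / suc k
  ι*1/ zero    k = trans (*-zeroˡ (ℤ.+ 1 / suc k)) (sym (0/n≡0 (suc k)))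
  ι*1/ (suc m) k = begin
    (1ℚ + ι m) * (ℤ.+ 1 / suc k)                   ≡⟨ *-distribʳ-+ (ℤ.+ 1 / suc k) 1ℚ (ι m) ⟩
    1ℚ * (ℤ.+ 1 / suc k) + ι m * (ℤ.+ 1 / suc k)     ≡⟨ cong₂ _+_ (*-identityˡ (ℤ.+ 1 / suc k)) (ι*1/ m k) ⟩
    ℤ.+ 1 / suc k + ℤ.+ m / suc k                    ≡⟨ /-suc m k ⟩
    ℤ.+ suc m / suc k                              ∎
    where open ≡-Reasoning

-- The junk value at 0 lets many identities hold without side conditions.
opaque
  inv : ℕ → ℚ
  inv zero    = 0ℚ
  inv (suc n) = ℤ.+ 1 / suc n

  inv0≡0 : inv 0 ≡ 0ℚ
  inv0≡0 = refl

  1/≡inv : ∀ k .{{_ : NonZero k}} → ℤ.+ 1 / k ≡ inv k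
  1/≡inv (suc k) = refl

  0<inv : ∀ k → 0ℚ < inv (suc k)
  0<inv k = positive⁻¹ (ℤ.+ 1 / suc k) {{normalize-pos 1 (suc k)}}

  ι*inv≡1 : ∀ k → ι (suc k) * inv (suc k) ≡ 1ℚ
  ι*inv≡1 k = trans (ι*1/ (suc k) k) (toℚᵘ-injective (ℚᵘ.≃-trans
    (toℚᵘ-fromℚᵘ (mkℚᵘ (ℤ.+ suc k) k)) (ℚᵘ.*≡* (ℤ.*-comm (ℤ.+ suc k) (ℤ.+ 1)))))

inv-unique : ∀ k {x} → ι (suc k) * x ≡ 1ℚ → x ≡ inv (suc k)
inv-unique k {x} h = modulo (- x) (ι*inv≡1 k) (modulo (inv (suc k)) h
  (solve 3 (λ i x r → x := (r :+ (:- x) :* (i :* r :- con 1ℚ)) :+ r :* (i :* x :- con 1ℚ)) refl (ι (suc k)) x (inv (suc k))))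

0≤inv : ∀ k → 0ℚ ≤ inv k
0≤inv zero    = ≤-reflexive (sym inv0≡0)
0≤inv (suc k) = <⇒≤ (0<inv k)

ι*inv≤1 : ∀ k → ι k * inv k ≤ 1ℚ
ι*inv≤1 zero    = subst (_≤ 1ℚ) (sym (*-zeroˡ (inv 0))) 0≤1
ι*inv≤1 (suc k) = ≤-reflexive (ι*inv≡1 k)

inv-antitone : ∀ {j k} → suc j ℕ.≤ k → inv k ≤ inv (suc j)
inv-antitone {j} {suc k} j≤k = ≤-from-difference ((ι (suc k) - ι (suc j)) * (inv (suc j) * inv (suc k)))
  (0≤-* (≤⇒0≤- (ι-mono j≤k)) (0≤-* (0≤inv (suc j)) (0≤inv (suc k))))
  (sym (modulo (inv (suc j)) (ι*inv≡1 k) (modulo (- inv (suc k)) (ι*inv≡1 j)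
    (solve 4 (λ J K r s → s :+ (K :- J) :* (r :* s) := (r :+ r :* (K :* s :- con 1ℚ)) :+ (:- s) :* (J :* r :- con 1ℚ))
      refl (ι (suc j)) (ι (suc k)) (inv (suc j)) (inv (suc k))))))

inv1≡1 : inv 1 ≡ 1ℚ
inv1≡1 = sym (1/≡inv 1)

inv≤1 : ∀ k → inv k ≤ 1ℚ
inv≤1 zero    = subst (_≤ 1ℚ) (sym inv0≡0) 0≤1
inv≤1 (suc k) = ≤-trans (inv-antitone (s≤s z≤n)) (≤-reflexive inv1≡1)

inv-* : ∀ m n → inv (m ℕ.* n) ≡ inv m * inv n
inv-* zero    n    = trans inv0≡0 (sym (trans (cong (_* inv n) inv0≡0) (*-zeroˡ (inv n))))
inv-* (suc m) zero = trans (cong inv (ℕ.*-zeroʳ m)) (trans inv0≡0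
  (sym (trans (cong (inv (suc m) *_) inv0≡0) (*-zeroʳ (inv (suc m))))))
inv-* (suc m) (suc n) = sym (inv-unique (n ℕ.+ m ℕ.* suc n) (begin
  ι (suc m ℕ.* suc n) * (inv (suc m) * inv (suc n))     ≡⟨ cong (_* (inv (suc m) * inv (suc n))) (ι-* (suc m) (suc n)) ⟩
  (ι (suc m) * ι (suc n)) * (inv (suc m) * inv (suc n)) ≡⟨ interchange (ι (suc m)) (ι (suc n)) (inv (suc m)) (inv (suc n)) ⟩
  (ι (suc m) * inv (suc m)) * (ι (suc n) * inv (suc n)) ≡⟨ cong₂ _*_ (ι*inv≡1 m) (ι*inv≡1 n) ⟩
  1ℚ                                                    ∎))
  where
  open ≡-Reasoning
  interchange : ∀ a b c d → (a * b) * (c * d) ≡ (a * c) * (b * d)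
  interchange = solve 4 (λ a b c d → (a :* b) :* (c :* d) := (a :* c) :* (b :* d)) refl

1/^ᴺ≡inv^ : ∀ k s → 1/ suc k ^ᴺ s ≡ inv (suc k) ^ s
1/^ᴺ≡inv^ k s = trans (1/≡inv (suc k ℕ.^ s) {{ℕ.m^n≢0 (suc k) s}}) (inv-^ s)
  where
  inv-^ : ∀ s → inv (suc k ℕ.^ s) ≡ inv (suc k) ^ s
  inv-^ zero    = inv1≡1
  inv-^ (suc s) = trans (inv-* (suc k) (suc k ℕ.^ s)) (cong (inv (suc k) *_) (inv-^ s))

archimedean : ∀ ε → 0ℚ < ε → ∃ λ N → inv (suc N) < ε
archimedean (mkℚ (ℤ.+ zero) d c) (*<* (ℤ.+<+ ()))
-- Here ε = (a + 1) / (d + 1) is at least 1 / (d + 1), and 1 / (d + 2) is strictly smaller.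
archimedean ε@(mkℚ (ℤ.+ suc a) d c) _ = suc d , (begin-strict
    inv (suc (suc d))                                  ≡⟨ sym (+-identityʳ (inv (suc (suc d)))) ⟩
    inv (suc (suc d)) + 0ℚ                             <⟨ +-monoʳ-< (inv (suc (suc d))) (0<-* (0<inv (suc d)) (0<inv d)) ⟩
    inv (suc (suc d)) + inv (suc (suc d)) * inv (suc d) ≡⟨ difference ⟩
    inv (suc d)                                        ≡⟨ sym (1/≡inv (suc d)) ⟩
    ℤ.+ 1 / suc d                                        ≤⟨ toℚᵘ-cancel-≤ (ℚᵘ.≤-respˡ-≃ (ℚᵘ.≃-sym (toℚᵘ-fromℚᵘ (mkℚᵘ (ℤ.+ 1) d))) (ℚᵘ.*≤* (ℤ.*-monoʳ-≤-nonNeg (ℤ.+ suc d) (ℤ.+≤+ (s≤s (z≤n {a})))))) ⟩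
    ε                                                  ∎)
  where
  open ≤-Reasoning
  r = inv (suc d)
  s = inv (suc (suc d))
  difference : s + s * r ≡ r
  difference = modulo (- s) (ι*inv≡1 d) (modulo r (ι*inv≡1 (suc d))
    (solve 3 (λ D r s → s :+ s :* r := (r :+ (:- s) :* (D :* r :- con 1ℚ)) :+ r :* ((con 1ℚ :+ D) :* s :- con 1ℚ)) refl (ι (suc d)) r s))

-- Finite sums

sum< : ℕ → (ℕ → ℚ) → ℚ
sum< zero    f = 0ℚ
sum< (suc n) f = sum< n f + f n

sum<-cong : ∀ n {f g : ℕ → ℚ} → (∀ i → i ℕ.< n → f i ≡ g i) → sum< n f ≡ sum< n g
sum<-cong zero    h = refl
sum<-cong (suc n) h = cong₂ _+_ (sum<-cong n (λ i i<n → h i (ℕ.m<n⇒m<1+n i<n))) (h n ℕ.≤-refl)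

sum<-+ : ∀ n (f g : ℕ → ℚ) → sum< n (λ i → f i + g i) ≡ sum< n f + sum< n g
sum<-+ zero    f g = refl
sum<-+ (suc n) f g = trans (cong (_+ (f n + g n)) (sum<-+ n f g))
  (solve 4 (λ a b c d → (a :+ b) :+ (c :+ d) := (a :+ c) :+ (b :+ d)) refl (sum< n f) (sum< n g) (f n) (g n))

sum<-*ˡ : ∀ n c (f : ℕ → ℚ) → sum< n (λ i → c * f i) ≡ c * sum< n f
sum<-*ˡ zero    c f = sym (*-zeroʳ c)
sum<-*ˡ (suc n) c f = trans (cong (_+ c * f n) (sum<-*ˡ n c f)) (sym (*-distribˡ-+ c (sum< n f) (f n)))

sum<-- : ∀ n (f g : ℕ → ℚ) → sum< n (λ i → f i - g i) ≡ sum< n f - sum< n g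
sum<-- zero    f g = refl
sum<-- (suc n) f g = trans (cong (_+ (f n - g n)) (sum<-- n f g))
  (solve 4 (λ a b c d → (a :- b) :+ (c :- d) := (a :+ c) :- (b :+ d)) refl (sum< n f) (sum< n g) (f n) (g n))

sum<-mono : ∀ n {f g : ℕ → ℚ} → (∀ i → i ℕ.< n → f i ≤ g i) → sum< n f ≤ sum< n g
sum<-mono zero    h = ≤-refl
sum<-mono (suc n) h = +-mono-≤ (sum<-mono n (λ i i<n → h i (ℕ.m<n⇒m<1+n i<n))) (h n ℕ.≤-refl)

sum<-0 : ∀ n {f : ℕ → ℚ} → (∀ i → i ℕ.< n → f i ≡ 0ℚ) → sum< n f ≡ 0ℚ
sum<-0 zero    h = refl
sum<-0 (suc n) h = cong₂ _+_ (sum<-0 n (λ i i<n → h i (ℕ.m<n⇒m<1+n i<n))) (h n ℕ.≤-refl)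

0≤sum< : ∀ n {f : ℕ → ℚ} → (∀ i → i ℕ.< n → 0ℚ ≤ f i) → 0ℚ ≤ sum< n f
0≤sum< zero    h = ≤-refl
0≤sum< (suc n) h = 0≤-+ (0≤sum< n (λ i i<n → h i (ℕ.m<n⇒m<1+n i<n))) (h n ℕ.≤-refl)

∣sum<∣≤ : ∀ n {f g : ℕ → ℚ} → (∀ i → i ℕ.< n → ∣ f i ∣ ≤ g i) → ∣ sum< n f ∣ ≤ sum< n g
∣sum<∣≤ zero    h = ≤-refl
∣sum<∣≤ (suc n) h = ∣p+q∣≤ (∣sum<∣≤ n (λ i i<n → h i (ℕ.m<n⇒m<1+n i<n))) (h n ℕ.≤-refl)

sum<-telescope : ∀ n (f : ℕ → ℚ) → sum< n (λ i → f (suc i) - f i) ≡ f n - f 0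
sum<-telescope zero    f = sym (+-inverseʳ (f 0))
sum<-telescope (suc n) f = trans (cong (_+ (f (suc n) - f n)) (sum<-telescope n f))
  (solve 3 (λ a b c → (b :- a) :+ (c :- b) := c :- a) refl (f 0) (f n) (f (suc n)))

sum<-const : ∀ n (c : ℚ) → sum< n (λ _ → c) ≡ ι n * c
sum<-const zero    c = sym (*-zeroˡ c)
sum<-const (suc n) c = trans (cong (_+ c) (sum<-const n c))
  (solve 2 (λ i c → i :* c :+ c := (con 1ℚ :+ i) :* c) refl (ι n) c)

sum<-front : ∀ n (f : ℕ → ℚ) → sum< (suc n) f ≡ f 0 + sum< n (λ i → f (suc i))
sum<-front zero    f = trans (+-identityˡ (f 0)) (sym (+-identityʳ (f 0)))
sum<-front (suc n) f = trans (cong (_+ f (suc n)) (sum<-front n f)) (+-assoc (f 0) (sum< n (λ i → f (suc i))) (f (suc n)))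

sum<-reverse : ∀ n (f : ℕ → ℚ) → sum< n (λ i → f (n ℕ.∸ suc i)) ≡ sum< n f
sum<-reverse zero    f = refl
sum<-reverse (suc n) f = trans (sum<-front n (λ i → f (n ℕ.∸ i)))
  (trans (cong (f n +_) (sum<-reverse n f)) (+-comm (f n) (sum< n f)))

sum<-monotone-range : ∀ {m n} (f : ℕ → ℚ) → (∀ i → 0ℚ ≤ f i) → m ℕ.≤ n → sum< m f ≤ sum< n f
sum<-monotone-range {m} f h m≤n = subst (λ t → sum< m f ≤ sum< t f) (ℕ.m∸n+n≡m m≤n) (grow (_ ℕ.∸ m))
  where
  grow : ∀ d → sum< m f ≤ sum< (d ℕ.+ m) f
  grow zero    = ≤-refl
  grow (suc d) = ≤-trans (grow d) (≤-from-difference (f (d ℕ.+ m)) (h (d ℕ.+ m)) refl)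

∑≡sum< : ∀ n (f : (k : ℕ) → .{{NonZero k}} → ℚ) → ∑ n f ≡ sum< n (λ i → f (suc i))
∑≡sum< zero    f = refl
∑≡sum< (suc n) f = cong (_+ f (suc n)) (∑≡sum< n f)

-- Limits of rational sequences

Null : (ℕ → ℚ) → Set
Null u = ∀ ε → 0ℚ < ε → ∃ λ N → ∀ n → N ℕ.≤ n → ∣ u n ∣ < ε

0<½* : ∀ {ε} → 0ℚ < ε → 0ℚ < ½ * ε
0<½* = 0<-* (positive⁻¹ ½)

½*-+ : ∀ ε → ½ * ε + ½ * ε ≡ ε
½*-+ = solve 1 (λ ε → con ½ :* ε :+ con ½ :* ε := ε) refl

null-dominated : ∀ {u v : ℕ → ℚ} → (∀ n → ∣ u n ∣ ≤ v n) → Null v → Null u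
null-dominated {u} {v} h hv ε 0<ε with N , hN ← hv ε 0<ε =
  N , λ n N≤n → ≤-<-trans (≤-trans (h n) (p≤∣p∣ (v n))) (hN n N≤n)

null-cong : ∀ {u v : ℕ → ℚ} → (∀ n → u n ≡ v n) → Null u → Null v
null-cong h hu ε 0<ε with N , hN ← hu ε 0<ε = N , λ n N≤n → subst (λ t → ∣ t ∣ < ε) (h n) (hN n N≤n)

null-0 : Null (λ _ → 0ℚ)
null-0 ε 0<ε = 0 , λ _ _ → 0<ε

null-+ : ∀ {u v : ℕ → ℚ} → Null u → Null v → Null (λ n → u n + v n)
null-+ {u} {v} hu hv ε 0<ε
  with M , hM ← hu (½ * ε) (0<½* 0<ε)
  with N , hN ← hv (½ * ε) (0<½* 0<ε) = M ℕ.⊔ N , λ n p →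
    ≤-<-trans (∣p+q∣≤∣p∣+∣q∣ (u n) (v n)) (subst (∣ u n ∣ + ∣ v n ∣ <_) (½*-+ ε)
      (+-mono-< (hM n (ℕ.m⊔n≤o⇒m≤o M N p)) (hN n (ℕ.m⊔n≤o⇒n≤o M N p))))

null-*bounded : ∀ {u v : ℕ → ℚ} (B : ℚ) → 0ℚ ≤ B → (∀ n → ∣ u n ∣ ≤ B) → Null v → Null (λ n → u n * v n)
null-*bounded {u} {v} B 0≤B hu hv ε 0<ε = N , λ n N≤n → ≤-<-trans (bound n N≤n) Bδ<ε
  where
  C = 1ℚ + B
  0<C : 0ℚ < C
  0<C = <-≤-trans (positive⁻¹ 1ℚ) (≤-from-difference B 0≤B refl)
  instance
    pos-C : Positive C
    pos-C = positive 0<C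
    nonZero-C : ℚ.NonZero C
    nonZero-C = pos⇒nonZero C
  δ = ℚ.1/_ C * ε
  0<δ : 0ℚ < δ
  0<δ = 0<-* (positive⁻¹ (ℚ.1/_ C) {{1/pos⇒pos C}}) 0<ε
  Cδ≡ε : C * δ ≡ ε
  Cδ≡ε = trans (sym (*-assoc C (ℚ.1/_ C) ε)) (trans (cong (_* ε) (*-inverseʳ C)) (*-identityˡ ε))
  Bδ<ε : B * δ < ε
  Bδ<ε = subst₂ _<_ (+-identityʳ (B * δ)) (trans (solve 2 (λ B d → B :* d :+ d := (con 1ℚ :+ B) :* d) refl B δ) Cδ≡ε)
    (+-monoʳ-< (B * δ) 0<δ)
  N = proj₁ (hv δ 0<δ)
  bound : ∀ n → N ℕ.≤ n → ∣ u n * v n ∣ ≤ B * δ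
  bound n N≤n = ∣p*q∣≤ (hu n) (<⇒≤ (proj₂ (hv δ 0<δ) n N≤n))

null-scale : ∀ {u : ℕ → ℚ} (c : ℚ) → Null u → Null (λ n → c * u n)
null-scale c = null-*bounded ∣ c ∣ (0≤∣p∣ c) (λ _ → ≤-refl)

null-inv : Null inv
null-inv ε 0<ε with N , hN ← archimedean ε 0<ε = suc N , λ n N<n →
  subst (_< ε) (sym (0≤p⇒∣p∣≡p (0≤inv n))) (≤-<-trans (inv-antitone N<n) hN)

null-shift : ∀ {u : ℕ → ℚ} → Null u → Null (λ n → u (suc n))
null-shift hu ε 0<ε with N , hN ← hu ε 0<ε = N , λ n N≤n → hN (suc n) (ℕ.m≤n⇒m≤1+n N≤n)

≡⇒asymptotic : ∀ {u v : ℕ → ℚ} → (∀ n → u n ≡ v n) → Asymptotic u v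
≡⇒asymptotic {u} {v} h = null-cong (λ n → sym (trans (cong (_- v n) (h n)) (+-inverseʳ (v n)))) null-0

asymptotic-sym : ∀ {u v : ℕ → ℚ} → Asymptotic u v → Asymptotic v u
asymptotic-sym {u} {v} h = null-cong (λ n → solve 2 (λ a b → con (- 1ℚ) :* (a :- b) := b :- a) refl (u n) (v n)) (null-scale (- 1ℚ) h)

asymptotic-trans : ∀ {u v w : ℕ → ℚ} → Asymptotic u v → Asymptotic v w → Asymptotic u w
asymptotic-trans {u} {v} {w} h k = null-cong (λ n → solve 3 (λ a b c → (a :- b) :+ (b :- c) := a :- c) refl (u n) (v n) (w n)) (null-+ h k)

asymptotic-+ : ∀ {u v u′ v′ : ℕ → ℚ} → Asymptotic u v → Asymptotic u′ v′ → Asymptotic (λ n → u n + u′ n) (λ n → v n + v′ n)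
asymptotic-+ {u} {v} {u′} {v′} h k = null-cong
  (λ n → solve 4 (λ a b c d → (a :- b) :+ (c :- d) := (a :+ c) :- (b :+ d)) refl (u n) (v n) (u′ n) (v′ n)) (null-+ h k)

asymptotic-scale : ∀ {u v : ℕ → ℚ} (c : ℚ) → Asymptotic u v → Asymptotic (λ n → c * u n) (λ n → c * v n)
asymptotic-scale {u} {v} c h = null-cong (λ n → solve 3 (λ c a b → c :* (a :- b) := c :* a :- c :* b) refl c (u n) (v n)) (null-scale c h)

Bounded : (ℕ → ℚ) → Set
Bounded u = ∃ λ B → 0ℚ ≤ B × (∀ n → ∣ u n ∣ ≤ B)

cauchy⇒bounded : ∀ {u : ℕ → ℚ} → Cauchy u → Bounded u
cauchy⇒bounded {u} cu with N , h ← cu 1ℚ (positive⁻¹ 1ℚ) = A + 1ℚ , 0≤-+ 0≤A 0≤1 , bound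
  where
  -- A sum of absolute values takes the place of a maximum.
  A = sum< (suc N) (λ i → ∣ u i ∣)
  0≤A : 0ℚ ≤ A
  0≤A = 0≤sum< (suc N) (λ i _ → 0≤∣p∣ (u i))
  term : ∀ {i n} → i ℕ.< n → ∣ u i ∣ ≤ sum< n (λ i → ∣ u i ∣)
  term {i} i<n = ≤-trans (≤-from-difference (sum< i (λ i → ∣ u i ∣)) (0≤sum< i (λ j _ → 0≤∣p∣ (u j))) (+-comm (sum< i (λ i → ∣ u i ∣)) ∣ u i ∣))
    (sum<-monotone-range (λ i → ∣ u i ∣) (λ j → 0≤∣p∣ (u j)) i<n)
  bound : ∀ n → ∣ u n ∣ ≤ A + 1ℚ
  bound n with ℕ.≤-total N n
  ... | inj₁ N≤n = subst (λ t → ∣ t ∣ ≤ A + 1ℚ) (solve 2 (λ a b → a :+ (b :- a) := b) refl (u N) (u n))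
    (∣p+q∣≤ (term ℕ.≤-refl) (<⇒≤ (h n N N≤n ℕ.≤-refl)))
  ... | inj₂ n≤N = ≤-trans (term (s≤s n≤N)) (≤-from-difference 1ℚ 0≤1 refl)

asymptotic⇒cauchy : ∀ (u v : ℕ → ℚ) → Asymptotic u v → Cauchy v → Cauchy u
asymptotic⇒cauchy u v h cv ε 0<ε
  with M , hM ← h (½ * (½ * ε)) (0<½* (0<½* 0<ε))
  with N , hN ← cv (½ * ε) (0<½* 0<ε) = M ℕ.⊔ N , λ m n p q →
    let Mm = ℕ.m⊔n≤o⇒m≤o M N p ; Nm = ℕ.m⊔n≤o⇒n≤o M N p
        Mn = ℕ.m⊔n≤o⇒m≤o M N q ; Nn = ℕ.m⊔n≤o⇒n≤o M N q
        a = u m - v m ; b = v m - v n ; c = u n - v n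
    in ≤-<-trans
         (subst (λ t → ∣ t ∣ ≤ (∣ a ∣ + ∣ c ∣) + ∣ b ∣)
           (solve 4 (λ um vm un vn → ((um :- vm) :- (un :- vn)) :+ (vm :- vn) := um :- un) refl (u m) (v m) (u n) (v n))
           (∣p+q∣≤ (∣p-q∣≤∣p∣+∣q∣ a c) ≤-refl))
         (subst ((∣ a ∣ + ∣ c ∣) + ∣ b ∣ <_) (½*-+ ε)
           (+-mono-< (subst (∣ a ∣ + ∣ c ∣ <_) (½*-+ (½ * ε)) (+-mono-< (hM m Mm) (hM n Mn))) (hN m n Nm Nn)))

asymptotic-* : ∀ {u v u′ v′ : ℕ → ℚ} → Asymptotic u v → Asymptotic u′ v′ → Bounded v → Bounded u′ →
  Asymptotic (λ n → u n * u′ n) (λ n → v n * v′ n)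
asymptotic-* {u} {v} {u′} {v′} h k (B , 0≤B , hB) (C , 0≤C , hC) = null-cong
  (λ n → solve 4 (λ a b c d → c :* (a :- b) :+ b :* (c :- d) := a :* c :- b :* d) refl (u n) (v n) (u′ n) (v′ n))
  (null-+ (null-*bounded C 0≤C hC h) (null-*bounded B 0≤B hB k))

cauchy-double : ∀ {u : ℕ → ℚ} → Cauchy u → Asymptotic (λ n → u (n ℕ.+ n)) u
cauchy-double cu ε 0<ε with N , h ← cu ε 0<ε = N , λ n N≤n → h (n ℕ.+ n) n (ℕ.m≤n⇒m≤n+o n N≤n) N≤n

-- `E` plays the role of a remainder: the increments of `V` after index `N` add up to at most `E N`.
-- A closed form for the remainder thus proves convergence.
telescoping⇒cauchy : ∀ (V E : ℕ → ℚ) → (∀ k → ∣ V (suc k) - V k ∣ ≤ E k - E (suc k)) → (∀ k → 0ℚ ≤ E k) → Null E → Cauchy V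
telescoping⇒cauchy V E step 0≤E nullE ε 0<ε with N , hN ← nullE (½ * ε) (0<½* 0<ε) =
  N , λ m n p q → ≤-<-trans
    (subst (λ t → ∣ t ∣ ≤ E N + E N) (solve 3 (λ a b c → (a :- c) :- (b :- c) := a :- b) refl (V m) (V n) (V N))
      (∣p-q∣≤ (near p) (near q)))
    (subst (E N + E N <_) (½*-+ ε) (+-mono-< (EN<) (EN<)))
  where
  EN< : E N < ½ * ε
  EN< = ≤-<-trans (p≤∣p∣ (E N)) (hN N ℕ.≤-refl)
  far : ∀ d → ∣ V (d ℕ.+ N) - V N ∣ ≤ E N - E (d ℕ.+ N)
  far zero    = ≤-reflexive (trans (cong ∣_∣ (+-inverseʳ (V N))) (sym (+-inverseʳ (E N))))
  far (suc d) = subst₂ (λ s t → ∣ s ∣ ≤ t)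
    (solve 3 (λ a b c → (a :- b) :+ (b :- c) := a :- c) refl (V (suc d ℕ.+ N)) (V (d ℕ.+ N)) (V N))
    (solve 3 (λ a b c → (a :- b) :+ (c :- a) := c :- b) refl (E (d ℕ.+ N)) (E (suc d ℕ.+ N)) (E N))
    (∣p+q∣≤ (step (d ℕ.+ N)) (far d))
  near : ∀ {m} → N ℕ.≤ m → ∣ V m - V N ∣ ≤ E N
  near {m} N≤m = ≤-trans (subst (λ t → ∣ V t - V N ∣ ≤ E N - E t) (ℕ.m∸n+n≡m N≤m) (far (m ℕ.∸ N)))
    (≤-from-difference (E m) (0≤E m) (solve 2 (λ a b → a := (a :- b) :+ b) refl (E N) (E m)))

-- Cesàro means: the terms before `N` contribute a constant over k + 1, and the mean of the later
-- ones stays below ½ ε.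
null-average : ∀ {a : ℕ → ℚ} → Null a → Null (λ k → inv (suc k) * sum< k a)
null-average {a} nullA ε 0<ε with N , hN ← nullA (½ * ε) (0<½* 0<ε) =
  K , λ k K≤k → ≤-<-trans (bound k) (small k K≤k)
  where
  B = sum< N (λ i → ∣ a i ∣)
  head : ∀ k → ∣ sum< k a ∣ ≤ B + ι k * (½ * ε)
  head k with ℕ.≤-total k N
  ... | inj₁ k≤N = ≤-trans (∣sum<∣≤ k (λ i _ → ≤-refl)) (≤-trans (sum<-monotone-range (λ i → ∣ a i ∣) (λ i → 0≤∣p∣ (a i)) k≤N)
    (≤-from-difference (ι k * (½ * ε)) (0≤-* (0≤ι k) (<⇒≤ (0<½* 0<ε))) refl))
  ... | inj₂ N≤k = ≤-trans (subst (λ t → ∣ sum< t a ∣ ≤ B + ι (k ℕ.∸ N) * (½ * ε)) (ℕ.m∸n+n≡m N≤k) (grow (k ℕ.∸ N)))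
    (+-monoʳ-≤ B (*-monoˡ-≤ (<⇒≤ (0<½* 0<ε)) (ι-mono (ℕ.m∸n≤m k N))))
    where
    grow : ∀ d → ∣ sum< (d ℕ.+ N) a ∣ ≤ B + ι d * (½ * ε)
    grow zero    = ≤-trans (∣sum<∣≤ N (λ i _ → ≤-refl)) (≤-reflexive (solve 2 (λ B e → B := B :+ con 0ℚ :* e) refl B (½ * ε)))
    grow (suc d) = ≤-trans (∣p+q∣≤ (grow d) (<⇒≤ (hN (d ℕ.+ N) (ℕ.m≤n+m N d))))
      (≤-reflexive (solve 3 (λ B e d → B :+ d :* e :+ e := B :+ (con 1ℚ :+ d) :* e) refl B (½ * ε) (ι d)))
  BN = null-shift (null-scale B null-inv) (½ * ε) (0<½* 0<ε)
  K = proj₁ BN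
  bound : ∀ k → ∣ inv (suc k) * sum< k a ∣ ≤ B * inv (suc k) + ½ * ε
  bound k = ≤-trans (∣p*q∣≤ (≤-reflexive (0≤p⇒∣p∣≡p (0≤inv (suc k)))) (head k))
    (subst (_≤ B * inv (suc k) + ½ * ε)
      (solve 4 (λ r B i e → B :* r :+ (i :* r) :* e := r :* (B :+ i :* e)) refl (inv (suc k)) B (ι k) (½ * ε))
      (+-monoʳ-≤ (B * inv (suc k)) (subst (ι k * inv (suc k) * (½ * ε) ≤_) (*-identityˡ (½ * ε)) (*-monoˡ-≤ (<⇒≤ (0<½* 0<ε))
        (≤-trans (*-monoˡ-≤ (0≤inv (suc k)) (ι-mono (ℕ.n≤1+n k))) (ι*inv≤1 (suc k)))))))
  small : ∀ k → K ℕ.≤ k → B * inv (suc k) + ½ * ε < ε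
  small k K≤k = subst (B * inv (suc k) + ½ * ε <_) (½*-+ ε)
    (+-monoˡ-< (½ * ε) (≤-<-trans (p≤∣p∣ (B * inv (suc k))) (proj₂ BN k K≤k)))

-- Falling products

fall : (ℕ → ℚ) → ℕ → ℕ → ℚ
fall δ a zero    = 1ℚ
fall δ a (suc k) = fall δ a k * ((ι a - ι k) * δ k)

fall-vanishes : ∀ (δ : ℕ → ℚ) {a k} → a ℕ.< k → fall δ a k ≡ 0ℚ
fall-vanishes δ {a} {suc k} (s≤s a≤k) with ℕ.m≤n⇒m<n∨m≡n a≤k
... | inj₁ a<k  = trans (cong (_* ((ι a - ι k) * δ k)) (fall-vanishes δ a<k)) (*-zeroˡ ((ι a - ι k) * δ k))
... | inj₂ refl = solve 3 (λ f a d → f :* ((a :- a) :* d) := con 0ℚ) refl (fall δ a a) (ι a) (δ a)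

-- Before a factor ι a - ι k turns negative, the factor with k = a has made the product zero.
0≤fall : ∀ (δ : ℕ → ℚ) → (∀ k → 0ℚ ≤ δ k) → ∀ a k → 0ℚ ≤ fall δ a k
0≤fall δ 0≤δ a zero    = 0≤1
0≤fall δ 0≤δ a (suc k) with ℕ.≤-<-connex k a
... | inj₁ k≤a = 0≤-* (0≤fall δ 0≤δ a k) (0≤-* (≤⇒0≤- (ι-mono k≤a)) (0≤δ k))
... | inj₂ a<k = ≤-reflexive (sym (fall-vanishes δ (ℕ.m<n⇒m<1+n a<k)))

fall-antitone : ∀ (δ : ℕ → ℚ) → (∀ k → 0ℚ ≤ δ k) → ∀ a → (∀ k → ι a * δ k ≤ 1ℚ) → ∀ k → fall δ a (suc k) ≤ fall δ a k
fall-antitone δ 0≤δ a aδ≤1 k = subst (fall δ a (suc k) ≤_) (*-identityʳ (fall δ a k))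
  (*-monoʳ-≤ (0≤fall δ 0≤δ a k) (≤-trans
    (*-monoˡ-≤ (0≤δ k) (≤-from-difference {ι a - ι k} {ι a} (ι k) (0≤ι k) (solve 2 (λ a k → a := (a :- k) :+ k) refl (ι a) (ι k))))
    (aδ≤1 k)))

fall≤1 : ∀ (δ : ℕ → ℚ) → (∀ k → 0ℚ ≤ δ k) → ∀ a → (∀ k → ι a * δ k ≤ 1ℚ) → ∀ k → fall δ a k ≤ 1ℚ
fall≤1 δ 0≤δ a aδ≤1 zero    = ≤-refl
fall≤1 δ 0≤δ a aδ≤1 (suc k) = ≤-trans (fall-antitone δ 0≤δ a aδ≤1 k) (fall≤1 δ 0≤δ a aδ≤1 k)

-- The numerator (a + 1) a ⋯ (a - k + 1) is split at its largest factor instead of its smallest;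
-- comparing the two splittings gives the differences in `a`.
fall-suc-suc : ∀ (δ : ℕ → ℚ) a k → fall δ (suc a) (suc k) ≡ fall δ a k * (ι (suc a) * δ k)
fall-suc-suc δ a zero    = cong (1ℚ *_) (cong (_* δ 0) (+-identityʳ (ι (suc a))))
fall-suc-suc δ a (suc k) = trans (cong (_* ((ι (suc a) - ι (suc k)) * δ (suc k))) (fall-suc-suc δ a k))
  (solve 5 (λ f a k d d′ → f :* ((con 1ℚ :+ a) :* d) :* (((con 1ℚ :+ a) :- (con 1ℚ :+ k)) :* d′)
      := f :* ((a :- k) :* d) :* ((con 1ℚ :+ a) :* d′)) refl (fall δ a k) (ι a) (ι k) (δ k) (δ (suc k)))

-- The weights smoothing n k = n (n - 1) ⋯ (n - k + 1) / (n + 1) ⋯ (n + k) = C(2n, n + k) / C(2n, n)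

rising : ℕ → ℕ → ℚ
rising y k = inv (suc (y ℕ.+ k))

smoothing : ℕ → ℕ → ℚ
smoothing n = fall (rising n) n

0≤rising : ∀ y k → 0ℚ ≤ rising y k
0≤rising y k = 0≤inv (suc (y ℕ.+ k))

ι*rising≤1 : ∀ n k → ι n * rising n k ≤ 1ℚ
ι*rising≤1 n k = ≤-trans (*-monoˡ-≤ (0≤rising n k) (ι-mono (ℕ.m≤n⇒m≤1+n (ℕ.m≤m+n n k)))) (ι*inv≤1 (suc (n ℕ.+ k)))

0≤smoothing : ∀ n k → 0ℚ ≤ smoothing n k
0≤smoothing n = 0≤fall (rising n) (0≤rising n) n

smoothing≤1 : ∀ n k → smoothing n k ≤ 1ℚ
smoothing≤1 n = fall≤1 (rising n) (0≤rising n) n (ι*rising≤1 n)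

smoothing-antitone : ∀ n k → smoothing n (suc k) ≤ smoothing n k
smoothing-antitone n = fall-antitone (rising n) (0≤rising n) n (ι*rising≤1 n)

-- Consecutive weights have the quotient (n - k) / (n + k + 1) = 1 - (2k + 1) / (n + k + 1), which
-- tends to 1 for fixed k.
smoothing→1 : ∀ k → Null (λ n → 1ℚ - smoothing n k)
smoothing→1 zero    = null-cong (λ n → sym (+-inverseʳ 1ℚ)) null-0
smoothing→1 (suc k) = null-cong rearrange (null-+ (smoothing→1 k)
  (null-*bounded 1ℚ 0≤1 bound (null-scale (ι k + ι (suc k)) small)))
  where
  small : Null (λ n → rising n k)
  small = null-dominated (λ n → subst (_≤ inv (suc n)) (sym (0≤p⇒∣p∣≡p (0≤rising n k))) (inv-antitone (s≤s (ℕ.m≤m+n n k))))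
    (null-shift null-inv)
  bound : ∀ n → ∣ smoothing n k ∣ ≤ 1ℚ
  bound n = subst (_≤ 1ℚ) (sym (0≤p⇒∣p∣≡p (0≤smoothing n k))) (smoothing≤1 n k)
  rearrange : ∀ n → (1ℚ - smoothing n k) + smoothing n k * ((ι k + ι (suc k)) * rising n k) ≡ 1ℚ - smoothing n (suc k)
  rearrange n = modulo (smoothing n k) (trans (cong (_* rising n k) (sym (cong (1ℚ +_) (ι-+ n k)))) (ι*inv≡1 (n ℕ.+ k)))
    (solve 4 (λ f n k r → (con 1ℚ :- f) :+ f :* ((k :+ (con 1ℚ :+ k)) :* r)
       := (con 1ℚ :- f :* ((n :- k) :* r)) :+ f :* ((con 1ℚ :+ (n :+ k)) :* r :- con 1ℚ)) refl (smoothing n k) (ι n) (ι k) (rising n k))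

-- The smoothed sum is an average of the partial sums T k with weights smoothing n k - smoothing n (suc k),
-- and these weights escape to infinity with n.
smoothing-preserves-limit : ∀ (t : ℕ → ℚ) → Cauchy (λ n → sum< n t) →
  Asymptotic (λ n → sum< n t) (λ n → sum< n (λ k → smoothing n (suc k) * t k))
smoothing-preserves-limit t cauchyT ε 0<ε = J ℕ.⊔ L , λ n p →
  subst (λ s → ∣ s ∣ < ε) (sym (by-parts n)) (≤-<-trans (estimate n (ℕ.m⊔n≤o⇒m≤o J L p)) (final n (ℕ.m⊔n≤o⇒n≤o J L p)))
  where
  T : ℕ → ℚ
  T n = sum< n t
  by-parts-upto : ∀ n X K → sum< K (λ k → (smoothing n k - smoothing n (suc k)) * (X - T k))
    ≡ X - smoothing n K * (X - T K) - sum< K (λ k → smoothing n (suc k) * t k)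
  by-parts-upto n X zero    = solve 1 (λ X → con 0ℚ := X :- con 1ℚ :* (X :- con 0ℚ) :- con 0ℚ) refl X
  by-parts-upto n X (suc K) = trans (cong (_+ (smoothing n K - smoothing n (suc K)) * (X - T K)) (by-parts-upto n X K))
    (solve 6 (λ X c c′ T t S → (X :- c :* (X :- T) :- S) :+ (c :- c′) :* (X :- T) := X :- c′ :* (X :- (T :+ t)) :- (S :+ c′ :* t))
      refl X (smoothing n K) (smoothing n (suc K)) (T K) (t K) (sum< K (λ k → smoothing n (suc k) * t k)))
  by-parts : ∀ n → T n - sum< n (λ k → smoothing n (suc k) * t k)
    ≡ sum< n (λ k → (smoothing n k - smoothing n (suc k)) * (T n - T k))
  by-parts n = sym (trans (by-parts-upto n (T n) n)
    (solve 3 (λ X c S → X :- c :* (X :- X) :- S := X :- S) refl (T n) (smoothing n n) (sum< n (λ k → smoothing n (suc k) * t k))))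
  bounded : Bounded T
  bounded = cauchy⇒bounded cauchyT
  B = proj₁ bounded
  T≤B = proj₂ (proj₂ bounded)
  η = ½ * ε
  -- From `J` on, T n - T k is below η. Before `J` only the bound 2B is known, but the weights there
  -- add up to 1 - smoothing n J, which tends to 0 as `J` is fixed.
  J = proj₁ (cauchyT η (0<½* 0<ε))
  close = proj₂ (cauchyT η (0<½* 0<ε))
  nullW = null-scale {λ n → 1ℚ - smoothing n J} (B + B) (smoothing→1 J) η (0<½* 0<ε)
  L = proj₁ nullW
  c = smoothing
  0≤drop : ∀ n k → 0ℚ ≤ c n k - c n (suc k)
  0≤drop n k = ≤⇒0≤- (smoothing-antitone n k)
  term : ∀ n k {b} → ∣ T n - T k ∣ ≤ b → ∣ (c n k - c n (suc k)) * (T n - T k) ∣ ≤ (c n k - c n (suc k)) * b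
  term n k h = ∣p*q∣≤ (≤-reflexive (0≤p⇒∣p∣≡p (0≤drop n k))) h
  initial : ∀ n K → ∣ sum< K (λ k → (c n k - c n (suc k)) * (T n - T k)) ∣ ≤ (B + B) * (1ℚ - c n K)
  initial n zero    = ≤-reflexive (sym (trans (cong ((B + B) *_) (+-inverseʳ 1ℚ)) (*-zeroʳ (B + B))))
  initial n (suc K) = ≤-trans (∣p+q∣≤ (initial n K) (term n K (∣p-q∣≤ {T n} {T K} (T≤B n) (T≤B K))))
    (≤-reflexive (solve 3 (λ b c c′ → b :* (con 1ℚ :- c) :+ (c :- c′) :* b := b :* (con 1ℚ :- c′)) refl (B + B) (c n K) (c n (suc K))))
  later : ∀ n → J ℕ.≤ n → ∀ d → ∣ sum< (d ℕ.+ J) (λ k → (c n k - c n (suc k)) * (T n - T k)) ∣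
    ≤ (B + B) * (1ℚ - c n J) + η * (c n J - c n (d ℕ.+ J))
  later n J≤n zero    = ≤-trans (initial n J) (≤-reflexive
    (solve 3 (λ x η c → x := x :+ η :* (c :- c)) refl ((B + B) * (1ℚ - c n J)) η (c n J)))
  later n J≤n (suc d) = ≤-trans (∣p+q∣≤ (later n J≤n d) (term n (d ℕ.+ J) (<⇒≤ (close n (d ℕ.+ J) J≤n (ℕ.m≤n+m J d)))))
    (≤-reflexive (solve 5 (λ x η c c′ c″ → x :+ η :* (c :- c′) :+ (c′ :- c″) :* η := x :+ η :* (c :- c″)) refl
      ((B + B) * (1ℚ - c n J)) η (c n J) (c n (d ℕ.+ J)) (c n (suc d ℕ.+ J))))
  estimate : ∀ n → J ℕ.≤ n → ∣ sum< n (λ k → (c n k - c n (suc k)) * (T n - T k)) ∣ ≤ (B + B) * (1ℚ - c n J) + η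
  estimate n J≤n = ≤-trans
    (subst (λ m → ∣ sum< m (λ k → (c n k - c n (suc k)) * (T n - T k)) ∣ ≤ (B + B) * (1ℚ - c n J) + η * (c n J - c n m))
      (ℕ.m∸n+n≡m J≤n) (later n J≤n (n ℕ.∸ J)))
    (+-monoʳ-≤ ((B + B) * (1ℚ - c n J)) (subst (η * (c n J - c n n) ≤_) (*-identityʳ η) (*-monoʳ-≤ (<⇒≤ (0<½* 0<ε))
      (≤-trans (≤-from-difference (c n n) (0≤smoothing n n) (solve 2 (λ a b → a := (a :- b) :+ b) refl (c n J) (c n n))) (smoothing≤1 n J)))))
  final : ∀ n → L ℕ.≤ n → (B + B) * (1ℚ - c n J) + η < ε
  final n L≤n = subst ((B + B) * (1ℚ - c n J) + η <_) (½*-+ ε)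
    (+-monoˡ-< η (≤-<-trans (p≤∣p∣ ((B + B) * (1ℚ - c n J))) (proj₂ nullW n L≤n)))

-- Convergence

sgn : ℕ → ℚ
sgn k = (- 1ℚ) ^ k

∣sgn∣≤1 : ∀ k → ∣ sgn k ∣ ≤ 1ℚ
∣sgn∣≤1 zero    = ≤-refl
∣sgn∣≤1 (suc k) = ∣p*q∣≤ {p = - 1ℚ} ≤-refl (∣sgn∣≤1 k)

inv-difference : ∀ k → inv (suc k) - inv (suc (suc k)) ≡ inv (suc k) * inv (suc (suc k))
inv-difference k = modulo (inv (suc (suc k))) (ι*inv≡1 k) (modulo (- inv (suc k)) (ι*inv≡1 (suc k))
  (solve 3 (λ K r s → r :- s := r :* s :+ s :* (K :* r :- con 1ℚ) :+ (:- r) :* ((con 1ℚ :+ K) :* s :- con 1ℚ))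
    refl (ι (suc k)) (inv (suc k)) (inv (suc (suc k)))))

inv≤2inv : ∀ j l → suc l ℕ.≤ suc j ℕ.+ suc j → inv (suc j) ≤ inv (suc l) + inv (suc l)
inv≤2inv j l l≤2j = ≤-from-difference ((ι (suc j ℕ.+ suc j) - ι (suc l)) * (r * s)) (0≤-* (≤⇒0≤- (ι-mono l≤2j)) (0≤-* (0≤inv (suc j)) (0≤inv (suc l))))
  (trans (modulo (- (s + s)) (ι*inv≡1 j) (modulo r (ι*inv≡1 l)
    (solve 4 (λ J L r s → s :+ s := (r :+ ((J :+ J) :- L) :* (r :* s)) :+ (:- (s :+ s)) :* (J :* r :- con 1ℚ) :+ r :* (L :* s :- con 1ℚ)) refl
      (ι (suc j)) (ι (suc l)) r s)))
    (cong (λ t → r + (t - ι (suc l)) * (r * s)) (sym (ι-+ (suc j) (suc j)))))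
  where
  r = inv (suc j)
  s = inv (suc l)

0≤^ : ∀ {p} n → 0ℚ ≤ p → 0ℚ ≤ p ^ n
0≤^ zero    0≤p = 0≤1
0≤^ (suc n) 0≤p = 0≤-* 0≤p (0≤^ n 0≤p)

^≤1 : ∀ {p} n → 0ℚ ≤ p → p ≤ 1ℚ → p ^ n ≤ 1ℚ
^≤1 zero    0≤p p≤1 = ≤-refl
^≤1 (suc n) 0≤p p≤1 = *-≤1 0≤p (0≤^ n 0≤p) p≤1 (^≤1 n 0≤p p≤1)

inv^suc≤inv : ∀ k s → inv k ^ suc s ≤ inv k
inv^suc≤inv k s = subst (inv k ^ suc s ≤_) (*-identityʳ (inv k)) (*-monoʳ-≤ (0≤inv k) (^≤1 s (0≤inv k) (inv≤1 k)))

½^≤inv : ∀ n → ½ ^ n ≤ inv (suc n)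
½^≤inv zero    = ≤-reflexive (sym inv1≡1)
½^≤inv (suc n) = ≤-trans (*-monoʳ-≤ 0≤½ (≤-trans (½^≤inv n) (inv≤2inv n (suc n) (s≤s (ℕ.m≤n+m (suc n) n)))))
  (≤-reflexive (solve 1 (λ s → con ½ :* (s :+ s) := s) refl (inv (suc (suc n)))))

zetaPartial≡ : ∀ s n → zetaPartial s n ≡ sum< n (λ k → inv (suc k) ^ s)
zetaPartial≡ s n = trans (∑≡sum< n (λ k → 1/ k ^ᴺ s)) (sum<-cong n (λ k _ → 1/^ᴺ≡inv^ k s))

liPartial≡ : ∀ p x n → liPartial p x n ≡ sum< n (λ k → x ^ suc k * inv (suc k) ^ p)
liPartial≡ p x n = trans (∑≡sum< n (λ k → x ^ k * 1/ k ^ᴺ p)) (sum<-cong n (λ k _ → cong (x ^ suc k *_) (1/^ᴺ≡inv^ k p)))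

cauchy-cong : ∀ {u v : ℕ → ℚ} → (∀ n → u n ≡ v n) → Cauchy v → Cauchy u
cauchy-cong {u} {v} h cv = asymptotic⇒cauchy u v (≡⇒asymptotic h) cv

increment : ∀ (f : ℕ → ℚ) n → sum< (suc n) f - sum< n f ≡ f n
increment f n = solve 2 (λ a b → (a :+ b) :- a := b) refl (sum< n f) (f n)

zeta-cauchy : ∀ s → Cauchy (zetaPartial (suc (suc s)))
zeta-cauchy s = cauchy-cong (zetaPartial≡ (suc (suc s))) (telescoping⇒cauchy (λ n → sum< n f) (λ n → inv (suc n) + inv (suc n)) step
  (λ k → 0≤-+ (0≤inv (suc k)) (0≤inv (suc k))) (null-+ (null-shift null-inv) (null-shift null-inv)))
  where
  f : ℕ → ℚ
  f k = inv (suc k) ^ suc (suc s)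
  step : ∀ k → ∣ sum< (suc k) f - sum< k f ∣ ≤ (inv (suc k) + inv (suc k)) - (inv (suc (suc k)) + inv (suc (suc k)))
  step k = begin
    ∣ sum< (suc k) f - sum< k f ∣           ≡⟨ cong ∣_∣ (increment f k) ⟩
    ∣ f k ∣                                 ≡⟨ 0≤p⇒∣p∣≡p (0≤^ (suc (suc s)) (0≤inv (suc k))) ⟩
    inv (suc k) * inv (suc k) ^ suc s       ≤⟨ *-monoʳ-≤ (0≤inv (suc k)) (≤-trans (inv^suc≤inv (suc k) s) (inv≤2inv k (suc k) (s≤s (ℕ.m≤n+m (suc k) k)))) ⟩
    r * (r′ + r′)                           ≡⟨ *-distribˡ-+ r r′ r′ ⟩
    r * r′ + r * r′                         ≡⟨ cong₂ _+_ (sym (inv-difference k)) (sym (inv-difference k)) ⟩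
    (r - r′) + (r - r′)                     ≡⟨ solve 2 (λ r s → (r :- s) :+ (r :- s) := (r :+ r) :- (s :+ s)) refl r r′ ⟩
    (r + r) - (r′ + r′)                     ∎
    where
    open ≤-Reasoning
    r = inv (suc k)
    r′ = inv (suc (suc k))

li-cauchy : ∀ s → Cauchy (liPartial s ½)
li-cauchy s = cauchy-cong (liPartial≡ s ½) (telescoping⇒cauchy (λ n → sum< n f) (½ ^_) step (λ k → 0≤^ k 0≤½)
  (null-dominated (λ n → subst (_≤ inv (suc n)) (sym (0≤p⇒∣p∣≡p (0≤^ n 0≤½))) (½^≤inv n)) (null-shift null-inv)))
  where
  f : ℕ → ℚ
  f k = ½ ^ suc k * inv (suc k) ^ s
  step : ∀ k → ∣ sum< (suc k) f - sum< k f ∣ ≤ ½ ^ k - ½ ^ suc k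
  step k = begin
    ∣ sum< (suc k) f - sum< k f ∣  ≡⟨ cong ∣_∣ (increment f k) ⟩
    ∣ f k ∣                        ≡⟨ 0≤p⇒∣p∣≡p (0≤-* (0≤^ (suc k) 0≤½) (0≤^ s (0≤inv (suc k)))) ⟩
    ½ ^ suc k * inv (suc k) ^ s    ≤⟨ *-monoʳ-≤ (0≤^ (suc k) 0≤½) (^≤1 s (0≤inv (suc k)) (inv≤1 (suc k))) ⟩
    ½ * ½ ^ k * 1ℚ                 ≡⟨ solve 1 (λ x → con ½ :* x :* con 1ℚ := x :- con ½ :* x) refl (½ ^ k) ⟩
    ½ ^ k - ½ ^ suc k              ∎
    where open ≤-Reasoning

-- The elementary symmetric polynomial of degree r in 1, 1/2, ..., 1/k. It majorises the partial
-- sums of every list of r entries, whatever their signs and exponents.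
multiharmonic : ℕ → ℕ → ℚ
multiharmonic zero    k       = 1ℚ
multiharmonic (suc r) zero    = 0ℚ
multiharmonic (suc r) (suc k) = multiharmonic (suc r) k + inv (suc k) * multiharmonic r k

0≤multiharmonic : ∀ r k → 0ℚ ≤ multiharmonic r k
0≤multiharmonic zero    k       = 0≤1
0≤multiharmonic (suc r) zero    = ≤-refl
0≤multiharmonic (suc r) (suc k) = 0≤-+ (0≤multiharmonic (suc r) k) (0≤-* (0≤inv (suc k)) (0≤multiharmonic r k))

∣factor∣≤inv : ∀ s k → ∣ factor s (suc k) ∣ ≤ inv (suc k)
∣factor∣≤inv (plain zero {{s≢0}})  k = ⊥-elim (ℕ.≢-nonZero⁻¹ 0 {{s≢0}} refl)
∣factor∣≤inv (plain (suc s)) k = subst (λ t → ∣ t ∣ ≤ inv (suc k)) (sym (1/^ᴺ≡inv^ k (suc s)))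
  (subst (_≤ inv (suc k)) (sym (0≤p⇒∣p∣≡p (0≤^ (suc s) (0≤inv (suc k))))) (inv^suc≤inv (suc k) s))
∣factor∣≤inv (bar zero {{s≢0}}) k = ⊥-elim (ℕ.≢-nonZero⁻¹ 0 {{s≢0}} refl)
∣factor∣≤inv (bar (suc s)) k = ≤-trans (∣p*q∣≤ (∣sgn∣≤1 (suc k)) (∣factor∣≤inv (plain (suc s)) k)) (≤-reflexive (*-identityˡ (inv (suc k))))

∣mzv∣≤multiharmonic : ∀ ss k → ∣ mzvPartial ss k ∣ ≤ multiharmonic (length ss) k
∣mzv∣≤multiharmonic []       k       = ≤-refl
∣mzv∣≤multiharmonic (s ∷ ss) zero    = ≤-refl
∣mzv∣≤multiharmonic (s ∷ ss) (suc k) = ∣p+q∣≤ (∣mzv∣≤multiharmonic (s ∷ ss) k) (∣p*q∣≤ (∣factor∣≤inv s k) (∣mzv∣≤multiharmonic ss k))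

-- The value of degree r + 1 at k is the sum over l < k of the value of degree r at l, divided by l
-- + 1. So each degree yields a Cesàro mean of the null sequence of the preceding one.
multiharmonic-sublinear : ∀ r → Null (λ k → inv (suc k) * multiharmonic r k)
multiharmonic-sublinear zero    = null-cong (λ k → sym (*-identityʳ (inv (suc k)))) (null-shift null-inv)
multiharmonic-sublinear (suc r) = null-cong (λ k → cong (inv (suc k) *_) (sym (as-sum k))) (null-average (multiharmonic-sublinear r))
  where
  as-sum : ∀ k → multiharmonic (suc r) k ≡ sum< k (λ l → inv (suc l) * multiharmonic r l)
  as-sum zero    = refl
  as-sum (suc k) = cong (_+ inv (suc k) * multiharmonic r k) (as-sum k)

multiharmonicUpTo : ℕ → ℕ → ℚ
multiharmonicUpTo zero    k = 1ℚ
multiharmonicUpTo (suc r) k = multiharmonicUpTo r k + multiharmonic (suc r) k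

-- The remainder from index k of the series with terms h(l) / ((l + 1) (l + 2)), where h has degree
-- r. Summation by parts splits off h(k) / (k + 1) and lowers the degree by one, whence the sum over
-- all degrees up to r.
tail : ℕ → ℕ → ℚ
tail r k = inv (suc k) * multiharmonicUpTo r k

0≤tail : ∀ r k → 0ℚ ≤ tail r k
0≤tail r k = 0≤-* (0≤inv (suc k)) (go r)
  where
  go : ∀ r → 0ℚ ≤ multiharmonicUpTo r k
  go zero    = 0≤1
  go (suc r) = 0≤-+ (go r) (0≤multiharmonic (suc r) k)

tail-null : ∀ r → Null (tail r)
tail-null zero    = multiharmonic-sublinear 0
tail-null (suc r) = null-cong (λ k → sym (*-distribˡ-+ (inv (suc k)) (multiharmonicUpTo r k) (multiharmonic (suc r) k)))
  (null-+ (tail-null r) (multiharmonic-sublinear (suc r)))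

tail-difference : ∀ r k → tail r k - tail r (suc k) ≡ inv (suc k) * inv (suc (suc k)) * multiharmonic r k
tail-difference r k = trans (cong (λ t → tail r k - inv (suc (suc k)) * t) (step r))
  (modulo (multiharmonicUpTo r k) (inv-difference k)
    (solve 4 (λ r s G h → r :* G :- s :* (G :+ r :* (G :- h)) := r :* s :* h :+ G :* (r :- s :- r :* s)) refl
      (inv (suc k)) (inv (suc (suc k))) (multiharmonicUpTo r k) (multiharmonic r k)))
  where
  step : ∀ r → multiharmonicUpTo r (suc k) ≡ multiharmonicUpTo r k + inv (suc k) * (multiharmonicUpTo r k - multiharmonic r k)
  step zero    = solve 1 (λ r → con 1ℚ := con 1ℚ :+ r :* (con 1ℚ :- con 1ℚ)) refl (inv (suc k))
  step (suc r) = trans (cong (_+ multiharmonic (suc r) (suc k)) (step r))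
    (solve 4 (λ r G h h′ → (G :+ r :* (G :- h)) :+ (h′ :+ r :* h) := (G :+ h′) :+ r :* ((G :+ h′) :- h′)) refl
      (inv (suc k)) (multiharmonicUpTo r k) (multiharmonic r k) (multiharmonic (suc r) k))

-- With T the partial sums of the alternating series ∑ (-1)ᵏ⁺¹ f k, the corrected sums T k - ½ (-1)ᵏ f k
-- have increments ± ½ (f k - f (k + 1)), which are absolutely summable.
alternating-cauchy : ∀ ss → Cauchy (mzvPartial (bar 1 ∷ ss))
alternating-cauchy ss = asymptotic⇒cauchy T corrected correction-null
  (telescoping⇒cauchy corrected E step (λ k → 0≤-+ (0≤tail r k) (0≤tail (pred r) k)) (null-+ (tail-null r) (tail-null (pred r))))
  where
  r = length ss
  H T f corrected E : ℕ → ℚ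
  H = mzvPartial ss
  T = mzvPartial (bar 1 ∷ ss)
  f k = inv (suc k) * H k
  corrected k = T k - ½ * (sgn k * f k)
  E k = tail r k + tail (pred r) k
  T-step : ∀ k → T (suc k) ≡ T k + sgn (suc k) * f k
  T-step k = cong (T k +_) (trans (cong (λ t → sgn (suc k) * t * H k) (trans (1/^ᴺ≡inv^ k 1) (*-identityʳ (inv (suc k)))))
    (*-assoc (sgn (suc k)) (inv (suc k)) (H k)))
  ∣f∣≤ : ∀ k → ∣ f k ∣ ≤ inv (suc k) * multiharmonic r k
  ∣f∣≤ k = ∣p*q∣≤ (≤-reflexive (0≤p⇒∣p∣≡p (0≤inv (suc k)))) (∣mzv∣≤multiharmonic ss k)
  correction-null : Asymptotic T corrected
  correction-null = null-cong (λ k → solve 2 (λ T x → con ½ :* x := T :- (T :- con ½ :* x)) refl (T k) (sgn k * f k))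
    (null-scale ½ (null-*bounded 1ℚ 0≤1 ∣sgn∣≤1 (null-dominated ∣f∣≤ (multiharmonic-sublinear r))))
  H-step : ∀ k → ∣ H (suc k) - H k ∣ ≤ inv (suc k) * multiharmonic (pred r) k
  H-step k = go ss
    where
    go : ∀ ss → ∣ mzvPartial ss (suc k) - mzvPartial ss k ∣ ≤ inv (suc k) * multiharmonic (pred (length ss)) k
    -- The empty list has constant partial sums, so any nonnegative bound will do, in particular the
    -- one with `pred 0 = 0`.
    go []       = subst (0ℚ ≤_) (sym (*-identityʳ (inv (suc k)))) (0≤inv (suc k))
    go (s ∷ ss) = subst (λ t → ∣ t ∣ ≤ inv (suc k) * multiharmonic (length ss) k)
      (solve 2 (λ a b → b := (a :+ b) :- a) refl (mzvPartial (s ∷ ss) k) (factor s (suc k) * mzvPartial ss k))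
      (∣p*q∣≤ (∣factor∣≤inv s k) (∣mzv∣≤multiharmonic ss k))
  f-step : ∀ k → ∣ f k - f (suc k) ∣ ≤ E k - E (suc k)
  f-step k = begin
    ∣ a * H k - b * H (suc k) ∣  ≡⟨ cong ∣_∣ (modulo (H k) (inv-difference k) (solve 4 (λ a b h h′ → a :* h :- b :* h′ := (a :* b :* h :- b :* (h′ :- h)) :+ h :* (a :- b :- a :* b)) refl a b (H k) (H (suc k)))) ⟩
    ∣ a * b * H k - b * (H (suc k) - H k) ∣
      ≤⟨ ∣p-q∣≤ (∣p*q∣≤ (≤-reflexive (0≤p⇒∣p∣≡p (0≤-* (0≤inv (suc k)) (0≤inv (suc (suc k)))))) (∣mzv∣≤multiharmonic ss k))
               (∣p*q∣≤ (≤-reflexive (0≤p⇒∣p∣≡p (0≤inv (suc (suc k))))) (H-step k)) ⟩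
    a * b * multiharmonic r k + b * (a * multiharmonic (pred r) k)
      ≡⟨ cong₂ _+_ (sym (tail-difference r k)) (trans (solve 3 (λ a b h → b :* (a :* h) := a :* b :* h) refl a b (multiharmonic (pred r) k)) (sym (tail-difference (pred r) k))) ⟩
    (tail r k - tail r (suc k)) + (tail (pred r) k - tail (pred r) (suc k))
      ≡⟨ solve 4 (λ a b c d → (a :- b) :+ (c :- d) := (a :+ c) :- (b :+ d)) refl (tail r k) (tail r (suc k)) (tail (pred r) k) (tail (pred r) (suc k)) ⟩
    E k - E (suc k) ∎
    where
    open ≤-Reasoning
    a = inv (suc k)
    b = inv (suc (suc k))
  step : ∀ k → ∣ corrected (suc k) - corrected k ∣ ≤ E k - E (suc k)
  step k = begin
    ∣ corrected (suc k) - corrected k ∣  ≡⟨ cong ∣_∣ (trans (cong (λ t → t - ½ * (sgn (suc k) * f (suc k)) - corrected k) (T-step k))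
      (solve 4 (λ T σ a b → (T :+ (:- con 1ℚ) :* σ :* a) :- con ½ :* ((:- con 1ℚ) :* σ :* b) :- (T :- con ½ :* (σ :* a))
         := (:- con ½) :* σ :* (a :- b)) refl (T k) (sgn k) (f k) (f (suc k)))) ⟩
    ∣ - ½ * sgn k * (f k - f (suc k)) ∣  ≤⟨ ∣p*q∣≤ (≤-trans (∣p*q∣≤ {p = - ½} {r = 1ℚ} (≤-from-difference ½ 0≤½ refl) (∣sgn∣≤1 k)) (≤-reflexive (*-identityˡ 1ℚ))) (f-step k) ⟩
    1ℚ * (E k - E (suc k))               ≡⟨ *-identityˡ (E k - E (suc k)) ⟩
    E k - E (suc k)                      ∎
    where open ≤-Reasoning

-- Discrete iterated integrals

integrate : (ℕ → ℚ) → (ℕ → ℚ) → ℕ → ℚ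
integrate ρ g zero    = 0ℚ
integrate ρ g (suc a) = integrate ρ g a + ρ a * g a

iterate : (ℕ → ℚ) → ℕ → (ℕ → ℚ) → ℕ → ℚ
iterate ρ zero    g = g
iterate ρ (suc m) g = integrate ρ (iterate ρ m g)

integrate-cong : ∀ (ρ f g : ℕ → ℚ) a → (∀ i → i ℕ.< a → f i ≡ g i) → integrate ρ f a ≡ integrate ρ g a
integrate-cong ρ f g zero    h = refl
integrate-cong ρ f g (suc a) h = cong₂ (λ x y → x + ρ a * y)
  (integrate-cong ρ f g a (λ i i<a → h i (ℕ.m<n⇒m<1+n i<a))) (h a ℕ.≤-refl)

iterate-cong : ∀ (ρ f g : ℕ → ℚ) m a → (∀ i → i ℕ.≤ a → f i ≡ g i) → iterate ρ m f a ≡ iterate ρ m g a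
iterate-cong ρ f g zero    a h = h a ℕ.≤-refl
iterate-cong ρ f g (suc m) a h = integrate-cong ρ (iterate ρ m f) (iterate ρ m g) a
  (λ i i<a → iterate-cong ρ f g m i (λ j j≤i → h j (ℕ.≤-trans j≤i (ℕ.<⇒≤ i<a))))

iterate-+ : ∀ (ρ f g : ℕ → ℚ) m a → iterate ρ m (λ i → f i + g i) a ≡ iterate ρ m f a + iterate ρ m g a
iterate-+ ρ f g zero    a       = refl
iterate-+ ρ f g (suc m) zero    = refl
iterate-+ ρ f g (suc m) (suc a) = trans (cong₂ (λ x y → x + ρ a * y) (iterate-+ ρ f g (suc m) a) (iterate-+ ρ f g m a))
  (solve 5 (λ x y r f g → (x :+ y) :+ r :* (f :+ g) := (x :+ r :* f) :+ (y :+ r :* g)) refl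
    (iterate ρ (suc m) f a) (iterate ρ (suc m) g a) (ρ a) (iterate ρ m f a) (iterate ρ m g a))

iterate-* : ∀ (ρ : ℕ → ℚ) c (f : ℕ → ℚ) m a → iterate ρ m (λ i → c * f i) a ≡ c * iterate ρ m f a
iterate-* ρ c f zero    a       = refl
iterate-* ρ c f (suc m) zero    = sym (*-zeroʳ c)
iterate-* ρ c f (suc m) (suc a) = trans (cong₂ (λ x y → x + ρ a * y) (iterate-* ρ c f (suc m) a) (iterate-* ρ c f m a))
  (solve 4 (λ x r c f → c :* x :+ r :* (c :* f) := c :* (x :+ r :* f)) refl
    (iterate ρ (suc m) f a) (ρ a) c (iterate ρ m f a))

iterate-iterate : ∀ (ρ : ℕ → ℚ) m j (f : ℕ → ℚ) → iterate ρ m (iterate ρ j f) ≡ iterate ρ (m ℕ.+ j) f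
iterate-iterate ρ zero    j f = refl
iterate-iterate ρ (suc m) j f = cong (integrate ρ) (iterate-iterate ρ m j f)

factor1≡inv : ∀ k → factor (plain 1) (suc k) ≡ inv (suc k)
factor1≡inv k = trans (1/^ᴺ≡inv^ k 1) (*-identityʳ (inv (suc k)))

factor2≡inv² : ∀ k → factor (plain 2) (suc k) ≡ inv (suc k) * inv (suc k)
factor2≡inv² k = trans (1/^ᴺ≡inv^ k 2) (cong (inv (suc k) *_) (*-identityʳ (inv (suc k))))

-- w a k plays the role of tᵏ at the a-th grid point, and ρ that of dt / (1 + t): the condition w-suc
-- discretises dtᵏ⁺¹ = (k + 1) (tᵏ + tᵏ⁺¹) dt / (1 + t).
module Grid
  (w : ℕ → ℕ → ℚ) (ρ : ℕ → ℚ) (K : ℕ)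
  (w-zero : ∀ a → w a 0 ≡ 1ℚ)
  (w-vanishes : ∀ {a k} → a ℕ.< k → w a k ≡ 0ℚ)
  (w-suc : ∀ i k → i ℕ.< K → w (suc i) (suc k) - w i (suc k) ≡ ι (suc k) * (ρ i * (w i k + w i (suc k))))
  where

  -- A multiple polylogarithm in one variable, taken at -t. Since `w a k` vanishes for k > a,
  -- truncation at `K` loses nothing at grid points a ≤ K.
  polylog : List Entry → ℕ → ℚ
  polylog []       a = 1ℚ
  polylog (s ∷ ss) a = sum< K (λ k → sgn (suc k) * w a (suc k) * (factor s (suc k) * mzvPartial ss k))

  polylog-zero : ∀ s ss → polylog (s ∷ ss) 0 ≡ 0ℚ
  polylog-zero s ss = sum<-0 K (λ k _ → trans (cong (λ t → sgn (suc k) * t * x k) (w-vanishes (s≤s z≤n)))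
    (solve 2 (λ σ x → σ :* con 0ℚ :* x := con 0ℚ) refl (sgn (suc k)) (x k)))
    where
    x : ℕ → ℚ
    x k = factor s (suc k) * mzvPartial ss k

  private
    -- The sum w i k + w i (suc k) stands for (1 + t) tᵏ. With alternating signs it telescopes,
    -- except for the increments of the coefficients `H`.
    by-parts : ∀ (H : ℕ → ℚ) i k → sum< k (λ k → sgn (suc k) * (w i k + w i (suc k)) * H k)
      ≡ sgn k * w i k * H k - H 0 - sum< k (λ k → sgn (suc k) * w i (suc k) * (H (suc k) - H k))
    by-parts H i zero    = sym (trans (cong (λ t → 1ℚ * t * H 0 - H 0 - 0ℚ) (w-zero i))
      (solve 1 (λ h → con 1ℚ :* con 1ℚ :* h :- h :- con 0ℚ := con 0ℚ) refl (H 0)))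
    by-parts H i (suc k) = trans (cong (_+ sgn (suc k) * (w i k + w i (suc k)) * H k) (by-parts H i k))
      (solve 7 (λ σ w w′ h h′ h₀ S → (σ :* w :* h :- h₀ :- S) :+ (:- con 1ℚ) :* σ :* (w :+ w′) :* h
         := (:- con 1ℚ) :* σ :* w′ :* h′ :- h₀ :- (S :+ (:- con 1ℚ) :* σ :* w′ :* (h′ :- h))) refl
         (sgn k) (w i k) (w i (suc k)) (H k) (H (suc k)) (H 0) (sum< k (λ k → sgn (suc k) * w i (suc k) * (H (suc k) - H k))))

    -- For a nonempty list the increments of the partial sums are the coefficients of its
    -- polylogarithm and the initial value is 0; for the empty list the increments vanish and the
    -- initial value 1 remains.
    polylog-increments : ∀ ss i → mzvPartial ss 0 + sum< K (λ k → sgn (suc k) * w i (suc k) * (mzvPartial ss (suc k) - mzvPartial ss k)) ≡ polylog ss i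
    polylog-increments []       i = cong (1ℚ +_) (sum<-0 K (λ k _ → *-zeroʳ (sgn (suc k) * w i (suc k))))
    polylog-increments (s ∷ ss) i = trans (+-identityˡ _) (sum<-cong K (λ k _ → cong (sgn (suc k) * w i (suc k) *_)
      (solve 2 (λ a b → (a :+ b) :- a := b) refl (mzvPartial (s ∷ ss) k) (factor s (suc k) * mzvPartial ss k))))

  -- A leading argument 1 means integration against -dt / (1 + t). The discrete form is exact
  -- because the boundary term at `K` contains `w i K`, which is 0 for i < K.
  polylog-plain1-suc : ∀ ss i → i ℕ.< K → polylog (plain 1 ∷ ss) (suc i) ≡ polylog (plain 1 ∷ ss) i - ρ i * polylog ss i
  polylog-plain1-suc ss i i<K = trans (solve 2 (λ x y → y := x :+ (y :- x)) refl (polylog (plain 1 ∷ ss) i) (polylog (plain 1 ∷ ss) (suc i)))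
    (cong (polylog (plain 1 ∷ ss) i +_) (begin
      polylog (plain 1 ∷ ss) (suc i) - polylog (plain 1 ∷ ss) i  ≡⟨ sym (sum<-- K (t (suc i)) (t i)) ⟩
      sum< K (λ k → t (suc i) k - t i k)                         ≡⟨ sum<-cong K (λ k _ → term k) ⟩
      sum< K (λ k → ρ i * (sgn (suc k) * (w i k + w i (suc k)) * H k))  ≡⟨ sum<-*ˡ K (ρ i) (λ k → sgn (suc k) * (w i k + w i (suc k)) * H k) ⟩
      ρ i * sum< K (λ k → sgn (suc k) * (w i k + w i (suc k)) * H k)    ≡⟨ cong (ρ i *_) (by-parts H i K) ⟩
      ρ i * (sgn K * w i K * H K - H 0 - S)                      ≡⟨ cong (λ t → ρ i * (sgn K * t * H K - H 0 - S)) (w-vanishes i<K) ⟩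
      ρ i * (sgn K * 0ℚ * H K - H 0 - S)
        ≡⟨ solve 5 (λ r σ h h₀ S → r :* (σ :* con 0ℚ :* h :- h₀ :- S) := :- (r :* (h₀ :+ S))) refl (ρ i) (sgn K) (H K) (H 0) S ⟩
      - (ρ i * (H 0 + S))                                        ≡⟨ cong (λ t → - (ρ i * t)) (polylog-increments ss i) ⟩
      - (ρ i * polylog ss i)                                     ∎))
    where
    open ≡-Reasoning
    H : ℕ → ℚ
    H = mzvPartial ss
    S = sum< K (λ k → sgn (suc k) * w i (suc k) * (H (suc k) - H k))
    t : ℕ → ℕ → ℚ
    t a k = sgn (suc k) * w a (suc k) * (factor (plain 1) (suc k) * H k)
    term : ∀ k → t (suc i) k - t i k ≡ ρ i * (sgn (suc k) * (w i k + w i (suc k)) * H k)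
    term k = begin
      t (suc i) k - t i k ≡⟨ cong (λ x → sgn (suc k) * w (suc i) (suc k) * (x * H k) - sgn (suc k) * w i (suc k) * (x * H k)) (factor1≡inv k) ⟩
      σ * w (suc i) (suc k) * (r * H k) - σ * w i (suc k) * (r * H k)
        ≡⟨ solve 5 (λ σ w′ w r h → σ :* w′ :* (r :* h) :- σ :* w :* (r :* h) := σ :* r :* h :* (w′ :- w)) refl σ (w (suc i) (suc k)) (w i (suc k)) r (H k) ⟩
      σ * r * H k * (w (suc i) (suc k) - w i (suc k))  ≡⟨ cong (σ * r * H k *_) (w-suc i k i<K) ⟩
      σ * r * H k * (ι (suc k) * (ρ i * v))
        ≡⟨ modulo (σ * H k * (ρ i * v)) (ι*inv≡1 k) (solve 6 (λ σ r h k ρ v → σ :* r :* h :* (k :* (ρ :* v)) := ρ :* (σ :* v :* h) :+ σ :* h :* (ρ :* v) :* (k :* r :- con 1ℚ)) refl σ r (H k) (ι (suc k)) (ρ i) v) ⟩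
      ρ i * (σ * v * H k) ∎
      where
      σ = sgn (suc k)
      r = inv (suc k)
      v = w i k + w i (suc k)

  polylog-plain1 : ∀ ss i → i ℕ.≤ K → polylog (plain 1 ∷ ss) i ≡ - integrate ρ (polylog ss) i
  polylog-plain1 ss zero    _   = polylog-zero (plain 1) ss
  polylog-plain1 ss (suc i) i<K = trans (polylog-plain1-suc ss i i<K)
    (trans (cong (_- ρ i * polylog ss i) (polylog-plain1 ss i (ℕ.<⇒≤ i<K)))
      (sym (neg-distrib-+ (integrate ρ (polylog ss) i) (ρ i * polylog ss i))))

  polylog-plain1s : ∀ m ss a → a ℕ.≤ K → polylog (replicate m (plain 1) ++ ss) a ≡ sgn m * iterate ρ m (polylog ss) a
  polylog-plain1s zero    ss a a≤K = sym (*-identityˡ (polylog ss a))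
  polylog-plain1s (suc m) ss a a≤K = trans (polylog-plain1 (replicate m (plain 1) ++ ss) a a≤K)
    (trans (cong -_ (trans
      (integrate-cong ρ _ (λ i → sgn m * iterate ρ m (polylog ss) i) a (λ i i<a → polylog-plain1s m ss i (ℕ.≤-trans (ℕ.<⇒≤ i<a) a≤K)))
      (iterate-* ρ (sgn m) (iterate ρ m (polylog ss)) 1 a)))
      (solve 2 (λ σ x → :- (σ :* x) := (:- con 1ℚ) :* σ :* x) refl (sgn m) (iterate ρ (suc m) (polylog ss) a)))

-- Up to the order of the factors this is the discretised polylogarithm at t = 1 of the list with a
-- leading argument 1: the sign of the bar becomes the sign in (-t)ᵏ.
mzv-smoothed : List Entry → ℕ → ℚ
mzv-smoothed ss n = sum< n (λ k → smoothing n (suc k) * (factor (bar 1) (suc k) * mzvPartial ss k))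

mzv~smoothed : ∀ ss → Asymptotic (mzvPartial (bar 1 ∷ ss)) (mzv-smoothed ss)
mzv~smoothed ss = asymptotic-trans {mzvPartial (bar 1 ∷ ss)} {λ n → sum< n t} {mzv-smoothed ss} (≡⇒asymptotic eq)
  (smoothing-preserves-limit t (cauchy-cong (λ n → sym (eq n)) (alternating-cauchy ss)))
  where
  t : ℕ → ℚ
  t k = factor (bar 1) (suc k) * mzvPartial ss k
  eq : ∀ n → mzvPartial (bar 1 ∷ ss) n ≡ sum< n t
  eq n = ∑≡sum< n (λ k → factor (bar 1) k * mzvPartial ss (pred k))

suc-∸-suc : ∀ {m i} → i ℕ.< m → m ℕ.∸ i ≡ suc (m ℕ.∸ suc i)
suc-∸-suc (s≤s i≤m) = ℕ.+-∸-assoc 1 i≤m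

-- The grid points s = i / 2n of [0, ½], where t = s / (1 - s)

-- Along the grid of s, where t = a / (2n - a), numerator and denominator both move; so the first
-- factor of each is split off.
fall-rising-suc : ∀ y a k → fall (rising y) (suc a) (suc k) ≡ ι (suc a) * (inv (suc y) * fall (rising (suc y)) a k)
fall-rising-suc y a zero    = trans (cong (λ t → 1ℚ * ((ι (suc a) - 0ℚ) * inv (suc t))) (ℕ.+-identityʳ y))
  (solve 2 (λ a r → con 1ℚ :* ((a :- con 0ℚ) :* r) := a :* (r :* con 1ℚ)) refl (ι (suc a)) (inv (suc y)))
fall-rising-suc y a (suc k) = trans (cong₂ (λ t x → t * ((ι (suc a) - ι (suc k)) * inv (suc x))) (fall-rising-suc y a k) (ℕ.+-suc y k))
  (solve 5 (λ a k r f r′ → (con 1ℚ :+ a) :* (r :* f) :* ((con 1ℚ :+ a :- (con 1ℚ :+ k)) :* r′) := (con 1ℚ :+ a) :* (r :* (f :* ((a :- k) :* r′)))) refl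
    (ι a) (ι k) (inv (suc y)) (fall (rising (suc y)) a k) (inv (suc (suc y ℕ.+ k))))

fall-rising-difference : ∀ y i k → fall (rising y) (suc i) (suc k) - fall (rising (suc y)) i (suc k)
  ≡ ι (suc k) * (inv (suc y) * (fall (rising (suc y)) i k + fall (rising (suc y)) i (suc k)))
fall-rising-difference y i k = trans (cong (_- fall (rising (suc y)) i (suc k)) (fall-rising-suc y i k))
  (modulo (f * (i′ - k′) * b) (ι*inv≡1 y) (modulo (- (f * (i′ - k′) * a)) (trans (cong (λ t → (1ℚ + (1ℚ + t)) * b) (sym (ι-+ y k))) (ι*inv≡1 (suc y ℕ.+ k)))
    (solve 6 (λ f i k y a b → (con 1ℚ :+ i) :* (a :* f) :- f :* ((i :- k) :* b)
      := (con 1ℚ :+ k) :* (a :* (f :+ f :* ((i :- k) :* b)))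
         :+ f :* (i :- k) :* b :* ((con 1ℚ :+ y) :* a :- con 1ℚ)
         :+ (:- (f :* (i :- k) :* a)) :* ((con 1ℚ :+ (con 1ℚ :+ (y :+ k))) :* b :- con 1ℚ)) refl f i′ k′ (ι y) a b)))
  where
  f = fall (rising (suc y)) i k
  i′ = ι i
  k′ = ι k
  a = inv (suc y)
  b = inv (suc (suc y ℕ.+ k))

-- Discretises tᵏ dt = tᵏ⁺¹ (ds / s + ds / (1 - s)), as dt / t is the sum of these two forms.
-- Exactness requires the right end of the cell for ds / s and the left end for ds / (1 - s).
fall-rising-difference₂ : ∀ y i k → inv (suc k) * (fall (rising y) (suc i) (suc k) - fall (rising (suc y)) i (suc k))
  ≡ inv (suc i) * fall (rising y) (suc i) (suc k) + inv (suc y) * fall (rising (suc y)) i (suc k)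
fall-rising-difference₂ y i k = trans (cong (inv (suc k) *_) (fall-rising-difference y i k)) (trans
  (modulo (a * (f + f′)) (ι*inv≡1 k) (modulo (- (a * f)) (ι*inv≡1 i)
    (solve 7 (λ f f′ i k a p q → p :* (k :* (a :* (f :+ f′)))
      := (q :* (i :* (a :* f)) :+ a :* f′) :+ a :* (f :+ f′) :* (k :* p :- con 1ℚ) :+ (:- (a :* f)) :* (i :* q :- con 1ℚ)) refl
      f f′ (ι (suc i)) (ι (suc k)) a (inv (suc k)) (inv (suc i)))))
  (cong (λ t → inv (suc i) * t + a * f′) (sym (fall-rising-suc y i k))))
  where
  f = fall (rising (suc y)) i k
  f′ = fall (rising (suc y)) i (suc k)
  a = inv (suc y)

-- The step 1 / 2n divided by 1 - i / 2n, that is, the form ds / (1 - s).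
ρ : ℕ → ℕ → ℚ
ρ n i = inv (n ℕ.+ n ℕ.∸ i)

private
  <⇒<2* : ∀ {i n} → i ℕ.< n → i ℕ.< n ℕ.+ n
  <⇒<2* {n = n} i<n = ℕ.≤-trans i<n (ℕ.m≤m+n n n)

-- The discretisation of (- ln (1 - s))ᵐ / m! at s = a / 2n
E : ℕ → ℕ → ℕ → ℚ
E n m = iterate (ρ n) m (λ _ → 1ℚ)

-- The discretisation of ∫ (- ln (1 - s))ᵏ / k! · ds / s
E/ : ℕ → ℕ → ℕ → ℚ
E/ n k a = sum< a (λ i → E n k (suc i) * inv (suc i))

module _ (n : ℕ) where
  private
    -- The replacement of tᵏ at t = a / (2n - a). At a = n, where s = ½ and t = 1, it is
    -- `smoothing n`.
    w : ℕ → ℕ → ℚ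
    w a = fall (rising (n ℕ.+ n ℕ.∸ a)) a

    w-suc : ∀ i k → i ℕ.< n → w (suc i) (suc k) - w i (suc k) ≡ ι (suc k) * (ρ n i * (w i k + w i (suc k)))
    w-suc i k i<n rewrite suc-∸-suc (<⇒<2* i<n) = fall-rising-difference (n ℕ.+ n ℕ.∸ suc i) i k

    w-suc₂ : ∀ i k → i ℕ.< n → inv (suc k) * (w (suc i) (suc k) - w i (suc k)) ≡ inv (suc i) * w (suc i) (suc k) + ρ n i * w i (suc k)
    w-suc₂ i k i<n rewrite suc-∸-suc (<⇒<2* i<n) = fall-rising-difference₂ (n ℕ.+ n ℕ.∸ suc i) i k

    open Grid w (ρ n) n (λ _ → refl) (λ {a} → fall-vanishes (rising (n ℕ.+ n ℕ.∸ a))) w-suc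

    polylog-1s : ∀ k a → a ℕ.≤ n → polylog (replicate k (plain 1)) a ≡ sgn k * E n k a
    polylog-1s zero    a a≤n = refl
    polylog-1s (suc k) a a≤n = trans (polylog-plain1 (replicate k (plain 1)) a a≤n)
      (trans (cong -_ (trans
        (integrate-cong (ρ n) _ (λ i → sgn k * E n k i) a (λ i i<a → polylog-1s k i (ℕ.≤-trans (ℕ.<⇒≤ i<a) a≤n)))
        (iterate-* (ρ n) (sgn k) (E n k) 1 a)))
        (solve 2 (λ σ x → :- (σ :* x) := (:- con 1ℚ) :* σ :* x) refl (sgn k) (E n (suc k) a)))

    polylog-plain2-suc : ∀ ss i → i ℕ.< n → polylog (plain 2 ∷ ss) (suc i)
      ≡ polylog (plain 2 ∷ ss) i + (inv (suc i) * polylog (plain 1 ∷ ss) (suc i) + ρ n i * polylog (plain 1 ∷ ss) i)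
    polylog-plain2-suc ss i i<n = trans (solve 2 (λ x y → y := x :+ (y :- x)) refl (polylog (plain 2 ∷ ss) i) (polylog (plain 2 ∷ ss) (suc i)))
      (cong (polylog (plain 2 ∷ ss) i +_) (begin
        polylog (plain 2 ∷ ss) (suc i) - polylog (plain 2 ∷ ss) i  ≡⟨ sym (sum<-- n (t 2 (suc i)) (t 2 i)) ⟩
        sum< n (λ k → t 2 (suc i) k - t 2 i k)                     ≡⟨ sum<-cong n (λ k _ → term k) ⟩
        sum< n (λ k → inv (suc i) * t 1 (suc i) k + ρ n i * t 1 i k)
          ≡⟨ sum<-+ n (λ k → inv (suc i) * t 1 (suc i) k) (λ k → ρ n i * t 1 i k) ⟩
        sum< n (λ k → inv (suc i) * t 1 (suc i) k) + sum< n (λ k → ρ n i * t 1 i k)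
          ≡⟨ cong₂ _+_ (sum<-*ˡ n (inv (suc i)) (t 1 (suc i))) (sum<-*ˡ n (ρ n i) (t 1 i)) ⟩
        inv (suc i) * polylog (plain 1 ∷ ss) (suc i) + ρ n i * polylog (plain 1 ∷ ss) i ∎))
      where
      open ≡-Reasoning
      t : ∀ s .{{_ : NonZero s}} → ℕ → ℕ → ℚ
      t s a k = sgn (suc k) * w a (suc k) * (factor (plain s) (suc k) * mzvPartial ss k)
      term : ∀ k → t 2 (suc i) k - t 2 i k ≡ inv (suc i) * t 1 (suc i) k + ρ n i * t 1 i k
      term k = begin
        t 2 (suc i) k - t 2 i k
          ≡⟨ cong (λ x → σ * w (suc i) (suc k) * (x * h) - σ * w i (suc k) * (x * h)) (factor2≡inv² k) ⟩
        σ * w (suc i) (suc k) * (r * r * h) - σ * w i (suc k) * (r * r * h)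
          ≡⟨ solve 5 (λ σ w′ w r h → σ :* w′ :* (r :* r :* h) :- σ :* w :* (r :* r :* h) := σ :* r :* h :* (r :* (w′ :- w))) refl σ (w (suc i) (suc k)) (w i (suc k)) r h ⟩
        σ * r * h * (r * (w (suc i) (suc k) - w i (suc k)))
          ≡⟨ cong (σ * r * h *_) (w-suc₂ i k i<n) ⟩
        σ * r * h * (inv (suc i) * w (suc i) (suc k) + ρ n i * w i (suc k))
          ≡⟨ solve 7 (λ σ r h p w′ q w → σ :* r :* h :* (p :* w′ :+ q :* w) := p :* (σ :* w′ :* (r :* h)) :+ q :* (σ :* w :* (r :* h))) refl σ r h (inv (suc i)) (w (suc i) (suc k)) (ρ n i) (w i (suc k)) ⟩
        inv (suc i) * (σ * w (suc i) (suc k) * (r * h)) + ρ n i * (σ * w i (suc k) * (r * h))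
          ≡⟨ cong (λ x → inv (suc i) * (σ * w (suc i) (suc k) * (x * h)) + ρ n i * (σ * w i (suc k) * (x * h))) (sym (factor1≡inv k)) ⟩
        inv (suc i) * t 1 (suc i) k + ρ n i * t 1 i k ∎
        where
        σ = sgn (suc k)
        r = inv (suc k)
        h = mzvPartial ss k

    -- The case of all arguments 1 is integrated against dt / t: the part ds / s gives `E/`, which
    -- also samples at the right end of each cell, and the part ds / (1 - s) gives one more
    -- iteration in `E`.
    polylog-2-1s : ∀ k a → a ℕ.≤ n → polylog (plain 2 ∷ replicate k (plain 1)) a ≡ sgn (suc k) * (E/ n (suc k) a + E n (suc (suc k)) a)
    polylog-2-1s k zero    a≤n = trans (polylog-zero (plain 2) (replicate k (plain 1))) (sym (*-zeroʳ (sgn (suc k))))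
    polylog-2-1s k (suc a) a<n = trans (polylog-plain2-suc (replicate k (plain 1)) a a<n)
      (trans (cong₂ _+_ (polylog-2-1s k a (ℕ.<⇒≤ a<n)) (cong₂ (λ x y → inv (suc a) * x + ρ n a * y) (polylog-1s (suc k) (suc a) a<n) (polylog-1s (suc k) a (ℕ.<⇒≤ a<n))))
      (solve 7 (λ σ x y p e q e′ → σ :* (x :+ y) :+ (p :* (σ :* e) :+ q :* (σ :* e′)) := σ :* ((x :+ e :* p) :+ (y :+ q :* e′))) refl
        (sgn (suc k)) (E/ n (suc k) a) (E n (suc (suc k)) a) (inv (suc a)) (E n (suc k) (suc a)) (ρ n a) (E n (suc k) a)))

  smoothed-1s-2-1s : ∀ m k → mzv-smoothed (replicate m (plain 1) ++ plain 2 ∷ replicate k (plain 1)) n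
    ≡ sgn (suc m) * sgn (suc k) * (iterate (ρ n) (suc m) (E/ n (suc k)) n + E n (suc m ℕ.+ suc (suc k)) n)
  smoothed-1s-2-1s m k = begin
    mzv-smoothed ss n                                     ≡⟨ sum<-cong n (λ j _ → term j) ⟩
    polylog (plain 1 ∷ ss) n                              ≡⟨ polylog-plain1s (suc m) (plain 2 ∷ replicate k (plain 1)) n ℕ.≤-refl ⟩
    sgn (suc m) * iterate (ρ n) (suc m) (polylog (plain 2 ∷ replicate k (plain 1))) n
      ≡⟨ cong (sgn (suc m) *_) (iterate-cong (ρ n) _ (λ a → sgn (suc k) * (E/ n (suc k) a + E n (suc (suc k)) a)) (suc m) n (polylog-2-1s k)) ⟩
    sgn (suc m) * iterate (ρ n) (suc m) (λ a → sgn (suc k) * (E/ n (suc k) a + E n (suc (suc k)) a)) n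
      ≡⟨ cong (sgn (suc m) *_) (trans (iterate-* (ρ n) (sgn (suc k)) (λ a → E/ n (suc k) a + E n (suc (suc k)) a) (suc m) n)
           (cong (sgn (suc k) *_) (trans (iterate-+ (ρ n) (E/ n (suc k)) (E n (suc (suc k))) (suc m) n)
             (cong (λ g → iterate (ρ n) (suc m) (E/ n (suc k)) n + g n) (iterate-iterate (ρ n) (suc m) (suc (suc k)) (λ _ → 1ℚ)))))) ⟩
    sgn (suc m) * (sgn (suc k) * X)                       ≡⟨ sym (*-assoc (sgn (suc m)) (sgn (suc k)) X) ⟩
    sgn (suc m) * sgn (suc k) * X                         ∎
    where
    open ≡-Reasoning
    ss = replicate m (plain 1) ++ plain 2 ∷ replicate k (plain 1)
    X = iterate (ρ n) (suc m) (E/ n (suc k)) n + E n (suc m ℕ.+ suc (suc k)) n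
    term : ∀ j → smoothing n (suc j) * (factor (bar 1) (suc j) * mzvPartial ss j) ≡ sgn (suc j) * w n (suc j) * (factor (plain 1) (suc j) * mzvPartial ss j)
    term j rewrite ℕ.m+n∸n≡m n n = solve 4 (λ c σ f h → c :* ((σ :* f) :* h) := σ :* c :* (f :* h)) refl
      (smoothing n (suc j)) (sgn (suc j)) (factor (plain 1) (suc j)) (mzvPartial ss j)

-- Bounds for the discrete iterated integrals

0≤ρ : ∀ n i → 0ℚ ≤ ρ n i
0≤ρ n i = 0≤inv (n ℕ.+ n ℕ.∸ i)

ρ≤inv : ∀ {n i} → i ℕ.< n → ρ n i ≤ inv n
ρ≤inv {suc n} {i} i<n = inv-antitone (subst (ℕ._≤ suc n ℕ.+ suc n ℕ.∸ i) (ℕ.m+n∸n≡m (suc n) (suc n))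
  (ℕ.∸-monoʳ-≤ (suc n ℕ.+ suc n) (ℕ.<⇒≤ i<n)))

ι*inv≤1′ : ∀ {a n} → a ℕ.≤ n → ι a * inv n ≤ 1ℚ
ι*inv≤1′ {a} {n} a≤n = ≤-trans (*-monoˡ-≤ (0≤inv n) (ι-mono a≤n)) (ι*inv≤1 n)

0≤p≤q⇒∣p∣≤q : ∀ {p q} → 0ℚ ≤ p → p ≤ q → ∣ p ∣ ≤ q
0≤p≤q⇒∣p∣≤q {p} {q} 0≤p p≤q = subst (_≤ q) (sym (0≤p⇒∣p∣≡p 0≤p)) p≤q

0≤iterate : ∀ n (g : ℕ → ℚ) → (∀ a → 0ℚ ≤ g a) → ∀ m a → 0ℚ ≤ iterate (ρ n) m g a
0≤iterate n g 0≤g zero    a       = 0≤g a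
0≤iterate n g 0≤g (suc m) zero    = ≤-refl
0≤iterate n g 0≤g (suc m) (suc a) = 0≤-+ (0≤iterate n g 0≤g (suc m) a) (0≤-* (0≤ρ n a) (0≤iterate n g 0≤g m a))

integrate≤ : ∀ n (g : ℕ → ℚ) → (∀ a → 0ℚ ≤ g a) → (∀ a → a ℕ.≤ n → g a ≤ 1ℚ) → ∀ a → a ℕ.≤ n → integrate (ρ n) g a ≤ ι a * inv n
integrate≤ n g 0≤g g≤1 zero    _   = ≤-reflexive (sym (*-zeroˡ (inv n)))
integrate≤ n g 0≤g g≤1 (suc a) a<n = ≤-trans
  (+-mono-≤ (integrate≤ n g 0≤g g≤1 a (ℕ.<⇒≤ a<n)) (*-mono-≤ (0≤ρ n a) (0≤g a) (ρ≤inv a<n) (g≤1 a (ℕ.<⇒≤ a<n))))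
  (≤-reflexive (solve 2 (λ a r → a :* r :+ r :* con 1ℚ := (con 1ℚ :+ a) :* r) refl (ι a) (inv n)))

iterate≤1 : ∀ n (g : ℕ → ℚ) → (∀ a → 0ℚ ≤ g a) → (∀ a → a ℕ.≤ n → g a ≤ 1ℚ) → ∀ m a → a ℕ.≤ n → iterate (ρ n) m g a ≤ 1ℚ
iterate≤1 n g 0≤g g≤1 zero    a a≤n = g≤1 a a≤n
iterate≤1 n g 0≤g g≤1 (suc m) a a≤n = ≤-trans
  (integrate≤ n (iterate (ρ n) m g) (0≤iterate n g 0≤g m) (iterate≤1 n g 0≤g g≤1 m) a a≤n) (ι*inv≤1′ a≤n)

0≤E : ∀ n m a → 0ℚ ≤ E n m a
0≤E n = 0≤iterate n (λ _ → 1ℚ) (λ _ → 0≤1)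

E≤1 : ∀ n m a → a ℕ.≤ n → E n m a ≤ 1ℚ
E≤1 n = iterate≤1 n (λ _ → 1ℚ) (λ _ → 0≤1) (λ _ _ → ≤-refl)

-- In positive order the iterated sums vanish linearly at s = 0, which pays for later divisions by
-- an index.
E-suc≤ : ∀ n m a → a ℕ.≤ n → E n (suc m) a ≤ ι a * inv n
E-suc≤ n m = integrate≤ n (E n m) (0≤E n m) (E≤1 n m)

ι*p*inv≤p : ∀ i p → 0ℚ ≤ p → ι (suc i) * p * inv (suc i) ≤ p
ι*p*inv≤p i p 0≤p = ≤-reflexive (modulo p (ι*inv≡1 i)
  (solve 3 (λ i p r → i :* p :* r := p :+ p :* (i :* r :- con 1ℚ)) refl (ι (suc i)) p (inv (suc i))))

0≤E/ : ∀ n k a → 0ℚ ≤ E/ n k a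
0≤E/ n k a = 0≤sum< a (λ i _ → 0≤-* (0≤E n k (suc i)) (0≤inv (suc i)))

E/≤1 : ∀ n k a → a ℕ.≤ n → E/ n (suc k) a ≤ 1ℚ
E/≤1 n k a a≤n = ≤-trans (sum<-mono a (λ i i<a → ≤-trans
    (*-monoˡ-≤ (0≤inv (suc i)) (E-suc≤ n k (suc i) (ℕ.≤-trans i<a a≤n))) (ι*p*inv≤p i (inv n) (0≤inv n))))
  (subst (_≤ 1ℚ) (sym (sum<-const a (inv n))) (ι*inv≤1′ a≤n))

-- Solutions of the discrete equation below are of second order in 1 / n.
remainder-bound : ∀ n (R t : ℕ → ℕ → ℚ) C → 0ℚ ≤ C →
  (∀ a → a ℕ.≤ n → ∣ R 0 a ∣ ≤ C * (ι a * (inv n * inv n))) →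
  (∀ m → R (suc m) 0 ≡ 0ℚ) →
  (∀ m a → a ℕ.< n → R (suc m) (suc a) ≡ R (suc m) a + ρ n a * R m a + ρ n a * ρ n a * t m a) →
  (∀ m a → a ℕ.< n → ∣ t m a ∣ ≤ 1ℚ) →
  ∀ m a → a ℕ.≤ n → ∣ R m a ∣ ≤ (ι m + C) * (ι a * (inv n * inv n))
remainder-bound n R t C 0≤C base R-zero R-suc t≤1 zero a a≤n =
  subst (λ c → ∣ R 0 a ∣ ≤ c * (ι a * (inv n * inv n))) (sym (+-identityˡ C)) (base a a≤n)
remainder-bound n R t C 0≤C base R-zero R-suc t≤1 (suc m) zero _ =
  ≤-reflexive (trans (cong ∣_∣ (R-zero m)) (solve 2 (λ c r → con 0ℚ := c :* (con 0ℚ :* r)) refl (ι (suc m) + C) (inv n * inv n)))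
remainder-bound n R t C 0≤C base R-zero R-suc t≤1 (suc m) (suc a) a<n = begin
  ∣ R (suc m) (suc a) ∣                               ≡⟨ cong ∣_∣ (R-suc m a a<n) ⟩
  ∣ R (suc m) a + ρ n a * R m a + ρ n a * ρ n a * t m a ∣
    ≤⟨ ∣p+q∣≤ (∣p+q∣≤ (bound (suc m)) (∣p*q∣≤ ∣ρ∣≤r (bound m))) (∣p*q∣≤ (∣p*q∣≤ ∣ρ∣≤r ∣ρ∣≤r) (t≤1 m a a<n)) ⟩
  (ι (suc m) + C) * (ι a * (r * r)) + r * ((ι m + C) * (ι a * (r * r))) + r * r * 1ℚ
    -- Since a / n ≤ 1, the last two summands are at most (m + C) r² + r², the growth allowed
    -- between a and a + 1.
    ≤⟨ ≤-from-difference ((ι m + C) * (r * r) * (1ℚ - ι a * r))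
         (0≤-* (0≤-* (0≤-+ (0≤ι m) 0≤C) (0≤-* 0≤r 0≤r)) (≤⇒0≤- (ι*inv≤1′ (ℕ.<⇒≤ a<n))))
         (solve 4 (λ m C a r → (con 1ℚ :+ m :+ C) :* ((con 1ℚ :+ a) :* (r :* r))
            := (con 1ℚ :+ m :+ C) :* (a :* (r :* r)) :+ r :* ((m :+ C) :* (a :* (r :* r))) :+ r :* r :* con 1ℚ
               :+ (m :+ C) :* (r :* r) :* (con 1ℚ :- a :* r)) refl (ι m) C (ι a) r) ⟩
  (ι (suc m) + C) * (ι (suc a) * (r * r))             ∎
  where
  open ≤-Reasoning
  r = inv n
  0≤r = 0≤inv n
  ∣ρ∣≤r : ∣ ρ n a ∣ ≤ r
  ∣ρ∣≤r = 0≤p≤q⇒∣p∣≤q (0≤ρ n a) (ρ≤inv a<n)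
  bound : ∀ m → ∣ R m a ∣ ≤ (ι m + C) * (ι a * (r * r))
  bound m = remainder-bound n R t C 0≤C base R-zero R-suc t≤1 m a (ℕ.<⇒≤ a<n)

-- Discrete versions of f · fᵐ / m! = (m + 1) · fᵐ⁺¹ / (m + 1)! and its consequences.
E₁*E-error : ∀ n m a → a ℕ.≤ n → ∣ E n 1 a * E n m a - ι (suc m) * E n (suc m) a ∣ ≤ ι m * (ι a * (inv n * inv n))
E₁*E-error n m a a≤n = subst (λ c → ∣ R m a ∣ ≤ c * (ι a * (inv n * inv n))) (+-identityʳ (ι m))
  (remainder-bound n R (E n) 0ℚ ≤-refl
    (λ a _ → ≤-reflexive (trans (cong ∣_∣ (solve 1 (λ e → e :* con 1ℚ :- (con 1ℚ :+ con 0ℚ) :* e := con 0ℚ) refl (E n 1 a))) (sym (*-zeroˡ (ι a * (inv n * inv n))))))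
    (λ m → solve 1 (λ m → con 0ℚ :* con 0ℚ :- m :* con 0ℚ := con 0ℚ) refl (ι (suc (suc m))))
    (λ m a _ → solve 6 (λ e ρ f g h m → (e :+ ρ :* con 1ℚ) :* (g :+ ρ :* f) :- (con 1ℚ :+ (con 1ℚ :+ m)) :* (h :+ ρ :* g)
      := (e :* g :- (con 1ℚ :+ (con 1ℚ :+ m)) :* h) :+ ρ :* (e :* f :- (con 1ℚ :+ m) :* g) :+ ρ :* ρ :* f) refl
      (E n 1 a) (ρ n a) (E n m a) (E n (suc m) a) (E n (suc (suc m)) a) (ι m))
    (λ m a a<n → 0≤p≤q⇒∣p∣≤q (0≤E n m a) (E≤1 n m a (ℕ.<⇒≤ a<n))) m a a≤n)
  where
  R : ℕ → ℕ → ℚ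
  R m a = E n 1 a * E n m a - ι (suc m) * E n (suc m) a

-- With f = - ln (1 - s), the m-fold iterate of `E/ n k` discretises the integral of (f(x) - f(s))ᵐ
-- / m! · f(s)ᵏ / k! · ds / s up to x. Multiplying by f(x) = (f(x) - f(s)) + f(s) raises either m or
-- k.
E₁*iterate-E/-error : ∀ n k m a → a ℕ.≤ n →
  ∣ E n 1 a * iterate (ρ n) m (E/ n (suc k)) a - ι (suc (suc k)) * iterate (ρ n) m (E/ n (suc (suc k))) a
    - ι (suc m) * iterate (ρ n) (suc m) (E/ n (suc k)) a ∣ ≤ (ι m + ι (suc k)) * (ι a * (inv n * inv n))
E₁*iterate-E/-error n k = remainder-bound n R (λ m → X m (suc k)) (ι (suc k)) (0≤ι (suc k)) base
    (λ m → solve 2 (λ j m → con 0ℚ :* con 0ℚ :- j :* con 0ℚ :- m :* con 0ℚ := con 0ℚ) refl (ι (suc (suc k))) (ι (suc (suc m))))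
    (λ m a _ → solve 9 (λ e ρ f g h f′ g′ j m → (e :+ ρ :* con 1ℚ) :* (g :+ ρ :* f) :- j :* (g′ :+ ρ :* f′) :- (con 1ℚ :+ (con 1ℚ :+ m)) :* (h :+ ρ :* g)
      := (e :* g :- j :* g′ :- (con 1ℚ :+ (con 1ℚ :+ m)) :* h) :+ ρ :* (e :* f :- j :* f′ :- (con 1ℚ :+ m) :* g) :+ ρ :* ρ :* f) refl
      (E n 1 a) (ρ n a) (X m (suc k) a) (X (suc m) (suc k) a) (X (suc (suc m)) (suc k) a) (X m (suc (suc k)) a) (X (suc m) (suc (suc k)) a) (ι (suc (suc k))) (ι m))
    (λ m a a<n → 0≤p≤q⇒∣p∣≤q (0≤iterate n (E/ n (suc k)) (0≤E/ n (suc k)) m a) (iterate≤1 n (E/ n (suc k)) (0≤E/ n (suc k)) (E/≤1 n k) m a (ℕ.<⇒≤ a<n)))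
  where
  X : ℕ → ℕ → ℕ → ℚ
  X m k = iterate (ρ n) m (E/ n k)
  R : ℕ → ℕ → ℚ
  R m a = E n 1 a * X m (suc k) a - ι (suc (suc k)) * X m (suc (suc k)) a - ι (suc m) * X (suc m) (suc k) a
  base : ∀ a → a ℕ.≤ n → ∣ R 0 a ∣ ≤ ι (suc k) * (ι a * (inv n * inv n))
  base zero    _   = ≤-reflexive (trans
    (cong ∣_∣ (solve 1 (λ j → con 0ℚ :* con 0ℚ :- j :* con 0ℚ :- (con 1ℚ :+ con 0ℚ) :* con 0ℚ := con 0ℚ) refl (ι (suc (suc k)))))
    (solve 2 (λ k r → con 0ℚ := k :* (con 0ℚ :* r)) refl (ι (suc k)) (inv n * inv n)))
  -- Each step adds an error from `E₁*E-error` divided by a + 1; the linear factor of that bound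
  -- cancels the division.
  base (suc a) a<n = begin
    ∣ R 0 (suc a) ∣
      ≡⟨ cong ∣_∣ (solve 9 (λ e ρ W p e′ j W′ e″ J → (e :+ ρ :* con 1ℚ) :* (W :+ e′ :* p) :- j :* (W′ :+ e″ :* p) :- (con 1ℚ :+ con 0ℚ) :* (J :+ ρ :* W)
           := (e :* W :- j :* W′ :- (con 1ℚ :+ con 0ℚ) :* J) :+ ((e :+ ρ :* con 1ℚ) :* e′ :- j :* e″) :* p) refl
           (E n 1 a) (ρ n a) (E/ n (suc k) a) (inv (suc a)) (E n (suc k) (suc a)) (ι (suc (suc k))) (E/ n (suc (suc k)) a) (E n (suc (suc k)) (suc a)) (X 1 (suc k) a)) ⟩
    ∣ R 0 a + (E n 1 (suc a) * E n (suc k) (suc a) - ι (suc (suc k)) * E n (suc (suc k)) (suc a)) * inv (suc a) ∣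
      ≤⟨ ∣p+q∣≤ (base a (ℕ.<⇒≤ a<n)) (∣p*q∣≤ (E₁*E-error n (suc k) (suc a) a<n) (0≤p≤q⇒∣p∣≤q (0≤inv (suc a)) ≤-refl)) ⟩
    ι (suc k) * (ι a * (inv n * inv n)) + ι (suc k) * (ι (suc a) * (inv n * inv n)) * inv (suc a)
      ≡⟨ modulo (ι (suc k) * (inv n * inv n)) (ι*inv≡1 a) (solve 4 (λ k a p s → k :* (a :* s) :+ k :* ((con 1ℚ :+ a) :* s) :* p
           := k :* ((con 1ℚ :+ a) :* s) :+ k :* s :* ((con 1ℚ :+ a) :* p :- con 1ℚ)) refl (ι (suc k)) (ι a) (inv (suc a)) (inv n * inv n)) ⟩
    ι (suc k) * (ι (suc a) * (inv n * inv n)) ∎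
    where open ≤-Reasoning

-- The variant of E with weakly decreasing indices
H : ℕ → ℕ → ℕ → ℚ
H n zero    a       = 1ℚ
H n (suc p) zero    = 0ℚ
H n (suc p) (suc a) = H n (suc p) a + ρ n a * H n p (suc a)

H/ : ℕ → ℕ → ℕ → ℚ
H/ n p a = sum< a (λ i → H n p (suc i) * inv (suc i))

0≤H : ∀ n p a → 0ℚ ≤ H n p a
0≤H n zero    a       = 0≤1
0≤H n (suc p) zero    = ≤-refl
0≤H n (suc p) (suc a) = 0≤-+ (0≤H n (suc p) a) (0≤-* (0≤ρ n a) (0≤H n p (suc a)))

H≤1 : ∀ n p a → a ℕ.≤ n → H n p a ≤ 1ℚ
H≤1 n zero    a a≤n = ≤-refl
H≤1 n (suc p) a a≤n = ≤-trans (go a a≤n) (ι*inv≤1′ a≤n)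
  where
  go : ∀ a → a ℕ.≤ n → H n (suc p) a ≤ ι a * inv n
  go zero    _   = ≤-reflexive (sym (*-zeroˡ (inv n)))
  go (suc a) a<n = ≤-trans
    (+-mono-≤ (go a (ℕ.<⇒≤ a<n)) (*-mono-≤ (0≤ρ n a) (0≤H n p (suc a)) (ρ≤inv a<n) (H≤1 n p (suc a) a<n)))
    (≤-reflexive (solve 2 (λ a r → a :* r :+ r :* con 1ℚ := (con 1ℚ :+ a) :* r) refl (ι a) (inv n)))

H-E-error : ∀ n p a → a ℕ.≤ n → ∣ H n p a - E n p a ∣ ≤ ι p * (ι a * (inv n * inv n))
H-E-error n p a a≤n = subst (λ c → ∣ H n p a - E n p a ∣ ≤ c * (ι a * (inv n * inv n))) (+-identityʳ (ι p))
  (remainder-bound n (λ p a → H n p a - E n p a) t 0ℚ ≤-refl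
    (λ a _ → ≤-reflexive (sym (*-zeroˡ (ι a * (inv n * inv n)))))
    (λ m → refl) step t≤1 p a a≤n)
  where
  -- `H` takes its lower order at the new index. This exceeds the value at the old index by ρ t,
  -- hence the second-order term ρ² t in the step.
  t : ℕ → ℕ → ℚ
  t zero    a = 0ℚ
  t (suc p) a = H n p (suc a)
  H-step : ∀ p a → H n p (suc a) ≡ H n p a + ρ n a * t p a
  H-step zero    a = sym (trans (cong (1ℚ +_) (*-zeroʳ (ρ n a))) (+-identityʳ 1ℚ))
  H-step (suc p) a = refl
  step : ∀ m a → a ℕ.< n → H n (suc m) (suc a) - E n (suc m) (suc a)
    ≡ (H n (suc m) a - E n (suc m) a) + ρ n a * (H n m a - E n m a) + ρ n a * ρ n a * t m a
  step m a _ = trans (cong (λ x → H n (suc m) a + ρ n a * x - E n (suc m) (suc a)) (H-step m a))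
    (solve 6 (λ h ρ h′ t e e′ → (h :+ ρ :* (h′ :+ ρ :* t)) :- (e :+ ρ :* e′) := (h :- e) :+ ρ :* (h′ :- e′) :+ ρ :* ρ :* t) refl
      (H n (suc m) a) (ρ n a) (H n m a) (t m a) (E n (suc m) a) (E n m a))
  t≤1 : ∀ m a → a ℕ.< n → ∣ t m a ∣ ≤ 1ℚ
  t≤1 zero    a a<n = 0≤1
  t≤1 (suc m) a a<n = 0≤p≤q⇒∣p∣≤q (0≤H n m (suc a)) (H≤1 n m (suc a) a<n)

second-order-at-n : ∀ n c → 0ℚ ≤ c → c * (ι n * (inv n * inv n)) ≤ c * inv n
second-order-at-n n c 0≤c = *-monoʳ-≤ 0≤c (subst₂ _≤_ (*-assoc (ι n) (inv n) (inv n)) (*-identityˡ (inv n))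
  (*-monoˡ-≤ (0≤inv n) (ι*inv≤1 n)))

E₁*E~ : ∀ m → Asymptotic (λ n → E n 1 n * E n m n) (λ n → ι (suc m) * E n (suc m) n)
E₁*E~ m = null-dominated (λ n → ≤-trans (E₁*E-error n m n ℕ.≤-refl) (second-order-at-n n (ι m) (0≤ι m))) (null-scale (ι m) null-inv)

E₁*iterate-E/~ : ∀ k m → Null (λ n → E n 1 n * iterate (ρ n) m (E/ n (suc k)) n - ι (suc (suc k)) * iterate (ρ n) m (E/ n (suc (suc k))) n
    - ι (suc m) * iterate (ρ n) (suc m) (E/ n (suc k)) n)
E₁*iterate-E/~ k m = null-dominated (λ n → ≤-trans (E₁*iterate-E/-error n k m n ℕ.≤-refl)
  (second-order-at-n n (ι m + ι (suc k)) (0≤-+ (0≤ι m) (0≤ι (suc k))))) (null-scale (ι m + ι (suc k)) null-inv)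

H~E : ∀ p → Asymptotic (λ n → H n p n) (λ n → E n p n)
H~E p = null-dominated (λ n → ≤-trans (H-E-error n p n ℕ.≤-refl) (second-order-at-n n (ι p) (0≤ι p))) (null-scale (ι p) null-inv)

H/~E/ : ∀ p → Asymptotic (λ n → H/ n p n) (λ n → E/ n p n)
H/~E/ p = null-dominated (λ n → ≤-trans (bound n) (second-order-at-n n (ι p) (0≤ι p))) (null-scale (ι p) null-inv)
  where
  bound : ∀ n → ∣ H/ n p n - E/ n p n ∣ ≤ ι p * (ι n * (inv n * inv n))
  bound n = subst₂ (λ x y → ∣ x ∣ ≤ y)
    (trans (sum<-cong n (λ i _ → solve 3 (λ h e r → (h :- e) :* r := h :* r :- e :* r) refl (H n p (suc i)) (E n p (suc i)) (inv (suc i))))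
      (sum<-- n (λ i → H n p (suc i) * inv (suc i)) (λ i → E n p (suc i) * inv (suc i))))
    (trans (sum<-const n (ι p * (inv n * inv n))) (solve 3 (λ n p s → n :* (p :* s) := p :* (n :* s)) refl (ι n) (ι p) (inv n * inv n)))
    (∣sum<∣≤ n (λ i i<n → ≤-trans
      (∣p*q∣≤ (H-E-error n p (suc i) i<n) (0≤p≤q⇒∣p∣≤q (0≤inv (suc i)) ≤-refl))
      (≤-reflexive (modulo (ι p * (inv n * inv n)) (ι*inv≡1 i)
        (solve 4 (λ p i s r → p :* (i :* s) :* r := p :* s :+ p :* s :* (i :* r :- con 1ℚ)) refl (ι p) (ι (suc i)) (inv n * inv n) (inv (suc i)))))))

-- The grid points t = a / n of [0, 1]

sgn*sgn≡1 : ∀ k → sgn k * sgn k ≡ 1ℚ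
sgn*sgn≡1 zero    = refl
sgn*sgn≡1 (suc k) = trans (solve 1 (λ s → (:- con 1ℚ) :* s :* ((:- con 1ℚ) :* s) := s :* s) refl (sgn k)) (sgn*sgn≡1 k)

ι-∸-suc : ∀ {j n} → j ℕ.< n → ι (n ℕ.∸ suc j) ≡ ι n - ι j - 1ℚ
ι-∸-suc {j} {n} j<n = trans (ι-∸ j<n) (solve 2 (λ n j → n :- (con 1ℚ :+ j) := n :- j :- con 1ℚ) refl (ι n) (ι j))

iterate-integrate : ∀ (ρ g : ℕ → ℚ) m → iterate ρ m (integrate ρ g) ≡ iterate ρ (suc m) g
iterate-integrate ρ g zero    = refl
iterate-integrate ρ g (suc m) = cong (integrate ρ) (iterate-integrate ρ g m)

null-square : ∀ (u : ℕ → ℚ) → (∀ n → 0ℚ ≤ u n) → Null (λ n → u n * u n) → Null u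
null-square u 0≤u h ε 0<ε with N , hN ← h (ε * ε) (0<-* 0<ε 0<ε) = N , λ n N≤n →
  subst (_< ε) (sym (0≤p⇒∣p∣≡p (0≤u n))) (≰⇒> (λ ε≤u → <⇒≱′ (≤-<-trans (p≤∣p∣ (u n * u n)) (hN n N≤n))
    (*-mono-≤ (<⇒≤ 0<ε) (<⇒≤ 0<ε) ε≤u ε≤u)))
  where
  <⇒≱′ : ∀ {p q} → p < q → q ≤ p → _
  <⇒≱′ p<q q≤p = <-irrefl refl (<-≤-trans p<q q≤p)

inv≤2rising : ∀ {n k} → k ℕ.< n → inv n ≤ rising n k + rising n k
inv≤2rising {suc n} {k} k<n = inv≤2inv n (suc n ℕ.+ k) (subst (ℕ._≤ suc n ℕ.+ suc n) (ℕ.+-suc (suc n) k) (ℕ.+-monoʳ-≤ (suc n) k<n))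

module _ (n : ℕ) where
  private
    w : ℕ → ℕ → ℚ
    w = fall (rising n)

    z : ℕ → ℕ → ℚ
    z i k = w i k * rising n k

    w-difference : ∀ i k → w (suc i) (suc k) - w i (suc k) ≡ ι (suc k) * z i k
    w-difference i k = trans (cong (_- w i (suc k)) (fall-suc-suc (rising n) i k))
      (solve 4 (λ f i k r → f :* ((con 1ℚ :+ i) :* r) :- f :* ((i :- k) :* r) := (con 1ℚ :+ k) :* (f :* r)) refl (w i k) (ι i) (ι k) (rising n k))

    τ : ℕ → ℚ
    τ i = inv (suc (n ℕ.+ i))

    w-suc : ∀ i k → w (suc i) (suc k) - w i (suc k) ≡ ι (suc k) * (τ i * (w i k + w i (suc k)))
    w-suc i k = trans (w-difference i k) (cong (ι (suc k) *_) (modulo (- (f * r)) ri≡1 (modulo (f * t) rk≡1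
      (solve 6 (λ f r t n i k → f :* r := t :* (f :+ f :* ((i :- k) :* r)) :+ (:- (f :* r)) :* ((con 1ℚ :+ (n :+ i)) :* t :- con 1ℚ)
         :+ f :* t :* ((con 1ℚ :+ (n :+ k)) :* r :- con 1ℚ)) refl f r t (ι n) (ι i) (ι k)))))
      where
      f = w i k
      r = rising n k
      t = τ i
      ri≡1 : (1ℚ + (ι n + ι i)) * t ≡ 1ℚ
      ri≡1 = trans (cong (λ x → (1ℚ + x) * t) (sym (ι-+ n i))) (ι*inv≡1 (n ℕ.+ i))
      rk≡1 : (1ℚ + (ι n + ι k)) * r ≡ 1ℚ
      rk≡1 = trans (cong (λ x → (1ℚ + x) * r) (sym (ι-+ n k))) (ι*inv≡1 (n ℕ.+ k))

    open Grid w τ n (λ _ → refl) (fall-vanishes (rising n)) (λ i k _ → w-suc i k)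

    -- `Q` discretises - ln (1 - t), and `S` discretises t / (1 - t).
    Q S : ℕ → ℚ
    Q a = sum< n (λ k → w a (suc k) * inv (suc k))
    S a = sum< n (λ k → w a (suc k))

    polylog-bar1 : ∀ a → polylog (bar 1 ∷ []) a ≡ Q a
    polylog-bar1 a = sum<-cong n (λ k _ → trans (cong (λ x → sgn (suc k) * w a (suc k) * (sgn (suc k) * x * 1ℚ)) (factor1≡inv k))
      (modulo (w a (suc k) * inv (suc k)) (sgn*sgn≡1 (suc k)) (solve 3 (λ σ w r → σ :* w :* (σ :* r :* con 1ℚ) := w :* r :+ w :* r :* (σ :* σ :- con 1ℚ)) refl
        (sgn (suc k)) (w a (suc k)) (inv (suc k)))))

    sum-at-0 : ∀ (g : ℕ → ℚ) → sum< n (λ k → w 0 (suc k) * g k) ≡ 0ℚ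
    sum-at-0 g = sum<-0 n (λ k _ → trans (cong (_* g k) (fall-vanishes (rising n) {0} {suc k} (s≤s z≤n))) (*-zeroˡ (g k)))

    Q-suc : ∀ j → Q (suc j) - Q j ≡ sum< n (z j)
    Q-suc j = trans (sym (sum<-- n (λ k → w (suc j) (suc k) * inv (suc k)) (λ k → w j (suc k) * inv (suc k)))) (sum<-cong n (λ k _ →
      trans (solve 3 (λ x y r → x :* r :- y :* r := (x :- y) :* r) refl (w (suc j) (suc k)) (w j (suc k)) (inv (suc k)))
      (trans (cong (_* inv (suc k)) (w-difference j k))
      (modulo (z j k) (ι*inv≡1 k) (solve 3 (λ k z r → k :* z :* r := z :+ z :* (k :* r :- con 1ℚ)) refl (ι (suc k)) (z j k) (inv (suc k)))))))

    S-suc : ∀ j → S (suc j) - S j ≡ sum< n (λ k → ι (suc k) * z j k)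
    S-suc j = trans (sym (sum<-- n (λ k → w (suc j) (suc k)) (λ k → w j (suc k)))) (sum<-cong n (λ k _ → w-difference j k))

    w-drop : ∀ j k → w j k - w j (suc k) ≡ (ι n - ι j - 1ℚ + (ι (suc k) + ι (suc k))) * z j k
    w-drop j k = modulo (- w j k) (trans (cong (λ x → (1ℚ + x) * rising n k) (sym (ι-+ n k))) (ι*inv≡1 (n ℕ.+ k)))
      (solve 5 (λ f r n j k → f :- f :* ((j :- k) :* r) := (n :- j :- con 1ℚ :+ ((con 1ℚ :+ k) :+ (con 1ℚ :+ k))) :* (f :* r)
        :+ (:- f) :* ((con 1ℚ :+ (n :+ k)) :* r :- con 1ℚ)) refl (w j k) (rising n k) (ι n) (ι j) (ι k))

    -- The discretisation of (1 - t) d(- ln (1 - t)) = dt, in which S stands for the negligible correction.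
    Q-S : ∀ j → j ℕ.< n → (ι n - ι j - 1ℚ) * (Q (suc j) - Q j) ≡ 1ℚ - ((S (suc j) - S j) + (S (suc j) - S j))
    Q-S j j<n = begin
      c * (Q (suc j) - Q j)     ≡⟨ cong (c *_) (Q-suc j) ⟩
      c * sum< n (z j)          ≡⟨ solve 3 (λ c x y → c :* x := (c :* x :+ (y :+ y)) :- (y :+ y)) refl c (sum< n (z j)) Y ⟩
      (c * sum< n (z j) + (Y + Y)) - (Y + Y)  ≡⟨ cong (_- (Y + Y)) total ⟩
      1ℚ - (Y + Y)              ≡⟨ cong (λ y → 1ℚ - (y + y)) (sym (S-suc j)) ⟩
      1ℚ - ((S (suc j) - S j) + (S (suc j) - S j)) ∎
      where
      open ≡-Reasoning
      c = ι n - ι j - 1ℚ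
      Y = sum< n (λ k → ι (suc k) * z j k)
      total : c * sum< n (z j) + (Y + Y) ≡ 1ℚ
      -- By `w-drop` the summands are the differences w j k - w j (suc k). The sum telescopes to w j
      -- 0 - w j n, and the last term is 0 because j < n.
      total = begin
        c * sum< n (z j) + (Y + Y)
          ≡⟨ cong₂ _+_ (sym (sum<-*ˡ n c (z j))) (sym (sum<-+ n (λ k → ι (suc k) * z j k) (λ k → ι (suc k) * z j k))) ⟩
        sum< n (λ k → c * z j k) + sum< n (λ k → ι (suc k) * z j k + ι (suc k) * z j k)
          ≡⟨ sym (sum<-+ n (λ k → c * z j k) (λ k → ι (suc k) * z j k + ι (suc k) * z j k)) ⟩
        sum< n (λ k → c * z j k + (ι (suc k) * z j k + ι (suc k) * z j k))
          ≡⟨ sum<-cong n (λ k _ → trans (solve 3 (λ c k z → c :* z :+ (k :* z :+ k :* z) := (c :+ (k :+ k)) :* z) refl c (ι (suc k)) (z j k)) (trans (sym (w-drop j k))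
               (solve 2 (λ x y → x :- y := con (- 1ℚ) :* (y :- x)) refl (w j k) (w j (suc k))))) ⟩
        sum< n (λ k → - 1ℚ * (w j (suc k) - w j k))  ≡⟨ trans (sum<-*ˡ n (- 1ℚ) (λ k → w j (suc k) - w j k)) (cong (- 1ℚ *_) (sum<-telescope n (w j))) ⟩
        - 1ℚ * (w j n - 1ℚ)                          ≡⟨ cong (λ x → - 1ℚ * (x - 1ℚ)) (fall-vanishes (rising n) j<n) ⟩
        1ℚ                                           ∎

    -- The substitution s = (1 - t) / 2: cell j in t is cell n - 1 - j in s, and dt / (1 + t)
    -- becomes ds / (1 - s) up to orientation.
    ρ-reflect : ∀ {j} → j ℕ.< n → ρ n (n ℕ.∸ suc j) ≡ τ j
    ρ-reflect {j} j<n = cong inv (trans (ℕ.+-∸-assoc n (ℕ.m∸n≤m n (suc j))) (trans (cong (n ℕ.+_) (ℕ.m∸[m∸n]≡n j<n)) (ℕ.+-suc n j)))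

    paired : ℕ → (ℕ → ℚ) → ℚ
    paired m g = sum< n (λ j → g j * E n m (n ℕ.∸ suc j))

    differences : (ℕ → ℚ) → ℕ → ℚ
    differences g j = g (suc j) - g j

    -- Summation by parts. Both boundary terms vanish: one by g 0 = 0, the other since `E` of
    -- positive order is 0 at index 0.
    paired-suc : ∀ m (g : ℕ → ℚ) → g 0 ≡ 0ℚ → paired m (λ j → τ j * g j) ≡ paired (suc m) (differences g)
    paired-suc m g g0≡0 = sym (trans
      (solve 2 (λ x y → x := y :+ (x :- y)) refl (paired (suc m) (differences g)) (paired m (λ j → τ j * g j)))
      (trans (cong (paired m (λ j → τ j * g j) +_) (trans
        (sym (sum<-- n (λ j → differences g j * E n (suc m) (n ℕ.∸ suc j)) (λ j → τ j * g j * E n m (n ℕ.∸ suc j))))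
        (trans (sum<-cong n term) (trans (sum<-telescope n F) ends))))
      (+-identityʳ (paired m (λ j → τ j * g j)))))
      where
      F : ℕ → ℚ
      F j = g j * E n (suc m) (n ℕ.∸ j)
      ends : F n - F 0 ≡ 0ℚ
      ends = trans (cong₂ (λ x y → g n * E n (suc m) x - y * E n (suc m) n) (ℕ.n∸n≡0 n) g0≡0)
        (solve 2 (λ g e → g :* con 0ℚ :- con 0ℚ :* e := con 0ℚ) refl (g n) (E n (suc m) n))
      term : ∀ j → j ℕ.< n → differences g j * E n (suc m) (n ℕ.∸ suc j) - τ j * g j * E n m (n ℕ.∸ suc j) ≡ F (suc j) - F j
      term j j<n rewrite suc-∸-suc j<n | ρ-reflect j<n = solve 5 (λ x y e t e′ → (x :- y) :* e :- t :* y :* e′ := x :* e :- y :* (e :+ t :* e′)) refl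
        (g (suc j)) (g j) (E n (suc m) (n ℕ.∸ suc j)) (τ j) (E n m (n ℕ.∸ suc j))

    -- Reversing the order of integration
    iterate-paired : ∀ m (g : ℕ → ℚ) → g 0 ≡ 0ℚ → iterate τ m g n ≡ paired m (differences g)
    iterate-paired zero    g g0≡0 = sym (trans (sum<-cong n (λ j _ → *-identityʳ (differences g j)))
      (trans (sum<-telescope n g) (trans (cong (λ x → g n - x) g0≡0) (+-identityʳ (g n)))))
    iterate-paired (suc m) g g0≡0 = trans (cong (λ f → f n) (sym (iterate-integrate τ g m)))
      (trans (iterate-paired m (integrate τ g) refl)
      (trans (sum<-cong n (λ j _ → cong (_* E n m (n ℕ.∸ suc j)) (solve 2 (λ x y → (x :+ y) :- x := y) refl (integrate τ g j) (τ j * g j))))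
      (paired-suc m g g0≡0)))

    -- The singularity of dt / (1 - t) at t = 1 sits at s = 0, where `E` of positive order vanishes
    -- linearly; so this quotient stays below 1 / n.
    ε : ℕ → ℕ → ℚ
    ε m b = E n (suc m) b * inv b

    ε-E : ∀ m b → E n (suc m) b ≡ ι b * ε m b
    ε-E m zero    = sym (*-zeroˡ (0ℚ * inv 0))
    ε-E m (suc b) = sym (modulo (E n (suc m) (suc b)) (ι*inv≡1 b)
      (solve 3 (λ i e r → i :* (e :* r) := e :+ e :* (i :* r :- con 1ℚ)) refl (ι (suc b)) (E n (suc m) (suc b)) (inv (suc b))))

    ∣ε∣≤ : ∀ m b → b ℕ.≤ n → ∣ ε m b ∣ ≤ inv n
    ∣ε∣≤ m zero    _   = subst (_≤ inv n) (cong ∣_∣ (sym (*-zeroˡ (inv 0)))) (0≤inv n)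
    ∣ε∣≤ m (suc b) b≤n = 0≤p≤q⇒∣p∣≤q (0≤-* (0≤E n (suc m) (suc b)) (0≤inv (suc b)))
      (≤-trans (*-monoˡ-≤ (0≤inv (suc b)) (E-suc≤ n m (suc b) b≤n)) (ι*p*inv≤p b (inv n) (0≤inv n)))

    -- Reversal produces the indices 0, ..., n - 1, whereas `E/` runs over 1, ..., n. The term at 0
    -- is zero and the one at n is left over.
    E/≡ : ∀ m → E/ n (suc m) n ≡ sum< n (λ j → ε m (n ℕ.∸ suc j)) + ε m n
    E/≡ m = trans (sym (+-identityˡ (E/ n (suc m) n))) (trans (cong (_+ E/ n (suc m) n) (sym (*-zeroˡ (inv 0))))
      (trans (sym (sum<-front n (ε m))) (cong (_+ ε m n) (sym (sum<-reverse n (ε m))))))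

    0≤z : ∀ i k → 0ℚ ≤ z i k
    0≤z i k = 0≤-* (0≤fall (rising n) (0≤rising n) i k) (0≤rising n k)

    S-mono : ∀ j → 0ℚ ≤ S (suc j) - S j
    S-mono j = subst (0ℚ ≤_) (sym (S-suc j)) (0≤sum< n (λ k _ → 0≤-* (0≤ι (suc k)) (0≤z j k)))

  -- The value of `S` at t = 1, hence the sum of all its increments. It enters the error only after
  -- division by n.
  smoothing-sum : ℚ
  smoothing-sum = sum< n (λ k → smoothing n (suc k))

  private
    iterate-Q-error : ∀ m → ∣ iterate τ (suc m) Q n - E/ n (suc m) n ∣ ≤ inv n * (1ℚ + (smoothing-sum + smoothing-sum))
    iterate-Q-error m = begin
      ∣ iterate τ (suc m) Q n - E/ n (suc m) n ∣            ≡⟨ cong ∣_∣ difference ⟩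
      ∣ - (sum< n (λ j → ε m (n ℕ.∸ suc j) * (D j + D j)) + ε m n) ∣  ≡⟨ ∣-p∣≡∣p∣ (sum< n (λ j → ε m (n ℕ.∸ suc j) * (D j + D j)) + ε m n) ⟩
      ∣ sum< n (λ j → ε m (n ℕ.∸ suc j) * (D j + D j)) + ε m n ∣
        ≤⟨ ∣p+q∣≤ (∣sum<∣≤ n (λ j _ → ∣p*q∣≤ (∣ε∣≤ m (n ℕ.∸ suc j) (ℕ.m∸n≤m n (suc j))) (0≤p≤q⇒∣p∣≤q (0≤-+ (S-mono j) (S-mono j)) ≤-refl)))
                  (∣ε∣≤ m n ℕ.≤-refl) ⟩
      sum< n (λ j → inv n * (D j + D j)) + inv n            ≡⟨ cong (_+ inv n) (sum<-*ˡ n (inv n) (λ j → D j + D j)) ⟩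
      inv n * sum< n (λ j → D j + D j) + inv n              ≡⟨ cong (λ x → inv n * x + inv n) (trans (sum<-+ n D D) (cong (λ x → x + x) sum-D)) ⟩
      inv n * (smoothing-sum + smoothing-sum) + inv n       ≡⟨ solve 2 (λ r s → r :* (s :+ s) :+ r := r :* (con 1ℚ :+ (s :+ s))) refl (inv n) smoothing-sum ⟩
      inv n * (1ℚ + (smoothing-sum + smoothing-sum))        ∎
      where
      open ≤-Reasoning
      D : ℕ → ℚ
      D = differences S
      sum-D : sum< n D ≡ smoothing-sum
      sum-D = trans (sum<-telescope n S) (trans (cong (λ x → S n - x) (trans (sum<-cong n (λ k _ → sym (*-identityʳ (w 0 (suc k))))) (sum-at-0 (λ _ → 1ℚ)))) (+-identityʳ (S n)))
      term : ∀ j → j ℕ.< n → differences Q j * E n (suc m) (n ℕ.∸ suc j) ≡ ε m (n ℕ.∸ suc j) - ε m (n ℕ.∸ suc j) * (D j + D j)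
      term j j<n = trans (cong (differences Q j *_) (trans (ε-E m (n ℕ.∸ suc j)) (cong (_* e) (ι-∸-suc j<n))))
        (trans (solve 3 (λ q c e → q :* (c :* e) := e :* (c :* q)) refl (differences Q j) (ι n - ι j - 1ℚ) e)
        (trans (cong (e *_) (Q-S j j<n)) (solve 2 (λ e d → e :* (con 1ℚ :- d) := e :- e :* d) refl e (D j + D j))))
        where e = ε m (n ℕ.∸ suc j)
      difference : iterate τ (suc m) Q n - E/ n (suc m) n ≡ - (sum< n (λ j → ε m (n ℕ.∸ suc j) * (D j + D j)) + ε m n)
      difference = trans
        (cong₂ _-_ (trans (iterate-paired (suc m) Q (sum-at-0 (λ k → inv (suc k))))
          (trans (sum<-cong n term) (sum<-- n (λ j → ε m (n ℕ.∸ suc j)) (λ j → ε m (n ℕ.∸ suc j) * (D j + D j))))) (E/≡ m))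
        (solve 3 (λ x y e → (x :- y) :- (x :+ e) := :- (y :+ e)) refl (sum< n (λ j → ε m (n ℕ.∸ suc j))) (sum< n (λ j → ε m (n ℕ.∸ suc j) * (D j + D j))) (ε m n))

  smoothed-1s-bar1 : ∀ m → mzv-smoothed (replicate m (plain 1) ++ bar 1 ∷ []) n ≡ sgn (suc m) * iterate τ (suc m) Q n
  smoothed-1s-bar1 m = trans (sum<-cong n (λ j _ → solve 4 (λ c σ f h → c :* ((σ :* f) :* h) := σ :* c :* (f :* h)) refl
      (smoothing n (suc j)) (sgn (suc j)) (factor (plain 1) (suc j)) (mzvPartial (replicate m (plain 1) ++ bar 1 ∷ []) j)))
    (trans (polylog-plain1s (suc m) (bar 1 ∷ []) n ℕ.≤-refl)
      (cong (sgn (suc m) *_) (iterate-cong τ (polylog (bar 1 ∷ [])) Q (suc m) n (λ i _ → polylog-bar1 i))))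

  smoothed-1s-bar1-error : ∀ m → ∣ mzv-smoothed (replicate m (plain 1) ++ bar 1 ∷ []) n - sgn (suc m) * E/ n (suc m) n ∣
    ≤ inv n * (1ℚ + (smoothing-sum + smoothing-sum))
  smoothed-1s-bar1-error m = subst₂ (λ x y → ∣ x ∣ ≤ y)
    (trans (solve 3 (λ σ a b → σ :* (a :- b) := σ :* a :- σ :* b) refl (sgn (suc m)) (iterate τ (suc m) Q n) (E/ n (suc m) n))
      (cong (_- sgn (suc m) * E/ n (suc m) n) (sym (smoothed-1s-bar1 m))))
    (*-identityˡ (inv n * (1ℚ + (smoothing-sum + smoothing-sum))))
    (∣p*q∣≤ (∣sgn∣≤1 (suc m)) (iterate-Q-error m))

  0≤smoothing-sum : 0ℚ ≤ smoothing-sum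
  0≤smoothing-sum = 0≤sum< n (λ k _ → 0≤smoothing n (suc k))

  private
    -- A new weight c increases the square of the partial sum s by (2s + c) c, where s ≤ K, c ≤ 1
    -- and c is at most the preceding weight.
    square≤ : ∀ K → sum< K (λ k → smoothing n (suc k)) * sum< K (λ k → smoothing n (suc k)) ≤ sum< K (λ k → (ι k + ι (suc k)) * smoothing n k)
    square≤ zero    = ≤-refl
    square≤ (suc K) = begin
      (s + c) * (s + c)                     ≡⟨ solve 2 (λ s c → (s :+ c) :* (s :+ c) := s :* s :+ (s :+ s :+ c) :* c) refl s c ⟩
      s * s + (s + s + c) * c               ≤⟨ +-mono-≤ (square≤ K) (*-mono-≤ (0≤-+ (0≤-+ 0≤s 0≤s) (0≤smoothing n (suc K))) (0≤smoothing n (suc K))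
                                                 (+-mono-≤ (+-mono-≤ s≤K s≤K) (smoothing≤1 n (suc K))) (smoothing-antitone n K)) ⟩
      sum< K (λ k → (ι k + ι (suc k)) * smoothing n k) + (ι K + ι K + 1ℚ) * smoothing n K
        ≡⟨ cong (λ x → sum< K (λ k → (ι k + ι (suc k)) * smoothing n k) + x * smoothing n K) (solve 1 (λ k → k :+ k :+ con 1ℚ := k :+ (con 1ℚ :+ k)) refl (ι K)) ⟩
      sum< (suc K) (λ k → (ι k + ι (suc k)) * smoothing n k) ∎
      where
      open ≤-Reasoning
      s = sum< K (λ k → smoothing n (suc k))
      c = smoothing n (suc K)
      0≤s : 0ℚ ≤ s
      0≤s = 0≤sum< K (λ k _ → 0≤smoothing n (suc k))
      s≤K : s ≤ ι K
      s≤K = ≤-trans (sum<-mono K (λ k _ → smoothing≤1 n (suc k))) (≤-reflexive (trans (sum<-const K 1ℚ) (*-identityʳ (ι K))))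

    -- By `w-drop` at j = n, the weight times (2k + 1) / (n + k + 1) is its drop to the next weight.
    -- As n + k + 1 ≤ 2n, the sum is at most twice a telescoping one.
    weighted≤ : inv n * sum< n (λ k → (ι k + ι (suc k)) * smoothing n k) ≤ 1ℚ + 1ℚ
    weighted≤ = begin
      inv n * sum< n (λ k → (ι k + ι (suc k)) * smoothing n k)     ≡⟨ sym (sum<-*ˡ n (inv n) (λ k → (ι k + ι (suc k)) * smoothing n k)) ⟩
      sum< n (λ k → inv n * ((ι k + ι (suc k)) * smoothing n k))   ≤⟨ sum<-mono n term ⟩
      sum< n (λ k → (- 1ℚ - 1ℚ) * (w n (suc k) - w n k))           ≡⟨ trans (sum<-*ˡ n (- 1ℚ - 1ℚ) (λ k → w n (suc k) - w n k)) (cong ((- 1ℚ - 1ℚ) *_) (sum<-telescope n (w n))) ⟩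
      (- 1ℚ - 1ℚ) * (w n n - 1ℚ)                                   ≤⟨ ≤-from-difference (w n n + w n n) (0≤-+ (0≤smoothing n n) (0≤smoothing n n))
           (solve 1 (λ x → con 1ℚ :+ con 1ℚ := (con (- 1ℚ) :- con 1ℚ) :* (x :- con 1ℚ) :+ (x :+ x)) refl (w n n)) ⟩
      1ℚ + 1ℚ                                                      ∎
      where
      open ≤-Reasoning
      term : ∀ k → k ℕ.< n → inv n * ((ι k + ι (suc k)) * smoothing n k) ≤ (- 1ℚ - 1ℚ) * (w n (suc k) - w n k)
      term k k<n = ≤-trans
        (*-monoˡ-≤ (0≤-* (0≤-+ (0≤ι k) (0≤ι (suc k))) (0≤smoothing n k)) (inv≤2rising k<n))
        (≤-reflexive (trans
          (solve 4 (λ r k n c → (r :+ r) :* ((k :+ (con 1ℚ :+ k)) :* c) := (con 1ℚ :+ con 1ℚ) :* ((n :- n :- con 1ℚ :+ ((con 1ℚ :+ k) :+ (con 1ℚ :+ k))) :* (c :* r))) refl (rising n k) (ι k) (ι n) (smoothing n k))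
          (trans (cong ((1ℚ + 1ℚ) *_) (sym (w-drop n k)))
            (solve 2 (λ x y → (con 1ℚ :+ con 1ℚ) :* (x :- y) := (con (- 1ℚ) :- con 1ℚ) :* (y :- x)) refl (w n k) (w n (suc k))))))

  smoothing-sum²≤ : (inv n * smoothing-sum) * (inv n * smoothing-sum) ≤ inv n * (1ℚ + 1ℚ)
  smoothing-sum²≤ = ≤-trans (≤-reflexive (solve 2 (λ r s → (r :* s) :* (r :* s) := r :* (r :* (s :* s))) refl (inv n) smoothing-sum))
    (*-monoʳ-≤ (0≤inv n) (≤-trans (*-monoʳ-≤ (0≤inv n) (square≤ n)) weighted≤))

smoothing-sum-sublinear : Null (λ n → inv n * smoothing-sum n)
smoothing-sum-sublinear = null-square (λ n → inv n * smoothing-sum n) 0≤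
  (null-dominated (λ n → 0≤p≤q⇒∣p∣≤q (0≤-* (0≤ n) (0≤ n)) (smoothing-sum²≤ n)) (null-cong (λ n → *-comm (1ℚ + 1ℚ) (inv n)) (null-scale (1ℚ + 1ℚ) null-inv)))
  where
  0≤ : ∀ n → 0ℚ ≤ inv n * smoothing-sum n
  0≤ n = 0≤-* (0≤inv n) (0≤smoothing-sum n)

smoothed-1s-bar1~ : ∀ m → Asymptotic (mzv-smoothed (replicate m (plain 1) ++ bar 1 ∷ [])) (λ n → sgn (suc m) * E/ n (suc m) n)
smoothed-1s-bar1~ m = null-dominated (λ n → smoothed-1s-bar1-error n m)
  (null-cong (λ n → solve 2 (λ r s → r :+ (r :* s :+ r :* s) := r :* (con 1ℚ :+ (s :+ s))) refl (inv n) (smoothing-sum n))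
    (null-+ null-inv (null-+ smoothing-sum-sublinear smoothing-sum-sublinear)))

-- Discretised polylogarithms

null-bounded-by-inv : ∀ {u : ℕ → ℚ} c → (∀ n → ∣ u n ∣ ≤ c * inv n) → Null u
null-bounded-by-inv c h = null-dominated h (null-scale c null-inv)

sum-k½^k : ∀ K → sum< K (λ k → ½ ^ suc k * ι (suc k)) ≡ (1ℚ + 1ℚ) - (1ℚ + 1ℚ + ι K) * ½ ^ K
sum-k½^k zero    = refl
sum-k½^k (suc K) = trans (cong (_+ ½ ^ suc K * ι (suc K)) (sum-k½^k K))
  (solve 2 (λ k h → ((con 1ℚ :+ con 1ℚ) :- (con 1ℚ :+ con 1ℚ :+ k) :* h) :+ con ½ :* h :* (con 1ℚ :+ k)
     := (con 1ℚ :+ con 1ℚ) :- (con 1ℚ :+ con 1ℚ :+ (con 1ℚ :+ k)) :* (con ½ :* h)) refl (ι K) (½ ^ K))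

module _ (n : ℕ) where
  private
    N = n ℕ.+ n

    δ : ℕ → ℚ
    δ = ρ n

    d : ℕ → ℕ → ℚ
    d = fall δ

    δ-inverse : ∀ {k} → k ℕ.< N → (ι N - ι k) * δ k ≡ 1ℚ
    δ-inverse {k} k<N = trans (cong (_* δ k) (sym (ι-∸ (ℕ.<⇒≤ k<N))))
      (subst (λ m → ι m * inv m ≡ 1ℚ) (sym (suc-∸-suc k<N)) (ι*inv≡1 (N ℕ.∸ suc k)))

  -- The binomial quotient d u k = u (u - 1) ⋯ / 2n (2n - 1) ⋯ replaces (u / 2n)ᵏ.
  V : ℕ → ℕ → ℚ
  V s u = sum< N (λ k → d u (suc k) * inv (suc k) ^ s)

  -- Discretises d Liₛ₊₁(x) = Liₛ(x) dx / x at x = u / 2n.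
  V-suc : ∀ s u → V (suc s) (suc u) ≡ V (suc s) u + inv (suc u) * V s (suc u)
  V-suc s u = trans (solve 2 (λ x y → y := x :+ (y :- x)) refl (V (suc s) u) (V (suc s) (suc u)))
    (cong (V (suc s) u +_) (begin
      V (suc s) (suc u) - V (suc s) u
        ≡⟨ sym (sum<-- N (λ k → d (suc u) (suc k) * inv (suc k) ^ suc s) (λ k → d u (suc k) * inv (suc k) ^ suc s)) ⟩
      sum< N (λ k → d (suc u) (suc k) * inv (suc k) ^ suc s - d u (suc k) * inv (suc k) ^ suc s)  ≡⟨ sum<-cong N (λ k _ → term k) ⟩
      sum< N (λ k → inv (suc u) * (d (suc u) (suc k) * inv (suc k) ^ s))  ≡⟨ sum<-*ˡ N (inv (suc u)) (λ k → d (suc u) (suc k) * inv (suc k) ^ s) ⟩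
      inv (suc u) * V s (suc u) ∎))
    where
    open ≡-Reasoning
    term : ∀ k → d (suc u) (suc k) * inv (suc k) ^ suc s - d u (suc k) * inv (suc k) ^ suc s ≡ inv (suc u) * (d (suc u) (suc k) * inv (suc k) ^ s)
    term k = trans (cong (λ x → x * (r * p) - f * ((ι u - ι k) * δ k) * (r * p)) (fall-suc-suc δ u k))
      (trans (modulo (f * δ k * p) (ι*inv≡1 k) (modulo (- (f * δ k * p)) (ι*inv≡1 u)
        (solve 7 (λ f u k e r p q → f :* ((con 1ℚ :+ u) :* e) :* (r :* p) :- f :* ((u :- k) :* e) :* (r :* p)
          := q :* (f :* ((con 1ℚ :+ u) :* e) :* p) :+ f :* e :* p :* ((con 1ℚ :+ k) :* r :- con 1ℚ) :+ (:- (f :* e :* p)) :* ((con 1ℚ :+ u) :* q :- con 1ℚ)) refl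
          f (ι u) (ι k) (δ k) r p (inv (suc u)))))
        (cong (λ x → inv (suc u) * (x * p)) (sym (fall-suc-suc δ u k))))
      where
      f = d u k
      r = inv (suc k)
      p = inv (suc k) ^ s

  V-zero : ∀ s → V s 0 ≡ 0ℚ
  V-zero s = sum<-0 N (λ k _ → trans (cong (_* inv (suc k) ^ s) (fall-vanishes δ {0} {suc k} (s≤s z≤n))) (*-zeroˡ (inv (suc k) ^ s)))

  -- The counterpart of Li₀(x) = x / (1 - x), with 2n - u + 1 in the denominator. The sum is
  -- telescoping, and its boundary term vanishes both for u < 2n and for u = 2n.
  V₀ : ∀ u → u ℕ.≤ N → V 0 u ≡ ι u * inv (suc (N ℕ.∸ u))
  V₀ u u≤N = begin
    V 0 u                           ≡⟨ sum<-cong N (λ k _ → *-identityʳ (d u (suc k))) ⟩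
    D N                             ≡⟨ sym (*-identityˡ (D N)) ⟩
    1ℚ * D N                        ≡⟨ cong (_* D N) (sym inverse) ⟩
    ((1ℚ + (ι N - ι u)) * r) * D N  ≡⟨ solve 3 (λ c r x → c :* r :* x := (c :* x) :* r) refl (1ℚ + (ι N - ι u)) r (D N) ⟩
    ((1ℚ + (ι N - ι u)) * D N) * r  ≡⟨ cong (_* r) (partial N ℕ.≤-refl) ⟩
    (ι u - (ι u - ι N) * d u N) * r ≡⟨ cong (λ x → (ι u - x) * r) (boundary u≤N) ⟩
    (ι u - 0ℚ) * r                  ≡⟨ cong (_* r) (+-identityʳ (ι u)) ⟩
    ι u * r                         ∎
    where
    open ≡-Reasoning
    r = inv (suc (N ℕ.∸ u))
    D : ℕ → ℚ
    D K = sum< K (λ k → d u (suc k))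
    inverse : (1ℚ + (ι N - ι u)) * r ≡ 1ℚ
    inverse = trans (cong (λ x → (1ℚ + x) * r) (sym (ι-∸ u≤N))) (ι*inv≡1 (N ℕ.∸ u))
    partial : ∀ K → K ℕ.≤ N → (1ℚ + (ι N - ι u)) * D K ≡ ι u - (ι u - ι K) * d u K
    partial zero    _   = solve 2 (λ n u → (con 1ℚ :+ (n :- u)) :* con 0ℚ := u :- (u :- con 0ℚ) :* con 1ℚ) refl (ι N) (ι u)
    partial (suc K) K<N = trans (*-distribˡ-+ (1ℚ + (ι N - ι u)) (D K) (d u (suc K)))
      (trans (cong (_+ (1ℚ + (ι N - ι u)) * d u (suc K)) (partial K (ℕ.<⇒≤ K<N)))
      (modulo ((ι u - ι K) * d u K) (δ-inverse K<N)
        (solve 5 (λ n u k f e → u :- (u :- k) :* f :+ (con 1ℚ :+ (n :- u)) :* (f :* ((u :- k) :* e))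
          := u :- (u :- (con 1ℚ :+ k)) :* (f :* ((u :- k) :* e)) :+ (u :- k) :* f :* ((n :- k) :* e :- con 1ℚ)) refl (ι N) (ι u) (ι K) (d u K) (δ K))))
    boundary : ∀ {u} → u ℕ.≤ N → (ι u - ι N) * d u N ≡ 0ℚ
    boundary {u} u≤N with ℕ.m≤n⇒m<n∨m≡n u≤N
    ... | inj₁ u<N  = trans (cong ((ι u - ι N) *_) (fall-vanishes δ u<N)) (*-zeroʳ (ι u - ι N))
    ... | inj₂ refl = trans (cong (_* d N N) (+-inverseʳ (ι N))) (*-zeroˡ (d N N))

  V₁≡E₁ : ∀ a → a ℕ.≤ N → V 1 a ≡ E n 1 a
  V₁≡E₁ zero    _   = V-zero 1
  V₁≡E₁ (suc a) a<N = trans (V-suc 0 a) (cong₂ _+_ (V₁≡E₁ a (ℕ.<⇒≤ a<N)) (begin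
    inv (suc a) * V 0 (suc a)                        ≡⟨ cong (inv (suc a) *_) (V₀ (suc a) a<N) ⟩
    inv (suc a) * (ι (suc a) * inv (suc (N ℕ.∸ suc a)))  ≡⟨ cong (λ m → inv (suc a) * (ι (suc a) * inv m)) (sym (suc-∸-suc a<N)) ⟩
    inv (suc a) * (ι (suc a) * δ a)                  ≡⟨ modulo (δ a) (ι*inv≡1 a) (solve 3 (λ p i e → p :* (i :* e) := e :* con 1ℚ :+ e :* (i :* p :- con 1ℚ)) refl (inv (suc a)) (ι (suc a)) (δ a)) ⟩
    δ a * 1ℚ                                         ∎))
    where open ≡-Reasoning

  V-at-N : ∀ s → V s N ≡ zetaPartial s N
  V-at-N s = trans (sum<-cong N (λ k k<N → trans (cong (_* inv (suc k) ^ s) (one (suc k) k<N)) (*-identityˡ (inv (suc k) ^ s)))) (sym (zetaPartial≡ s N))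
    where
    one : ∀ k → k ℕ.≤ N → d N k ≡ 1ℚ
    one zero    _   = refl
    one (suc k) k<N = cong₂ _*_ (one k (ℕ.<⇒≤ k<N)) (δ-inverse k<N)

  -- Discretises the integral of (- ln (1 - σ))ʲ / j! · Liₛ(1 - σ) · dσ / (1 - σ) from 0 to a / 2n.
  T : ℕ → ℕ → ℕ → ℚ
  T j s a = sum< a (λ i → ρ n i * H n j (suc i) * V s (N ℕ.∸ i))

  T-zero-suc : ∀ s a → a ℕ.≤ N → V (suc s) (N ℕ.∸ a) ≡ V (suc s) N - T 0 s a
  T-zero-suc s zero    _   = sym (+-identityʳ (V (suc s) N))
  T-zero-suc s (suc a) a<N = begin
    V (suc s) u                                     ≡⟨ solve 2 (λ x y → x := (x :+ y) :- y) refl (V (suc s) u) (ρ n a * V s (N ℕ.∸ a)) ⟩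
    (V (suc s) u + ρ n a * V s (N ℕ.∸ a)) - ρ n a * V s (N ℕ.∸ a)
      ≡⟨ cong (_- ρ n a * V s (N ℕ.∸ a)) (trans (sym step) (T-zero-suc s a (ℕ.<⇒≤ a<N))) ⟩
    (V (suc s) N - T 0 s a) - ρ n a * V s (N ℕ.∸ a)
      ≡⟨ solve 4 (λ x y r v → x :- y :- r :* v := x :- (y :+ r :* con 1ℚ :* v)) refl (V (suc s) N) (T 0 s a) (ρ n a) (V s (N ℕ.∸ a)) ⟩
    V (suc s) N - T 0 s (suc a)                     ∎
    where
    open ≡-Reasoning
    u = N ℕ.∸ suc a
    step : V (suc s) (N ℕ.∸ a) ≡ V (suc s) u + ρ n a * V s (N ℕ.∸ a)
    step rewrite suc-∸-suc a<N = V-suc s u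

  -- Integration by parts, which trades a logarithm for a higher order of the polylogarithm. It is
  -- exact because `H` steps with its lower order at the new index, so both sums sample `H` at
  -- `suc i`; with `E` they would sample at different indices.
  T-suc : ∀ j s a → a ℕ.≤ N → H n (suc j) a * V (suc s) (N ℕ.∸ a) ≡ T j (suc s) a - T (suc j) s a
  T-suc j s zero    _   = *-zeroˡ (V (suc s) N)
  T-suc j s (suc a) a<N = begin
    (h + r * h′) * V (suc s) u
      ≡⟨ solve 5 (λ h r h′ x v → (h :+ r :* h′) :* x := h :* (x :+ r :* v) :+ r :* h′ :* (x :+ r :* v) :- r :* (h :+ r :* h′) :* v) refl h r h′ (V (suc s) u) v ⟩
    h * (V (suc s) u + r * v) + r * h′ * (V (suc s) u + r * v) - r * (h + r * h′) * v
      ≡⟨ cong (λ x → h * x + r * h′ * x - r * (h + r * h′) * v) (sym step) ⟩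
    h * V (suc s) (N ℕ.∸ a) + r * h′ * V (suc s) (N ℕ.∸ a) - r * (h + r * h′) * v
      ≡⟨ cong (λ x → x + r * h′ * V (suc s) (N ℕ.∸ a) - r * (h + r * h′) * v) (T-suc j s a (ℕ.<⇒≤ a<N)) ⟩
    (T j (suc s) a - T (suc j) s a) + r * h′ * V (suc s) (N ℕ.∸ a) - r * (h + r * h′) * v
      ≡⟨ solve 4 (λ x y z w → (x :- y) :+ z :- w := (x :+ z) :- (y :+ w)) refl (T j (suc s) a) (T (suc j) s a) (r * h′ * V (suc s) (N ℕ.∸ a)) (r * (h + r * h′) * v) ⟩
    T j (suc s) (suc a) - T (suc j) s (suc a) ∎
    where
    open ≡-Reasoning
    u = N ℕ.∸ suc a
    h = H n (suc j) a
    h′ = H n j (suc a)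
    r = ρ n a
    v = V s (N ℕ.∸ a)
    step : V (suc s) (N ℕ.∸ a) ≡ V (suc s) u + r * v
    step rewrite suc-∸-suc a<N = V-suc s u

  -- Li₀(1 - σ) dσ / (1 - σ) = dσ / σ, and the shift in `V₀` turns σ into exactly the right end of
  -- the cell.
  T₀≡H/ : ∀ j → T j 0 n ≡ H/ n j n
  T₀≡H/ j = sum<-cong n (λ i i<n → term i (ℕ.≤-trans i<n (ℕ.m≤m+n n n)))
    where
    open ≡-Reasoning
    term : ∀ i → i ℕ.< N → ρ n i * H n j (suc i) * V 0 (N ℕ.∸ i) ≡ H n j (suc i) * inv (suc i)
    term i i<N = begin
      ρ n i * H n j (suc i) * V 0 (N ℕ.∸ i)   ≡⟨ cong (ρ n i * H n j (suc i) *_) (V₀ (N ℕ.∸ i) (ℕ.m∸n≤m N i)) ⟩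
      ρ n i * H n j (suc i) * (ι (N ℕ.∸ i) * inv (suc (N ℕ.∸ (N ℕ.∸ i))))
        ≡⟨ cong₂ (λ x m → ρ n i * H n j (suc i) * (x * inv (suc m))) (ι-∸ (ℕ.<⇒≤ i<N)) (ℕ.m∸[m∸n]≡n (ℕ.<⇒≤ i<N)) ⟩
      ρ n i * H n j (suc i) * ((ι N - ι i) * inv (suc i))
        ≡⟨ modulo (H n j (suc i) * inv (suc i)) (δ-inverse i<N) (solve 4 (λ r h c p → r :* h :* (c :* p) := h :* p :+ h :* p :* (c :* r :- con 1ℚ)) refl (ρ n i) (H n j (suc i)) (ι N - ι i) (inv (suc i))) ⟩
      H n j (suc i) * inv (suc i) ∎

  private
    0≤d : ∀ k → 0ℚ ≤ d n k
    0≤d = 0≤fall δ (0≤ρ n) n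

    deficit : ℕ → ℚ
    deficit k = ½ ^ k - d n k

    -- The next factor of `d n` is (n - k) / (2n - k) = ½ - ½ k / (2n - k).
    deficit-suc : ∀ {k} → k ℕ.< N → deficit (suc k) ≡ ½ * deficit k + ½ * ι k * (δ k * d n k)
    deficit-suc {k} k<N = modulo (- (½ * d n k)) (trans (cong (λ x → (x - ι k) * δ k) (sym (ι-+ n n))) (δ-inverse k<N))
      (solve 5 (λ h f n k e → con ½ :* h :- f :* ((n :- k) :* e) := con ½ :* (h :- f) :+ con ½ :* k :* (e :* f)
        :+ (:- (con ½ :* f)) :* (((n :+ n) :- k) :* e :- con 1ℚ)) refl (½ ^ k) (d n k) (ι n) (ι k) (δ k))

    0≤deficit : ∀ k → k ℕ.≤ N → 0ℚ ≤ deficit k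
    0≤deficit zero    _   = ≤-refl
    0≤deficit (suc k) k<N = subst (0ℚ ≤_) (sym (deficit-suc k<N))
      (0≤-+ (0≤-* 0≤½ (0≤deficit k (ℕ.<⇒≤ k<N))) (0≤-* (0≤-* 0≤½ (0≤ι k)) (0≤-* (0≤ρ n k) (0≤d k))))

    -- For k > n the weight `δ k` may exceed 1 / n, but there the falling product has vanished.
    δ*d≤ : ∀ k → k ℕ.≤ N → δ k * d n k ≤ inv n * ½ ^ k
    δ*d≤ k k≤N with ℕ.<-cmp k n
    ... | tri< k<n _ _  = *-mono-≤ (0≤ρ n k) (0≤d k) (ρ≤inv k<n) (0≤-⇒≤ (0≤deficit k k≤N))
    ... | tri≈ _ refl _ = *-mono-≤ (0≤ρ n k) (0≤d k) (≤-reflexive (cong inv (ℕ.m+n∸n≡m n n))) (0≤-⇒≤ (0≤deficit k k≤N))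
    ... | tri> _ _ n<k  = subst (_≤ inv n * ½ ^ k) (sym (trans (cong (δ k *_) (fall-vanishes δ n<k)) (*-zeroʳ (δ k)))) (0≤-* (0≤inv n) (0≤^ k 0≤½))

    -- After multiplication by 2ᵏ the recursion adds at most k / n in each step, and k² / n
    -- dominates these additions.
    deficit≤ : ∀ k → k ℕ.≤ N → deficit k ≤ ½ ^ k * (ι k * ι k) * inv n
    deficit≤ zero    _   = ≤-reflexive (solve 1 (λ r → con 1ℚ :- con 1ℚ := con 1ℚ :* (con 0ℚ :* con 0ℚ) :* r) refl (inv n))
    deficit≤ (suc k) k<N = subst (_≤ ½ ^ suc k * (ι (suc k) * ι (suc k)) * inv n) (sym (deficit-suc k<N)) (≤-trans
      (+-mono-≤ (*-monoʳ-≤ 0≤½ (deficit≤ k (ℕ.<⇒≤ k<N))) (*-monoʳ-≤ (0≤-* 0≤½ (0≤ι k)) (δ*d≤ k (ℕ.<⇒≤ k<N))))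
      (≤-from-difference (½ ^ suc k * ι (suc k) * inv n) (0≤-* (0≤-* (0≤^ (suc k) 0≤½) (0≤ι (suc k))) (0≤inv n))
        (solve 3 (λ h k r → con ½ :* h :* ((con 1ℚ :+ k) :* (con 1ℚ :+ k)) :* r
          := con ½ :* (h :* (k :* k) :* r) :+ con ½ :* k :* (r :* h) :+ con ½ :* h :* (con 1ℚ :+ k) :* r) refl (½ ^ k) (ι k) (inv n))))

  li-V-error : ∀ s → ∣ liPartial (suc s) ½ N - V (suc s) n ∣ ≤ (1ℚ + 1ℚ) * inv n
  li-V-error s = begin
    ∣ liPartial (suc s) ½ N - V (suc s) n ∣
      ≡⟨ cong ∣_∣ (trans (cong (_- V (suc s) n) (liPartial≡ (suc s) ½ N))
           (trans (sym (sum<-- N (λ k → ½ ^ suc k * inv (suc k) ^ suc s) (λ k → d n (suc k) * inv (suc k) ^ suc s)))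
             (sum<-cong N (λ k _ → solve 3 (λ x y r → x :* r :- y :* r := (x :- y) :* r) refl (½ ^ suc k) (d n (suc k)) (inv (suc k) ^ suc s))))) ⟩
    ∣ sum< N (λ k → deficit (suc k) * inv (suc k) ^ suc s) ∣   ≤⟨ ∣sum<∣≤ N term ⟩
    sum< N (λ k → inv n * (½ ^ suc k * ι (suc k)))             ≡⟨ trans (sum<-*ˡ N (inv n) (λ k → ½ ^ suc k * ι (suc k))) (cong (inv n *_) (sum-k½^k N)) ⟩
    inv n * ((1ℚ + 1ℚ) - (1ℚ + 1ℚ + ι N) * ½ ^ N)
      ≤⟨ ≤-from-difference (inv n * ((1ℚ + 1ℚ + ι N) * ½ ^ N)) (0≤-* (0≤inv n) (0≤-* (0≤-+ (0≤-+ 0≤1 0≤1) (0≤ι N)) (0≤^ N 0≤½)))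
           (solve 2 (λ r x → (con 1ℚ :+ con 1ℚ) :* r := r :* ((con 1ℚ :+ con 1ℚ) :- x) :+ r :* x) refl (inv n) ((1ℚ + 1ℚ + ι N) * ½ ^ N)) ⟩
    (1ℚ + 1ℚ) * inv n ∎
    where
    open ≤-Reasoning
    term : ∀ k → k ℕ.< N → ∣ deficit (suc k) * inv (suc k) ^ suc s ∣ ≤ inv n * (½ ^ suc k * ι (suc k))
    term k k<N = ≤-trans (∣p*q∣≤ (0≤p≤q⇒∣p∣≤q (0≤deficit (suc k) k<N) (deficit≤ (suc k) k<N))
        (0≤p≤q⇒∣p∣≤q (0≤^ (suc s) (0≤inv (suc k))) (inv^suc≤inv (suc k) s)))
      (≤-reflexive (modulo (½ ^ suc k * ι (suc k) * inv n) (ι*inv≡1 k)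
        (solve 4 (λ h i r p → h :* (i :* i) :* r :* p := r :* (h :* i) :+ h :* i :* r :* (i :* p :- con 1ℚ)) refl (½ ^ suc k) (ι (suc k)) (inv n) (inv (suc k)))))

V~li : ∀ s → Asymptotic (λ n → V n (suc s) n) (liPartial (suc s) ½)
V~li s = asymptotic-trans {λ n → V n (suc s) n} {λ n → liPartial (suc s) ½ (n ℕ.+ n)} {liPartial (suc s) ½}
  (asymptotic-sym {λ n → liPartial (suc s) ½ (n ℕ.+ n)} {λ n → V n (suc s) n} (null-bounded-by-inv (1ℚ + 1ℚ) (λ n → li-V-error n s)))
  (cauchy-double {liPartial (suc s) ½} (li-cauchy (suc s)))

V~zeta : ∀ s → Asymptotic (λ n → V n (suc (suc s)) (n ℕ.+ n)) (zetaPartial (suc (suc s)))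
V~zeta s = asymptotic-trans {λ n → V n (suc (suc s)) (n ℕ.+ n)} {λ n → zetaPartial (suc (suc s)) (n ℕ.+ n)} {zetaPartial (suc (suc s))}
  (≡⇒asymptotic (λ n → V-at-N n (suc (suc s)))) (cauchy-double {zetaPartial (suc (suc s))} (zeta-cauchy s))

-- Expressible sequences

Term : Set
Term = ℚ × List⁺ (Σ ℝ Generator)

value : List Term → ℕ → ℚ
value []              n = 0ℚ
value ((q , gs) ∷ ts) n = q * seq (product gs) n + value ts n

value≡ : ∀ ts n → value ts n ≡ seq (linearCombination ts) n
value≡ []              n = refl
value≡ ((q , gs) ∷ ts) n = cong (q * seq (product gs) n +_) (value≡ ts n)

value-cauchy : ∀ ts → Cauchy (value ts)
value-cauchy ts = cauchy-cong (value≡ ts) (cauchy (linearCombination ts))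

value-++ : ∀ ts us n → value (ts ++ us) n ≡ value ts n + value us n
value-++ []             us n = sym (+-identityˡ (value us n))
value-++ ((q , gs) ∷ ts) us n = trans (cong (q * seq (product gs) n +_) (value-++ ts us n))
  (sym (+-assoc (q * seq (product gs) n) (value ts n) (value us n)))

scale : ℚ → List Term → List Term
scale c = map (λ (q , gs) → c * q , gs)

value-scale : ∀ c ts n → value (scale c ts) n ≡ c * value ts n
value-scale c []              n = sym (*-zeroʳ c)
value-scale c ((q , gs) ∷ ts) n = trans (cong (c * q * seq (product gs) n +_) (value-scale c ts n))
  (solve 4 (λ c q g v → c :* q :* g :+ c :* v := c :* (q :* g :+ v)) refl c q (seq (product gs) n) (value ts n))

product-⁺++⁺ : ∀ gs hs n → seq (product (gs ⁺++⁺ hs)) n ≡ seq (product gs) n * seq (product hs) n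
product-⁺++⁺ (g List⁺.∷ gs) hs n = go g gs
  where
  go : ∀ g gs → seq (product ((g List⁺.∷ gs) ⁺++⁺ hs)) n ≡ seq (product (g List⁺.∷ gs)) n * seq (product hs) n
  go g []        = refl
  go g (g′ ∷ gs) = trans (cong (seq (proj₁ g) n *_) (go g′ gs))
    (sym (*-assoc (seq (proj₁ g) n) (seq (product (g′ List⁺.∷ gs)) n) (seq (product hs) n)))

multiplyTerm : Term → List Term → List Term
multiplyTerm (q , gs) = map (λ (r , hs) → q * r , gs ⁺++⁺ hs)

value-multiplyTerm : ∀ q gs us n → value (multiplyTerm (q , gs) us) n ≡ q * seq (product gs) n * value us n
value-multiplyTerm q gs []              n = sym (*-zeroʳ (q * seq (product gs) n))
value-multiplyTerm q gs ((r , hs) ∷ us) n = trans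
  (cong₂ (λ x y → q * r * x + y) (product-⁺++⁺ gs hs n) (value-multiplyTerm q gs us n))
  (solve 5 (λ q r g h v → q :* r :* (g :* h) :+ q :* g :* v := q :* g :* (r :* h :+ v)) refl
    q r (seq (product gs) n) (seq (product hs) n) (value us n))

multiply : List Term → List Term → List Term
multiply []       us = []
multiply (t ∷ ts) us = multiplyTerm t us ++ multiply ts us

value-multiply : ∀ ts us n → value (multiply ts us) n ≡ value ts n * value us n
value-multiply []              us n = sym (*-zeroˡ (value us n))
value-multiply ((q , gs) ∷ ts) us n = trans (value-++ (multiplyTerm (q , gs) us) (multiply ts us) n)
  (trans (cong₂ _+_ (value-multiplyTerm q gs us n) (value-multiply ts us n))
    (sym (*-distribʳ-+ (value us n) (q * seq (product gs) n) (value ts n))))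

-- Stated for sequences rather than reals, so that discretised integrals can be related index by
-- index before their convergence is known; the Cauchy property of `value terms` then supplies it.
record Expr (u : ℕ → ℚ) : Set where
  constructor expr
  field
    terms  : List Term
    limit : Asymptotic u (value terms)

open Expr

expr-~ : ∀ {u : ℕ → ℚ} (v : ℕ → ℚ) → Asymptotic u v → Expr v → Expr u
expr-~ {u} v u~v (expr ts h) = expr ts (asymptotic-trans {u} {v} {value ts} u~v h)

expr-cong : ∀ {u v : ℕ → ℚ} → (∀ n → u n ≡ v n) → Expr v → Expr u
expr-cong {u} {v} h = expr-~ v (≡⇒asymptotic {u} {v} h)

expr-generator : ∀ x → Generator x → Expr (seq x)
expr-generator x g = expr ((1ℚ , (x , g) List⁺.∷ []) ∷ [])
  (≡⇒asymptotic {seq x} (λ n → solve 1 (λ x → x := con 1ℚ :* x :+ con 0ℚ) refl (seq x n)))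

expr-+ : ∀ {u v : ℕ → ℚ} → Expr u → Expr v → Expr (λ n → u n + v n)
expr-+ {u} {v} (expr ts h) (expr us k) = expr-~ (λ n → value ts n + value us n) (asymptotic-+ {u} {value ts} {v} {value us} h k)
  (expr (ts ++ us) (≡⇒asymptotic {λ n → value ts n + value us n} {value (ts ++ us)} (λ n → sym (value-++ ts us n))))

expr-scale : ∀ {u : ℕ → ℚ} c → Expr u → Expr (λ n → c * u n)
expr-scale {u} c (expr ts h) = expr-~ (λ n → c * value ts n) (asymptotic-scale {u} {value ts} c h)
  (expr (scale c ts) (≡⇒asymptotic {λ n → c * value ts n} {value (scale c ts)} (λ n → sym (value-scale c ts n))))

expr-- : ∀ {u v : ℕ → ℚ} → Expr u → Expr v → Expr (λ n → u n - v n)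
expr-- {u} {v} p q = expr-cong (λ n → solve 2 (λ x y → x :- y := x :+ con (- 1ℚ) :* y) refl (u n) (v n)) (expr-+ p (expr-scale (- 1ℚ) q))

expr-unscale : ∀ {u : ℕ → ℚ} k → Expr (λ n → ι (suc k) * u n) → Expr u
expr-unscale {u} k p = expr-cong (λ n → sym (modulo (u n) (ι*inv≡1 k)
  (solve 3 (λ i r u → r :* (i :* u) := u :+ u :* (i :* r :- con 1ℚ)) refl (ι (suc k)) (inv (suc k)) (u n)))) (expr-scale (inv (suc k)) p)

expr-* : ∀ {u v : ℕ → ℚ} → Expr u → Expr v → Expr (λ n → u n * v n)
expr-* {u} {v} (expr ts h) (expr us k) = expr-~ (λ n → value ts n * value us n)
  (asymptotic-* {u} {value ts} {v} {value us} h k (cauchy⇒bounded {value ts} (value-cauchy ts))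
    (cauchy⇒bounded {v} (asymptotic⇒cauchy v (value us) k (value-cauchy us))))
  (expr (multiply ts us) (≡⇒asymptotic {λ n → value ts n * value us n} {value (multiply ts us)} (λ n → sym (value-multiply ts us n))))

expr⇒expressible : ∀ ss → Expr (mzvPartial ss) → ExpressibleMZV ss
-- The linear combination itself is taken as the limit, so its expressibility is reflexivity.
expr⇒expressible ss (expr ts h) = x , asymptotic-trans {mzvPartial ss} {value ts} {seq x} h (≡⇒asymptotic (value≡ ts)) ,
  ts , ≡⇒asymptotic {seq x} {seq x} (λ n → refl)
  where
  x : ℝ
  x = linearCombination ts

-- Limits of the discretised integrals

li-expr : ∀ s → Expr (λ n → V n (suc s) n)
li-expr s = expr-~ (liPartial (suc s) ½) (V~li s) (expr-generator (mkℝ (liPartial (suc s) ½) (li-cauchy (suc s))) (isLi (suc s) (s≤s z≤n) (≡⇒asymptotic {liPartial (suc s) ½} {liPartial (suc s) ½} (λ n → refl))))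

zeta-expr : ∀ s → Expr (λ n → V n (suc (suc s)) (n ℕ.+ n))
zeta-expr s = expr-~ (zetaPartial (suc (suc s))) (V~zeta s) (expr-generator (mkℝ (zetaPartial (suc (suc s))) (zeta-cauchy s)) (isZeta (suc (suc s)) (s≤s (s≤s z≤n)) (≡⇒asymptotic {zetaPartial (suc (suc s))} {zetaPartial (suc (suc s))} (λ n → refl))))

-- The number ln 2 enters as Li₁(½).
E₁-expr : Expr (λ n → E n 1 n)
E₁-expr = expr-cong (λ n → sym (V₁≡E₁ n n (ℕ.m≤m+n n n))) (li-expr 0)

-- Powers of ln 2, divided by factorials. The induction starts at exponent 1, as a product of
-- generators has at least one factor.
E-expr : ∀ m → Expr (λ n → E n (suc m) n)
E-expr zero    = E₁-expr
E-expr (suc m) = expr-unscale (suc m) (expr-~ (λ n → E n 1 n * E n (suc m) n)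
  (asymptotic-sym {λ n → E n 1 n * E n (suc m) n} {λ n → ι (suc (suc m)) * E n (suc (suc m)) n} (E₁*E~ (suc m)))
  (expr-* E₁-expr (E-expr m)))

H-expr : ∀ m → Expr (λ n → H n (suc m) n)
H-expr m = expr-~ (λ n → E n (suc m) n) (H~E (suc m)) (E-expr m)

V-at-midpoint : ∀ s n → V n s (n ℕ.+ n ℕ.∸ n) ≡ V n s n
V-at-midpoint s n = cong (V n s) (ℕ.m+n∸n≡m n n)

-- The integral without logarithms is the part of ζ beyond the midpoint. The order `suc s` keeps the
-- divergent ζ(1) away.
T₀-expr : ∀ s → Expr (λ n → T n 0 (suc s) n)
T₀-expr s = expr-cong eq (expr-- (zeta-expr s) (li-expr (suc s)))
  where
  eq : ∀ n → T n 0 (suc s) n ≡ V n (suc (suc s)) (n ℕ.+ n) - V n (suc (suc s)) n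
  eq n = trans (solve 2 (λ x y → y := x :- (x :- y)) refl (V n (suc (suc s)) (n ℕ.+ n)) (T n 0 (suc s) n))
    (cong (λ x → V n (suc (suc s)) (n ℕ.+ n) - x) (trans (sym (T-zero-suc n (suc s) n (ℕ.m≤m+n n n))) (V-at-midpoint (suc (suc s)) n)))

-- Each integration by parts lowers j and raises s, keeping j + s fixed, until no logarithm is left.
T-expr : ∀ j s → Expr (λ n → T n (suc j) s n)
T-expr j s = expr-cong eq (expr-- (previous j) (expr-* (H-expr j) (li-expr s)))
  where
  previous : ∀ j → Expr (λ n → T n j (suc s) n)
  previous zero    = T₀-expr s
  previous (suc j) = T-expr j (suc s)
  eq : ∀ n → T n (suc j) s n ≡ T n j (suc s) n - H n (suc j) n * V n (suc s) n
  eq n = trans (solve 2 (λ x y → y := x :- (x :- y)) refl (T n j (suc s) n) (T n (suc j) s n))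
    (cong (λ x → T n j (suc s) n - x) (trans (sym (T-suc n j s n (ℕ.m≤m+n n n))) (cong (H n (suc j) n *_) (V-at-midpoint (suc s) n))))

E/-expr : ∀ k → Expr (λ n → E/ n (suc k) n)
E/-expr k = expr-~ (λ n → H/ n (suc k) n) (asymptotic-sym {λ n → H/ n (suc k) n} {λ n → E/ n (suc k) n} (H/~E/ (suc k)))
  (expr-cong (λ n → sym (T₀≡H/ n (suc k))) (T-expr k 0))

-- The product relation is solved for its term with m + 1 iterations. The other terms have m
-- iterations but involve k + 1 as well, so the induction on m runs over all k at once.
iterate-E/-expr : ∀ m k → Expr (λ n → iterate (ρ n) m (E/ n (suc k)) n)
iterate-E/-expr zero    k = E/-expr k
iterate-E/-expr (suc m) k = expr-unscale m (expr-~ (λ n → E n 1 n * X m k n - ι (suc (suc k)) * X m (suc k) n)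
  (asymptotic-sym {λ n → E n 1 n * X m k n - ι (suc (suc k)) * X m (suc k) n} {λ n → ι (suc m) * X (suc m) k n} (E₁*iterate-E/~ k m))
  (expr-- (expr-* E₁-expr (iterate-E/-expr m k)) (expr-scale (ι (suc (suc k))) (iterate-E/-expr m (suc k)))))
  where
  X : ℕ → ℕ → ℕ → ℚ
  X m k n = iterate (ρ n) m (E/ n (suc k)) n

-- The two families of alternating values

expressible-bar1-bar1 : ∀ m → ExpressibleMZV (bar 1 ∷ replicate m (plain 1) ++ bar 1 ∷ [])
expressible-bar1-bar1 m = expr⇒expressible (bar 1 ∷ ss) (expr-~ (mzv-smoothed ss) (mzv~smoothed ss)
  (expr-~ (λ n → sgn (suc m) * E/ n (suc m) n) (smoothed-1s-bar1~ m) (expr-scale (sgn (suc m)) (E/-expr m))))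
  where
  ss : List Entry
  ss = replicate m (plain 1) ++ bar 1 ∷ []

expressible-bar1-2 : ∀ m k → ExpressibleMZV (bar 1 ∷ replicate m (plain 1) ++ plain 2 ∷ replicate k (plain 1))
expressible-bar1-2 m k = expr⇒expressible (bar 1 ∷ ss) (expr-~ (mzv-smoothed ss) (mzv~smoothed ss)
  (expr-cong (λ n → smoothed-1s-2-1s n m k)
    (expr-scale (sgn (suc m) * sgn (suc k)) (expr-+ (iterate-E/-expr (suc m) k) (E-expr (m ℕ.+ suc (suc k)))))))
  where
  ss : List Entry
  ss = replicate m (plain 1) ++ plain 2 ∷ replicate k (plain 1)

theorem6p1 : (m k : ℕ) → .{{_ : NonZero m}} → .{{_ : NonZero k}} →
    ExpressibleMZV (bar 1 ∷ replicate (pred m) (plain 1) ++ bar 1 ∷ [])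
    × ExpressibleMZV (bar 1 ∷ replicate (pred m) (plain 1) ++ plain 2 ∷ replicate (pred k) (plain 1))
theorem6p1 m k = expressible-bar1-bar1 (pred m) , expressible-bar1-2 (pred m) (pred k)
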